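{- Let $d$ be even, let $\mathcal{G}$ be a class of generators of the hyperbolic quadric $Q^+(2d-1,q)$, let $\mathcal{L}\subseteq\mathcal{G}$, put $x=|\mathcal{L}|/\prod_{k=1}^{d-2}(q^k+1)$, and let $i$ be an integer with $1\le i\le d/2$. Then $\mathcal{L}$ is a Cameron-Liebler set of generators in $\mathcal{G}$ if and only if for every generator $\pi\in\mathcal{G}$ the number of elements of $\mathcal{L}$ meeting $\pi$ in a $(d-2i-1)$-space equals $$\left((x-1)\begin{bmatrix} d-1\\ 2i-1\end{bmatrix}_q+q^{2i-1}\begin{bmatrix} d-1\\ 2i\end{bmatrix}_q\right)q^{(2i-1)(i-1)}\ \text{ if }\pi\in\mathcal{L},\qquad x\begin{bmatrix} d-1\\ 2i-1\end{bmatrix}_q q^{(2i-1)(i-1)}\ \text{ if }\pi\notin\mathcal{L}.$$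
   Context: The generators of the hyperbolic quadric $Q^+(2d-1,q)$ are its totally singular subspaces of projective dimension $d-1$; they split into two classes such that two generators are in the same class iff the projective dimension of their intersection is $\equiv d \pmod 2$. A $(-1)$-space means the empty subspace. $\begin{bmatrix} a\\ b\end{bmatrix}_q=\prod_{k=1}^b\frac{q^{a-b+k}-1}{q^k-1}$. A set $\mathcal{L}$ of generators of one class $\mathcal{G}$, with characteristic vector $\chi\in\mathbb{R}^{\mathcal{G}}$, is a Cameron-Liebler set of generators in $\mathcal{G}$ if $\chi\in\mathrm{im}(A_{\mathcal{G}}^T)$, where $A_{\mathcal{G}}$ is the real incidence matrix of points of $Q^+(2d-1,q)$ versus generators in $\mathcal{G}$; its parameter is $x=|\mathcal{L}|/\prod_{k=1}^{d-2}(q^k+1)$ (so the set of generators of $\mathcal{G}$ through a point has parameter $1$).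
   Formalization: The image of the transposed point-generator incidence matrix, which defines Cameron-Liebler sets, is taken over the rationals instead of the reals; two generators are in the same class iff their intersection has projective dimension ≡ d-1 (mod 2), the standard parity. Two generators are taken to be in the same class iff the projective dimension of their intersection is ≡ d−1 (mod 2), not ≡ d as the setting says; the latter is inconsistent, since a generator meets itself in projective dimension d−1. -}

module Defs where

open import Data.Nat as ℕ using (ℕ; zero; suc; _^_; NonZero)
open import Data.Nat.Properties using (m*n≢0)
open import Data.Fin using (Fin)
open import Data.Bool using (Bool; true; _∧_)
open import Data.Vec using (Vec; []; _∷_; zipWith; map; replicate)
open import Data.List using (List; []; _∷_)
open import Data.List.Relation.Unary.All using (All)
open import Data.List.Relation.Unary.Any using (Any)
open import Data.List.Relation.Unary.AllPairs using (AllPairs)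
open import Data.Product using (Σ; ∃; _×_; _,_)
open import Data.Integer using (+_)
open import Data.Rational as ℚ using (ℚ; _/_)
open import Algebra.Structures using (IsCommutativeRing)
open import Relation.Binary.PropositionalEquality using (_≡_)
open import Relation.Nullary using (¬_)

-- A finite field of order q, with carrier Fin q.
-- (Every finite field of order q is isomorphic to such a structure.)

record FiniteField (q : ℕ) : Set where
  infixl 6 _+_
  infixl 7 _*_
  field
    _+_ _*_ : Fin q → Fin q → Fin q
    -_      : Fin q → Fin q
    0# 1#   : Fin q
    isCommutativeRing : IsCommutativeRing _≡_ _+_ _*_ -_ 0# 1#
    0≢1     : ¬ (0# ≡ 1#)
    inverse : ∀ x → ¬ (x ≡ 0#) → ∃ λ y → x * y ≡ 1#

module Geometry {q : ℕ} (F : FiniteField q) (d : ℕ) where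
  open FiniteField F

  -- The ambient vector space F^(2d), written as d coordinate pairs
  -- (x_{2j}, x_{2j+1}).
  V : Set
  V = Vec (Fin q × Fin q) d

  zeroV : V
  zeroV = replicate d (0# , 0#)

  _+V_ : V → V → V
  _+V_ = zipWith (λ { (a , b) (c , e) → (a + c , b + e) })

  _·V_ : Fin q → V → V
  c ·V v = map (λ { (a , b) → (c * a , c * b) }) v

  -- The hyperbolic quadratic form Q(x) = x0 x1 + x2 x3 + … + x_{2d-2} x_{2d-1};
  -- its zero set is the hyperbolic quadric Q⁺(2d-1,q).
  Qf : ∀ {n} → Vec (Fin q × Fin q) n → Fin q
  Qf []             = 0#
  Qf ((a , b) ∷ v)  = a * b + Qf v

  -- Subsets of V (decidable membership, V is finite).
  Sub : Set
  Sub = V → Bool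

  _∈S_ : V → Sub → Set
  v ∈S S = S v ≡ true

  _≈S_ : Sub → Sub → Set
  S ≈S T = ∀ v → S v ≡ T v

  _∩S_ : Sub → Sub → Sub
  (S ∩S T) v = S v ∧ T v

  _⊆S_ : Sub → Sub → Set
  S ⊆S T = ∀ v → v ∈S S → v ∈S T

  lincomb : ∀ {k} → Vec (Fin q) k → Vec V k → V
  lincomb []       []       = zeroV
  lincomb (c ∷ cs) (b ∷ bs) = (c ·V b) +V lincomb cs bs

  HasDim : Sub → ℕ → Set
  HasDim S k = Σ (Vec V k) λ b →
      (∀ (c : Vec (Fin q) k) → lincomb c b ≡ zeroV → c ≡ replicate k 0#)
    × (∀ v → v ∈S S → ∃ λ (c : Vec (Fin q) k) → lincomb c b ≡ v)
    × (∀ (c : Vec (Fin q) k) → lincomb c b ∈S S)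

  TotallySingular : Sub → Set
  TotallySingular S = ∀ v → v ∈S S → Qf v ≡ 0#

  IsPoint : Sub → Set
  IsPoint P = HasDim P 1 × TotallySingular P

  IsGenerator : Sub → Set
  IsGenerator π = HasDim π d × TotallySingular π

  -- π and ρ lie in the same class: their intersection has projective
  -- dimension ≡ d-1 (mod 2), i.e. vector dimension ≡ d (mod 2).
  SameClass : Sub → Sub → Set
  SameClass π ρ = ∃ λ k → HasDim (π ∩S ρ) k × (k ℕ.% 2 ≡ d ℕ.% 2)

  -- the class 𝒢 of generators containing the generator ρ
  InClass : Sub → Sub → Set
  InClass ρ π = IsGenerator π × SameClass π ρ

  _∈L_ : Sub → List Sub → Set
  π ∈L L = Any (π ≈S_) L

  IsGenSetIn : Sub → List Sub → Set
  IsGenSetIn ρ L = All (InClass ρ) L × AllPairs (λ σ τ → ¬ (σ ≈S τ)) L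

  PointList : List Sub → Set
  PointList ps = All IsPoint ps
               × AllPairs (λ σ τ → ¬ (σ ≈S τ)) ps
               × (∀ P → IsPoint P → P ∈L ps)

data CountIn {A : Set} (P : A → Set) : List A → ℕ → Set where
  c-nil  : CountIn P [] 0
  c-yes  : ∀ {x xs n} → P x → CountIn P xs n → CountIn P (x ∷ xs) (suc n)
  c-no   : ∀ {x xs n} → ¬ P x → CountIn P xs n → CountIn P (x ∷ xs) n

data SumIn {A : Set} (P : A → Set) (y : A → ℚ) : List A → ℚ → Set where
  s-nil  : SumIn P y [] ℚ.0ℚ
  s-yes  : ∀ {x xs s} → P x → SumIn P y xs s → SumIn P y (x ∷ xs) (y x ℚ.+ s)
  s-no   : ∀ {x xs s} → ¬ P x → SumIn P y xs s → SumIn P y (x ∷ xs) s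

module CameronLiebler {q : ℕ} (F : FiniteField q) (d : ℕ) where
  open Geometry F d

  -- L is a Cameron–Liebler set of generators in the class 𝒢 of ρ:
  -- χ_L ∈ im(A_𝒢ᵀ), i.e. there is a weight y on the points of the quadric
  -- with  Σ_{P ∈ π} y(P) = χ_L(π)  for every π ∈ 𝒢.
  -- (A_𝒢 is rational, so solvability over ℝ ⇔ solvability over ℚ.)
  IsCLSet : Sub → List Sub → Set
  IsCLSet ρ L = Σ (List Sub) λ ps → PointList ps × Σ (Sub → ℚ) λ y →
    ∀ π → InClass ρ π →
        (π ∈L L → SumIn (λ P → P ⊆S π) y ps ℚ.1ℚ)
      × (¬ (π ∈L L) → SumIn (λ P → P ⊆S π) y ps ℚ.0ℚ)

-- Gaussian binomial [a b]_q via the q-Pascal rule; equals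
-- ∏_{k=1}^{b} (q^{a-b+k}-1)/(q^k-1) for b ≤ a, and 0 for b > a.
gauss : ℕ → ℕ → ℕ → ℕ
gauss q a       zero    = 1
gauss q zero    (suc b) = 0
gauss q (suc a) (suc b) = gauss q a b ℕ.+ q ^ suc b ℕ.* gauss q a (suc b)

prodPlus : ℕ → ℕ → ℕ
prodPlus q zero    = 1
prodPlus q (suc m) = prodPlus q m ℕ.* suc (q ^ suc m)

prodPlus-nz : ∀ q m → NonZero (prodPlus q m)
prodPlus-nz q zero    = _
prodPlus-nz q (suc m) = m*n≢0 (prodPlus q m) (suc (q ^ suc m)) {{prodPlus-nz q m}}

ℕtoℚ : ℕ → ℚ
ℕtoℚ n = + n / 1

param : ℕ → ℕ → ℕ → ℚ
param q d n = (+ n / prodPlus q (d ℕ.∸ 2)) {{prodPlus-nz q (d ℕ.∸ 2)}}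

countIn : ℕ → ℕ → ℕ → ℚ → ℚ
countIn q d i x =
  ((x ℚ.- ℚ.1ℚ) ℚ.* ℕtoℚ (gauss q (d ℕ.∸ 1) (2 ℕ.* i ℕ.∸ 1))
    ℚ.+ ℕtoℚ (q ^ (2 ℕ.* i ℕ.∸ 1) ℕ.* gauss q (d ℕ.∸ 1) (2 ℕ.* i)))
  ℚ.* ℕtoℚ (q ^ ((2 ℕ.* i ℕ.∸ 1) ℕ.* (i ℕ.∸ 1)))

countOut : ℕ → ℕ → ℕ → ℚ → ℚ
countOut q d i x =
  x ℚ.* ℕtoℚ (gauss q (d ℕ.∸ 1) (2 ℕ.* i ℕ.∸ 1) ℕ.* q ^ ((2 ℕ.* i ℕ.∸ 1) ℕ.* (i ℕ.∸ 1)))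

-- For generators π, σ write codim(σ, π) for the codimension of σ ∩ π in σ, and let A be the matrix of
-- the relation codim = 2i. For a totally singular t-space T the number of generators σ ⊇ T with
-- codim(σ, π) = k is the coefficient of z^(k-a) in ∏_{j < d-t} (1 + qʲ z), where a is the codimension
-- of T ∩ π in T; this follows by induction on d - t, counting flags T ⊂ T + v ⊆ σ. In particular
-- generators sharing a (d-1)-space have codimensions in π that differ by one, which gives the two
-- classes, and the incidence functions [T ⊆ π] behave well under A:
-- A [T ⊆ π] = Λₜ [T ⊆ π] + (combination of such functions with smaller T), where Λₜ is the coefficient
-- of z^(2i) in ∏_{r < t} (1 - qʳ z) ∏_{j < d-t} (1 + qʲ z).
-- If χ is in the span of the points, the case t = 1 gives A χ = Λ₁ χ + const, and the constant is found
-- by counting the generators of the class through a point. Conversely, any χ is a combination of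
-- functions [T ⊆ π] with dim T ≤ d/2; if A χ = Λ₁ χ + const, then (Λ₁ - Λₜ) χ loses the terms of
-- dimension t, and Λₜ ≠ Λ₁ for 2 ≤ t ≤ d/2 (the two have different q-adic valuations for i ≥ 2, as
-- have Λₜ + 1 and Λ₁ + 1 for i = 1), so χ descends to a combination of points.

module Submission where

open import Defs
open import Data.Nat using (ℕ; zero; suc; _+_; _%_; _≤_; _<_; _*_; _∸_; _^_; z≤n; s≤s; NonZero)
import Data.Nat
import Data.Nat.Properties as ℕₚ
open import Data.Nat.Solver using (module +-*-Solver)
import Data.Integer as ℤ
import Data.Integer.Properties as ℤₚ
import Data.Integer.Solver
import Data.Rational as ℚ
import Data.Rational.Properties as ℚₚ
import Data.Rational.Solver
import Data.Rational.Unnormalised as ℚᵘ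
import Data.Rational.Unnormalised.Properties as ℚᵘₚ
open import Data.Bool using (Bool; true; false; _∧_; not; if_then_else_)
import Data.Bool.Properties as 𝔹ₚ
open import Data.Fin using (Fin)
import Data.Fin.Properties as Finₚ
open import Data.Vec using (Vec; []; _∷_; replicate; zipWith)
import Data.Vec as Vec
import Data.Vec.Properties as Vecₚ
open import Data.List using (List; []; _∷_; length; _++_; filter; concatMap; allFin)
import Data.List as List
import Data.List.Properties as Listₚ
open import Data.List.Relation.Unary.All as All using (All; []; _∷_)
import Data.List.Relation.Unary.All.Properties as Allₚ
open import Data.List.Relation.Unary.Any as Any using (Any; here; there)
open import Data.List.Relation.Unary.AllPairs using (AllPairs; []; _∷_)
import Data.List.Relation.Unary.AllPairs.Properties as AllPairsₚ
open import Data.Product using (∃; _×_; _,_; proj₁; proj₂)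
open import Data.Sum using (_⊎_; inj₁; inj₂)
open import Data.Empty using (⊥; ⊥-elim)
import Data.Unit
import Relation.Binary
import Algebra.Properties.Ring
open import Relation.Binary.PropositionalEquality
  using (_≡_; _≢_; refl; sym; trans; cong; cong₂; subst; module ≡-Reasoning)
open import Relation.Nullary using (¬_; Dec; yes; no; does)
import Relation.Nullary.Decidable as Dec
open import Algebra.Structures using (IsCommutativeSemiring; IsCommutativeRing)
open import Algebra.Bundles using (CommutativeSemiring; CommutativeRing)
open import Function.Bundles using (_⇔_; mk⇔)
open ℚ using (ℚ; 0ℚ; 1ℚ) renaming (_+_ to _+ᵣ_; _*_ to _*ᵣ_; _-_ to _-ᵣ_)

bool-ext : ∀ {a b} → (a ≡ true → b ≡ true) → (b ≡ true → a ≡ true) → a ≡ b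
bool-ext {true}  {true}  f g = refl
bool-ext {true}  {false} f g = sym (f refl)
bool-ext {false} {true}  f g = g refl
bool-ext {false} {false} f g = refl

∧-intro : ∀ {a b} → a ≡ true → b ≡ true → a ∧ b ≡ true
∧-intro refl refl = refl

∧-fst : ∀ {a b} → a ∧ b ≡ true → a ≡ true
∧-fst {true} p = refl

∧-snd : ∀ {a b} → a ∧ b ≡ true → b ≡ true
∧-snd {true} p = p

not-true : ∀ {a} → ¬ (a ≡ true) → a ≡ false
not-true {true}  n = ⊥-elim (n refl)
not-true {false} n = refl

false≢true : ∀ {a} → a ≡ false → ¬ (a ≡ true)
false≢true refl ()

bool-cases : ∀ (a : Bool) → (a ≡ true) ⊎ (a ≡ false)
bool-cases true  = inj₁ refl
bool-cases false = inj₂ refl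

module _ {P : Set} where
  does-intro : (d : Dec P) → P → does d ≡ true
  does-intro (yes _) p = refl
  does-intro (no ¬p) p = ⊥-elim (¬p p)

  does-elim : (d : Dec P) → does d ≡ true → P
  does-elim (yes p) _ = p

does-⇔ : ∀ {P Q : Set} (d : Dec P) (e : Dec Q) → (P → Q) → (Q → P) → does d ≡ does e
does-⇔ d e f g = bool-ext (λ p → does-intro e (f (does-elim d p)))
                          (λ p → does-intro d (g (does-elim e p)))

module Sums {R : Set} {_⊕_ _⊗_ : R → R → R} {0# 1# : R}
            (isCSR : IsCommutativeSemiring _≡_ _⊕_ _⊗_ 0# 1#) where
  open IsCommutativeSemiring isCSR
    using (+-assoc; +-comm; +-identityˡ; +-identityʳ; *-comm; *-assoc; distribˡ; zeroˡ; zeroʳ;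
           *-identityˡ; *-identityʳ)

  private
    bundle : CommutativeSemiring _ _
    bundle = record { isCommutativeSemiring = isCSR }
  open import Algebra.Solver.CommutativeMonoid (CommutativeSemiring.+-commutativeMonoid bundle)
    using (solve; _⊜_) renaming (_⊕_ to _:+_)

  𝟙 : Bool → R
  𝟙 true  = 1#
  𝟙 false = 0#

  𝟙-∧ : ∀ a b → 𝟙 (a ∧ b) ≡ 𝟙 a ⊗ 𝟙 b
  𝟙-∧ true  b = sym (*-identityˡ _)
  𝟙-∧ false b = sym (zeroˡ _)

  𝟙-on : ∀ a {x y} → (a ≡ true → x ≡ y) → 𝟙 a ⊗ x ≡ 𝟙 a ⊗ y
  𝟙-on true  p = cong (1# ⊗_) (p refl)
  𝟙-on false p = trans (zeroˡ _) (sym (zeroˡ _))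

  𝟙-yes : ∀ {a} → a ≡ true → ∀ x → 𝟙 a ⊗ x ≡ x
  𝟙-yes refl x = *-identityˡ x

  𝟙-split : ∀ a x → x ≡ (𝟙 a ⊗ x) ⊕ (𝟙 (not a) ⊗ x)
  𝟙-split true  x = sym (trans (cong₂ _⊕_ (*-identityˡ x) (zeroˡ x)) (+-identityʳ x))
  𝟙-split false x = sym (trans (cong₂ _⊕_ (zeroˡ x) (*-identityˡ x)) (+-identityˡ x))

  module _ {A : Set} where
    ∑ : List A → (A → R) → R
    ∑ []       f = 0#
    ∑ (x ∷ xs) f = f x ⊕ ∑ xs f

    ∑-cong : ∀ xs {f g : A → R} → (∀ x → f x ≡ g x) → ∑ xs f ≡ ∑ xs g
    ∑-cong []       p = refl
    ∑-cong (x ∷ xs) p = cong₂ _⊕_ (p x) (∑-cong xs p)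

    ∑-congAll : ∀ {P : A → Set} {xs} → All P xs → {f g : A → R} →
                (∀ x → P x → f x ≡ g x) → ∑ xs f ≡ ∑ xs g
    ∑-congAll []         p = refl
    ∑-congAll (px ∷ pxs) p = cong₂ _⊕_ (p _ px) (∑-congAll pxs p)

    ∑-0 : ∀ (xs : List A) → ∑ xs (λ _ → 0#) ≡ 0#
    ∑-0 []       = refl
    ∑-0 (x ∷ xs) = trans (+-identityˡ _) (∑-0 xs)

    ∑-⊕ : ∀ xs (f g : A → R) → ∑ xs (λ x → f x ⊕ g x) ≡ ∑ xs f ⊕ ∑ xs g
    ∑-⊕ []       f g = sym (+-identityˡ 0#)
    ∑-⊕ (x ∷ xs) f g = trans (cong (_ ⊕_) (∑-⊕ xs f g))
      (solve 4 (λ a b c e → (a :+ b) :+ (c :+ e) ⊜ (a :+ c) :+ (b :+ e)) refl (f x) (g x) _ _)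

    ∑-*ˡ : ∀ xs c (f : A → R) → ∑ xs (λ x → c ⊗ f x) ≡ c ⊗ ∑ xs f
    ∑-*ˡ []       c f = sym (zeroʳ c)
    ∑-*ˡ (x ∷ xs) c f = trans (cong (_ ⊕_) (∑-*ˡ xs c f)) (sym (distribˡ c _ _))

    ∑-*ʳ : ∀ xs c (f : A → R) → ∑ xs (λ x → f x ⊗ c) ≡ ∑ xs f ⊗ c
    ∑-*ʳ xs c f = trans (∑-cong xs (λ x → *-comm _ c)) (trans (∑-*ˡ xs c f) (*-comm c _))

    ∑-++ : ∀ xs ys (f : A → R) → ∑ (xs ++ ys) f ≡ ∑ xs f ⊕ ∑ ys f
    ∑-++ []       ys f = sym (+-identityˡ _)
    ∑-++ (x ∷ xs) ys f = trans (cong (_ ⊕_) (∑-++ xs ys f)) (sym (+-assoc _ _ _))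

    ∑-filter : ∀ {P : A → Set} (P? : ∀ x → Dec (P x)) xs (f : A → R) →
               ∑ (filter P? xs) f ≡ ∑ xs (λ x → 𝟙 (does (P? x)) ⊗ f x)
    ∑-filter P? []       f = refl
    ∑-filter P? (x ∷ xs) f with P? x
    ... | yes _ = cong₂ _⊕_ (sym (*-identityˡ _)) (∑-filter P? xs f)
    ... | no  _ = trans (∑-filter P? xs f) (sym (trans (cong (_⊕ ∑ xs (λ x → 𝟙 (does (P? x)) ⊗ f x)) (zeroˡ (f x))) (+-identityˡ _)))

  ∑-swap : ∀ {A B : Set} (xs : List A) (ys : List B) (f : A → B → R) →
           ∑ xs (λ x → ∑ ys (f x)) ≡ ∑ ys (λ y → ∑ xs (λ x → f x y))
  ∑-swap []       ys f = sym (∑-0 ys)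
  ∑-swap (x ∷ xs) ys f = trans (cong (_ ⊕_) (∑-swap xs ys f)) (sym (∑-⊕ ys (f x) _))

  ∑-map : ∀ {A B : Set} (h : A → B) xs (f : B → R) →
          ∑ (List.map h xs) f ≡ ∑ xs (λ x → f (h x))
  ∑-map h []       f = refl
  ∑-map h (x ∷ xs) f = cong (_ ⊕_) (∑-map h xs f)

  ∑-concatMap : ∀ {A B : Set} (h : A → List B) xs (f : B → R) →
                ∑ (concatMap h xs) f ≡ ∑ xs (λ x → ∑ (h x) f)
  ∑-concatMap h []       f = refl
  ∑-concatMap h (x ∷ xs) f = trans (∑-++ (h x) _ f) (cong (_ ⊕_) (∑-concatMap h xs f))

open Sums ℕₚ.+-*-isCommutativeSemiring public

∑-mono : ∀ {A : Set} xs {f g : A → ℕ} → (∀ x → f x ≤ g x) → ∑ xs f ≤ ∑ xs g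
∑-mono []       p = z≤n
∑-mono (x ∷ xs) p = ℕₚ.+-mono-≤ (p x) (∑-mono xs p)

∑-pos : ∀ {A : Set} xs {f : A → ℕ} → 1 ≤ ∑ xs f → ∃ λ x → 1 ≤ f x
∑-pos (x ∷ xs) {f} p with f x in eq
... | suc n = x , subst (1 ≤_) (sym eq) (s≤s z≤n)
... | zero  = ∑-pos xs p

𝟙-≤1 : ∀ a → 𝟙 a ≤ 1
𝟙-≤1 true  = s≤s z≤n
𝟙-≤1 false = z≤n

-- Finite types, given by lists that meet every class of a decidable equivalence exactly once.

record Finite (A : Set) : Set₁ where
  field
    _~_   : A → A → Set
    ~-refl : ∀ {x} → x ~ x
    ~-sym : ∀ {x y} → x ~ y → y ~ x
    _~?_  : ∀ x y → Dec (x ~ y)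
    elems : List A
    once  : ∀ a → ∑ elems (λ x → 𝟙 (does (x ~? a))) ≡ 1

  ∑-pick : ∀ a (f : A → ℕ) → (∀ x → x ~ a → f x ≡ f a) →
           ∑ elems (λ x → 𝟙 (does (x ~? a)) * f x) ≡ f a
  ∑-pick a f inv = trans (∑-cong elems (λ x → 𝟙-on (does (x ~? a)) (λ p → inv x (does-elim (x ~? a) p))))
    (trans (∑-*ʳ elems (f a) _) (trans (cong (_* f a) (once a)) (ℕₚ.*-identityˡ _)))

  find : ∀ {P : A → Set} a → (∀ x → x ~ a → P x) → Any P elems
  find {P} a p = go elems (subst (1 ≤_) (sym (once a)) ℕₚ.≤-refl)
    where
    go : ∀ xs → 1 ≤ ∑ xs (λ x → 𝟙 (does (x ~? a))) → Any P xs
    go (x ∷ xs) h with x ~? a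
    ... | yes r = here (p x r)
    ... | no  _ = there (go xs h)

  ∃? : ∀ {P : A → Set} → (∀ x → Dec (P x)) → (∀ {x y} → x ~ y → P x → P y) → Dec (∃ P)
  ∃? {P} P? resp = Dec.map′ Any.satisfied (λ (a , pa) → find a (λ x r → resp (~-sym r) pa)) (Any.any? P? elems)

  ∀? : ∀ {P : A → Set} → (∀ x → Dec (P x)) → (∀ {x y} → x ~ y → P x → P y) → Dec (∀ x → P x)
  ∀? {P} P? resp = Dec.map′ (λ al a → resp′ a (find {λ x → x ~ a} a (λ x r → r)) al)
                           (λ f → All.tabulate (λ {x} _ → f x)) (All.all? P? elems)
    where
    resp′ : ∀ a {xs} → Any (λ x → x ~ a) xs → All P xs → P a
    resp′ a (here r)  (p ∷ _)  = resp r p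
    resp′ a (there i) (_ ∷ ps) = resp′ a i ps

  ∑-bij : ∀ (f : A → ℕ) (g h : A → A) → (∀ {x y} → x ~ y → f x ≡ f y) →
          (∀ {x y} → g y ~ x → y ~ h x) → (∀ {x y} → y ~ h x → g y ~ x) →
          ∑ elems (λ y → f (g y)) ≡ ∑ elems f
  ∑-bij f g h resp to from = begin
    ∑ elems (λ y → f (g y))
      ≡⟨ ∑-cong elems (λ y → sym (∑-pick (g y) f (λ x r → resp r))) ⟩
    ∑ elems (λ y → ∑ elems (λ x → 𝟙 (does (x ~? g y)) * f x))
      ≡⟨ ∑-swap elems elems _ ⟩
    ∑ elems (λ x → ∑ elems (λ y → 𝟙 (does (x ~? g y)) * f x))
      ≡⟨ ∑-cong elems (λ x → trans (∑-*ʳ elems (f x) _) (cong (_* f x)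
           (trans (∑-cong elems (λ y → cong 𝟙 (does-⇔ (x ~? g y) (y ~? h x)
              (λ r → to (~-sym r)) (λ r → ~-sym (from r))))) (once (h x))))) ⟩
    ∑ elems (λ x → 1 * f x)
      ≡⟨ ∑-cong elems (λ x → ℕₚ.*-identityˡ _) ⟩
    ∑ elems f ∎
    where open ≡-Reasoning

finFinite : ∀ n → Finite (Fin n)
finFinite n = record
  { _~_ = _≡_ ; ~-refl = refl ; ~-sym = sym ; _~?_ = Finₚ._≟_ ; elems = allFin n ; once = once′ n }
  where
  once′ : ∀ n (a : Fin n) → ∑ (allFin n) (λ x → 𝟙 (does (x Finₚ.≟ a))) ≡ 1
  once′ (suc n) a = trans (cong (𝟙 (does (Fin.zero Finₚ.≟ a)) +_)
      (trans (cong (λ l → ∑ l (λ x → 𝟙 (does (x Finₚ.≟ a)))) (sym (Listₚ.map-tabulate (λ x → x) Fin.suc)))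
             (∑-map Fin.suc (allFin n) _))) (rest a)
    where
    rest : ∀ a → 𝟙 (does (Fin.zero Finₚ.≟ a)) + ∑ (allFin n) (λ x → 𝟙 (does (Fin.suc x Finₚ.≟ a))) ≡ 1
    rest Fin.zero    = cong suc (∑-0 (allFin n))
    rest (Fin.suc a) = once′ n a

module _ {A B : Set} (FA : Finite A) (FB : Finite B) where
  private
    module A = Finite FA
    module B = Finite FB

  ×-finite : Finite (A × B)
  ×-finite = record
    { _~_ = λ (a , b) (a′ , b′) → a A.~ a′ × b B.~ b′
    ; ~-refl = A.~-refl , B.~-refl
    ; ~-sym = λ (p , r) → A.~-sym p , B.~-sym r
    ; _~?_ = λ (a , b) (a′ , b′) → (a A.~? a′) Dec.×-dec (b B.~? b′)
    ; elems = concatMap (λ a → List.map (a ,_) B.elems) A.elems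
    ; once = λ (a , b) → trans (∑-concatMap _ A.elems _)
        (trans (∑-cong A.elems (λ x → trans (∑-map (x ,_) B.elems _)
           (trans (∑-cong B.elems (λ y → 𝟙-∧ (does (x A.~? a)) _))
                  (trans (∑-*ˡ B.elems (𝟙 (does (x A.~? a))) _)
             (trans (cong (𝟙 (does (x A.~? a)) *_) (B.once b)) (ℕₚ.*-identityʳ _))))))
          (A.once a)) }

map-finite : ∀ {A B : Set} (FA : Finite A) → (∀ {x y} → Finite._~_ FA x y → x ≡ y) →
  (to : A → B) (from : B → A) → (∀ b → to (from b) ≡ b) → (∀ a → from (to a) ≡ a) → Finite B
map-finite {B = B} FA eq to from tf ft = record
  { _~_ = _≡_ ; ~-refl = refl ; ~-sym = sym ; _~?_ = dec
  ; elems = List.map to A.elems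
  ; once = λ b → trans (∑-map to A.elems _) (trans (∑-cong A.elems
      (λ x → cong 𝟙 (does-⇔ (dec (to x) b) (x A.~? from b)
         (λ { refl → subst (x A.~_) (sym (ft x)) A.~-refl })
         (λ r → trans (cong to (eq r)) (tf b))))) (A.once (from b))) }
  where
  module A = Finite FA
  dec : (x y : B) → Dec (x ≡ y)
  dec x y = Dec.map′ (λ r → trans (sym (tf x)) (trans (cong to (eq r)) (tf y)))
                     (λ { refl → A.~-refl }) (from x A.~? from y)

record FiniteSet (A : Set) : Set₁ where
  field
    finite : Finite A
    ~⇒≡    : ∀ {x y} → Finite._~_ finite x y → x ≡ y
  open Finite finite public

vecFinite : ∀ {A : Set} → FiniteSet A → ∀ n → FiniteSet (Vec A n)
vecFinite S zero    = record { finite = record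
  { _~_ = _≡_ ; ~-refl = refl ; ~-sym = sym ; _~?_ = λ { [] [] → yes refl }
  ; elems = [] ∷ [] ; once = λ { [] → refl } } ; ~⇒≡ = λ p → p }
vecFinite S (suc n) = record
  { finite = map-finite (×-finite S.finite R.finite) (λ (p , r) → cong₂ _,_ (S.~⇒≡ p) (R.~⇒≡ r))
      (λ (a , v) → a ∷ v) (λ { (a ∷ v) → a , v }) (λ { (a ∷ v) → refl }) (λ _ → refl)
  ; ~⇒≡ = λ p → p }
  where
  module S = FiniteSet S
  module R = FiniteSet (vecFinite S n)

∑-const-× : ∀ {A B : Set} (FA : Finite A) (FB : Finite B) →
  ∑ (Finite.elems (×-finite FA FB)) (λ _ → 1) ≡
  ∑ (Finite.elems FA) (λ _ → 1) * ∑ (Finite.elems FB) (λ _ → 1)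
∑-const-× FA FB = trans (∑-concatMap (λ a → List.map (a ,_) (Finite.elems FB)) (Finite.elems FA) _)
  (trans (∑-cong (Finite.elems FA) (λ x → trans (∑-map (x ,_) (Finite.elems FB) _) (sym (ℕₚ.*-identityˡ _))))
    (∑-*ʳ (Finite.elems FA) _ _))

∑-const-vec : ∀ {A : Set} (S : FiniteSet A) n →
  ∑ (FiniteSet.elems (vecFinite S n)) (λ _ → 1) ≡ ∑ (FiniteSet.elems S) (λ _ → 1) ^ n
∑-const-vec S zero    = refl
∑-const-vec S (suc n) = trans
  (∑-map (λ (a , v) → a ∷ v) (Finite.elems (×-finite (FiniteSet.finite S) (FiniteSet.finite (vecFinite S n)))) _)
  (trans (∑-const-× (FiniteSet.finite S) (FiniteSet.finite (vecFinite S n)))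
    (cong (∑ (FiniteSet.elems S) (λ _ → 1) *_) (∑-const-vec S n)))

module Space {q : ℕ} (F : FiniteField q) (d : ℕ) where
  open FiniteField F public using (0#; 1#; 0≢1; inverse)
    renaming (_+_ to _+F_; _*_ to _*F_; -_ to -F_; isCommutativeRing to ringF)
  open Geometry F d

  private
    R : CommutativeRing _ _
    R = record { isCommutativeRing = ringF }
  module F = CommutativeRing R
  open import Algebra.Solver.Ring.NaturalCoefficients.Default F.commutativeSemiring as FS
    using (_:+_; _:*_; _:=_; con)

  private
    Pair : Set
    Pair = Fin q × Fin q

    add : Pair → Pair → Pair
    add (a , b) (c , e) = (a +F c , b +F e)

    scale : Fin q → Pair → Pair
    scale c (a , b) = (c *F a , c *F b)

    map-zipWith : ∀ {A : Set} {f : A → A → A} {g : A → A} → (∀ a b → g (f a b) ≡ f (g a) (g b)) →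
      ∀ {n} (u v : Vec A n) → Vec.map g (zipWith f u v) ≡ zipWith f (Vec.map g u) (Vec.map g v)
    map-zipWith p []      []      = refl
    map-zipWith p (a ∷ u) (b ∷ v) = cong₂ _∷_ (p a b) (map-zipWith p u v)

    zipWith-maps : ∀ {A : Set} {f : A → A → A} {g h k : A → A} → (∀ a → k a ≡ f (g a) (h a)) →
      ∀ {n} (v : Vec A n) → Vec.map k v ≡ zipWith f (Vec.map g v) (Vec.map h v)
    zipWith-maps p []      = refl
    zipWith-maps p (a ∷ v) = cong₂ _∷_ (p a) (zipWith-maps p v)

    map-replicate′ : ∀ {A : Set} {g : A → A} {a b} → g a ≡ b → ∀ n → Vec.map g (replicate n a) ≡ replicate n b
    map-replicate′ p zero    = refl
    map-replicate′ p (suc n) = cong₂ _∷_ p (map-replicate′ p n)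

    map-const : ∀ {A : Set} {g : A → A} {b} → (∀ a → g a ≡ b) → ∀ {n} (v : Vec A n) → Vec.map g v ≡ replicate n b
    map-const p []      = refl
    map-const p (a ∷ v) = cong₂ _∷_ (p a) (map-const p v)

  -1# : Fin q
  -1# = -F 1#

  +V-assoc : ∀ u v w → (u +V v) +V w ≡ u +V (v +V w)
  +V-assoc = Vecₚ.zipWith-assoc (λ _ _ _ → cong₂ _,_ (F.+-assoc _ _ _) (F.+-assoc _ _ _))

  +V-comm : ∀ u v → u +V v ≡ v +V u
  +V-comm = Vecₚ.zipWith-comm (λ _ _ → cong₂ _,_ (F.+-comm _ _) (F.+-comm _ _))

  +V-idʳ : ∀ v → v +V zeroV ≡ v
  +V-idʳ = Vecₚ.zipWith-identityʳ (λ _ → cong₂ _,_ (F.+-identityʳ _) (F.+-identityʳ _))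

  +V-idˡ : ∀ v → zeroV +V v ≡ v
  +V-idˡ v = trans (+V-comm _ _) (+V-idʳ v)

  ·V-distribˡ : ∀ c u v → c ·V (u +V v) ≡ (c ·V u) +V (c ·V v)
  ·V-distribˡ c = map-zipWith (λ _ _ → cong₂ _,_ (F.distribˡ c _ _) (F.distribˡ c _ _))

  ·V-distribʳ : ∀ a b v → (a +F b) ·V v ≡ (a ·V v) +V (b ·V v)
  ·V-distribʳ a b = zipWith-maps (λ _ → cong₂ _,_ (F.distribʳ _ a b) (F.distribʳ _ a b))

  ·V-assoc : ∀ a b v → (a *F b) ·V v ≡ a ·V (b ·V v)
  ·V-assoc a b v = trans (Vecₚ.map-cong (λ _ → cong₂ _,_ (F.*-assoc a b _) (F.*-assoc a b _)) v)
                         (Vecₚ.map-∘ _ _ v)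

  1·V : ∀ v → 1# ·V v ≡ v
  1·V v = trans (Vecₚ.map-cong (λ _ → cong₂ _,_ (F.*-identityˡ _) (F.*-identityˡ _)) v) (Vecₚ.map-id v)

  0·V : ∀ v → 0# ·V v ≡ zeroV
  0·V v = map-const (λ _ → cong₂ _,_ (F.zeroˡ _) (F.zeroˡ _)) v

  ·V-zero : ∀ c → c ·V zeroV ≡ zeroV
  ·V-zero c = map-replicate′ (cong₂ _,_ (F.zeroʳ c) (F.zeroʳ c)) d

  -V_ : V → V
  -V v = -1# ·V v

  +V-inv : ∀ v → v +V (-V v) ≡ zeroV
  +V-inv v = trans (cong (_+V (-V v)) (sym (1·V v))) (trans (sym (·V-distribʳ 1# -1# v))
    (trans (cong (_·V v) (F.-‿inverseʳ 1#)) (0·V v)))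

  +V-cancel : ∀ v w → (v +V w) +V (-V w) ≡ v
  +V-cancel v w = trans (+V-assoc v w _) (trans (cong (v +V_) (+V-inv w)) (+V-idʳ v))

  +V-cancel′ : ∀ v w → (v +V (-V w)) +V w ≡ v
  +V-cancel′ v w = trans (+V-assoc v _ w)
    (trans (cong (v +V_) (trans (+V-comm _ w) (+V-inv w))) (+V-idʳ v))

  inv : Fin q → Fin q
  inv c with c Finₚ.≟ 0#
  ... | yes _ = 0#
  ... | no c≢0 = proj₁ (inverse c c≢0)

  inv-* : ∀ {c} → c ≢ 0# → c *F inv c ≡ 1#
  inv-* {c} c≢0 with c Finₚ.≟ 0#
  ... | yes p = ⊥-elim (c≢0 p)
  ... | no c≢0′ = proj₂ (inverse c c≢0′)

  inv-·V : ∀ {c} → c ≢ 0# → ∀ v → inv c ·V (c ·V v) ≡ v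
  inv-·V c≢0 v = trans (sym (·V-assoc _ _ v))
    (trans (cong (_·V v) (trans (F.*-comm _ _) (inv-* c≢0))) (1·V v))

  B : ∀ {n} → Vec Pair n → Vec Pair n → Fin q
  B []            []            = 0#
  B ((a , b) ∷ u) ((c , e) ∷ v) = (a *F e +F c *F b) +F B u v

  private
    Q-+′ : ∀ {n} (u v : Vec Pair n) → Qf (zipWith add u v) ≡ (Qf u +F Qf v) +F B u v
    Q-+′ [] [] = sym (trans (F.+-identityʳ _) (F.+-identityʳ _))
    Q-+′ ((a , b) ∷ u) ((c , e) ∷ v) rewrite Q-+′ u v =
      FS.solve 7 (λ a b c e x y z → (a :+ c) :* (b :+ e) :+ ((x :+ y) :+ z) :=
         ((a :* b :+ x) :+ (c :* e :+ y)) :+ ((a :* e :+ c :* b) :+ z)) refl a b c e (Qf u) (Qf v) (B u v)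

    Q-·′ : ∀ {n} k (u : Vec Pair n) → Qf (Vec.map (scale k) u) ≡ (k *F k) *F Qf u
    Q-·′ k [] = sym (F.zeroʳ _)
    Q-·′ k ((a , b) ∷ u) rewrite Q-·′ k u =
      FS.solve 4 (λ k a b x → (k :* a) :* (k :* b) :+ (k :* k) :* x := (k :* k) :* (a :* b :+ x)) refl k a b (Qf u)

    B-+′ : ∀ {n} (u u′ v : Vec Pair n) → B (zipWith add u u′) v ≡ B u v +F B u′ v
    B-+′ [] [] [] = sym (F.+-identityʳ _)
    B-+′ ((a , b) ∷ u) ((a′ , b′) ∷ u′) ((c , e) ∷ v) rewrite B-+′ u u′ v =
      FS.solve 8 (λ a b a′ b′ c e x y → ((a :+ a′) :* e :+ c :* (b :+ b′)) :+ (x :+ y) :=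
        ((a :* e :+ c :* b) :+ x) :+ ((a′ :* e :+ c :* b′) :+ y)) refl a b a′ b′ c e (B u v) (B u′ v)

    B-·′ : ∀ {n} k (u v : Vec Pair n) → B (Vec.map (scale k) u) v ≡ k *F B u v
    B-·′ k [] [] = sym (F.zeroʳ _)
    B-·′ k ((a , b) ∷ u) ((c , e) ∷ v) rewrite B-·′ k u v =
      FS.solve 6 (λ k a b c e x → ((k :* a) :* e :+ c :* (k :* b)) :+ k :* x :=
        k :* ((a :* e :+ c :* b) :+ x)) refl k a b c e (B u v)

    B-sym′ : ∀ {n} (u v : Vec Pair n) → B u v ≡ B v u
    B-sym′ [] [] = refl
    B-sym′ ((a , b) ∷ u) ((c , e) ∷ v) = cong₂ _+F_ (F.+-comm _ _) (B-sym′ u v)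

    B-0′ : ∀ {n} (u : Vec Pair n) → B u (replicate n (0# , 0#)) ≡ 0#
    B-0′ [] = refl
    B-0′ ((a , b) ∷ u) = trans (cong₂ _+F_ (trans (cong₂ _+F_ (F.zeroʳ a) (F.zeroˡ b)) (F.+-identityʳ _)) (B-0′ u))
      (F.+-identityʳ _)

    B-nondeg′ : ∀ {n} (u : Vec Pair n) → (∀ v → B u v ≡ 0#) → u ≡ replicate n (0# , 0#)
    B-nondeg′ [] p = refl
    B-nondeg′ ((a , b) ∷ u) p = cong₂ _∷_
      (cong₂ _,_
        (trans (sym (trans (cong₂ _+F_ (trans (cong₂ _+F_ (F.*-identityʳ a) (F.zeroˡ b)) (F.+-identityʳ a)) (B-0′ u))
          (F.+-identityʳ a))) (p ((0# , 1#) ∷ replicate _ (0# , 0#))))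
        (trans (sym (trans (cong₂ _+F_ (trans (cong₂ _+F_ (F.zeroʳ a) (F.*-identityˡ b)) (F.+-identityˡ b)) (B-0′ u))
          (F.+-identityʳ b))) (p ((1# , 0#) ∷ replicate _ (0# , 0#)))))
      (B-nondeg′ u (λ v → trans (sym (trans (cong (_+F B u v) (trans (cong₂ _+F_ (F.zeroʳ a) (F.zeroˡ b)) (F.+-identityʳ _)))
        (F.+-identityˡ _))) (p ((0# , 0#) ∷ v))))

  Q-+ : ∀ u v → Qf (u +V v) ≡ (Qf u +F Qf v) +F B u v
  Q-+ = Q-+′

  Q-· : ∀ k u → Qf (k ·V u) ≡ (k *F k) *F Qf u
  Q-· = Q-·′

  B-+ : ∀ (u u′ v : V) → B (u +V u′) v ≡ B u v +F B u′ v
  B-+ = B-+′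

  B-· : ∀ k (u v : V) → B (k ·V u) v ≡ k *F B u v
  B-· = B-·′

  B-sym : ∀ (u v : V) → B u v ≡ B v u
  B-sym = B-sym′

  B-+ʳ : ∀ (u v v′ : V) → B u (v +V v′) ≡ B u v +F B u v′
  B-+ʳ u v v′ = trans (B-sym u _) (trans (B-+ v v′ u) (cong₂ _+F_ (B-sym v u) (B-sym v′ u)))

  B-·ʳ : ∀ k (u v : V) → B u (k ·V v) ≡ k *F B u v
  B-·ʳ k u v = trans (B-sym u _) (trans (B-· k v u) (cong (k *F_) (B-sym v u)))

  B-0ʳ : ∀ (u : V) → B u zeroV ≡ 0#
  B-0ʳ = B-0′

  B-nondeg : ∀ (u : V) → (∀ v → B u v ≡ 0#) → u ≡ zeroV
  B-nondeg = B-nondeg′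

  abstract
    Vfin : FiniteSet V
    Vfin = vecFinite (record { finite = ×-finite (finFinite q) (finFinite q)
                             ; ~⇒≡ = λ (p , r) → cong₂ _,_ p r }) d

  module 𝕍 = FiniteSet Vfin
  module 𝔽 = Finite (finFinite q)

  _≟V_ : (u v : V) → Dec (u ≡ v)
  _≟V_ = Vecₚ.≡-dec (λ (a , b) (c , e) → Dec.map′ (λ (p , r) → cong₂ _,_ p r)
                        (λ { refl → refl , refl }) ((a Finₚ.≟ c) Dec.×-dec (b Finₚ.≟ e)))

  allV : List V
  allV = 𝕍.elems

  ∑V : (V → ℕ) → ℕ
  ∑V = ∑ allV

  ∑F : (Fin q → ℕ) → ℕ
  ∑F = ∑ (allFin q)

  ∑V-shift : ∀ u f → ∑V (λ v → f (v +V u)) ≡ ∑V f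
  ∑V-shift u f = 𝕍.∑-bij f (_+V u) (_+V (-V u)) (λ r → cong f (𝕍.~⇒≡ r))
    (λ r → ≡⇒~ (trans (sym (+V-cancel _ u)) (cong (_+V (-V u)) (𝕍.~⇒≡ r))))
    (λ r → ≡⇒~ (trans (cong (_+V u) (𝕍.~⇒≡ r)) (+V-cancel′ _ u)))
    where
    ≡⇒~ : ∀ {x y} → x ≡ y → x 𝕍.~ y
    ≡⇒~ refl = 𝕍.~-refl

  ∃V? : ∀ {P : V → Set} → (∀ v → Dec (P v)) → Dec (∃ P)
  ∃V? {P} P? = 𝕍.∃? P? (λ r → subst P (𝕍.~⇒≡ r))

  ∀V? : ∀ {P : V → Set} → (∀ v → Dec (P v)) → Dec (∀ v → P v)
  ∀V? {P} P? = 𝕍.∀? P? (λ r → subst P (𝕍.~⇒≡ r))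

  ∃F? : ∀ {P : Fin q → Set} → (∀ v → Dec (P v)) → Dec (∃ P)
  ∃F? {P} P? = 𝔽.∃? P? (subst P)

  ∀F? : ∀ {P : Fin q → Set} → (∀ v → Dec (P v)) → Dec (∀ v → P v)
  ∀F? {P} P? = 𝔽.∀? P? (subst P)

  ∑F-count : ∑F (λ _ → 1) ≡ q
  ∑F-count = trans (go (allFin q)) (Listₚ.length-tabulate {n = q} (λ x → x))
    where
    go : (xs : List (Fin q)) → ∑ xs (λ _ → 1) ≡ length xs
    go []       = refl
    go (x ∷ xs) = cong suc (go xs)

  abstract
    ∑V-count : ∑V (λ _ → 1) ≡ q ^ (d + d)
    ∑V-count = trans (∑-const-vec pairs d) (trans (cong (_^ d) (trans (∑-const-× (finFinite q) (finFinite q))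
        (cong₂ _*_ ∑F-count (trans ∑F-count (sym (ℕₚ.*-identityʳ q)))))) (trans (ℕₚ.^-*-assoc q 2 d)
        (cong (q ^_) (cong (d +_) (ℕₚ.+-identityʳ d)))))
      where
      pairs : FiniteSet (Fin q × Fin q)
      pairs = record { finite = ×-finite (finFinite q) (finFinite q) ; ~⇒≡ = λ (p , r) → cong₂ _,_ p r }

  2≤q : 2 ≤ q
  2≤q = go q 0# 1# 0≢1
    where
    go : ∀ n (x y : Fin n) → x ≢ y → 2 ≤ n
    go (suc zero)    Fin.zero Fin.zero x≢y = ⊥-elim (x≢y refl)
    go (suc (suc n)) x y x≢y = s≤s (s≤s z≤n)

module Subspaces {q : ℕ} (F : FiniteField q) (d : ℕ) where
  open Space F d public
  open Geometry F d

  record IsSubspace (S : Sub) : Set where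
    field
      has-0 : zeroV ∈S S
      has-+ : ∀ {u v} → u ∈S S → v ∈S S → (u +V v) ∈S S
      has-· : ∀ c {v} → v ∈S S → (c ·V v) ∈S S

    shift : ∀ {v} → v ∈S S → ∀ u → S (u +V v) ≡ S u
    shift {v} p u = bool-ext
      (λ r → subst (_∈S S) (+V-cancel u v) (has-+ r (has-· -1# p)))
      (λ r → has-+ r p)

    shiftˡ : ∀ {v} → v ∈S S → ∀ u → S (v +V u) ≡ S u
    shiftˡ p u = trans (cong S (+V-comm _ u)) (shift p u)

    unscale : ∀ {c v} → c ≢ 0# → (c ·V v) ∈S S → v ∈S S
    unscale {c} {v} c≢0 p = subst (_∈S S) (inv-·V c≢0 v) (has-· (inv c) p)

  open IsSubspace public

  _∈?_ : ∀ v S → Dec (v ∈S S)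
  v ∈? S = S v 𝔹ₚ.≟ true

  ≈S-sym : ∀ {S T} → S ≈S T → T ≈S S
  ≈S-sym p v = sym (p v)

  ≈S-trans : ∀ {S T U} → S ≈S T → T ≈S U → S ≈S U
  ≈S-trans p r v = trans (p v) (r v)

  ∩-cong : ∀ {S S′ T T′} → S ≈S S′ → T ≈S T′ → (S ∩S T) ≈S (S′ ∩S T′)
  ∩-cong p r v = cong₂ _∧_ (p v) (r v)

  ∩-comm : ∀ S T → (S ∩S T) ≈S (T ∩S S)
  ∩-comm S T v = 𝔹ₚ.∧-comm (S v) (T v)

  subspace-resp : ∀ {S T} → S ≈S T → IsSubspace S → IsSubspace T
  subspace-resp p s = record
    { has-0 = trans (sym (p _)) (has-0 s)
    ; has-+ = λ a b → trans (sym (p _)) (has-+ s (trans (p _) a) (trans (p _) b))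
    ; has-· = λ c a → trans (sym (p _)) (has-· s c (trans (p _) a)) }

  ∩-subspace : ∀ {S T} → IsSubspace S → IsSubspace T → IsSubspace (S ∩S T)
  ∩-subspace s t = record
    { has-0 = ∧-intro (has-0 s) (has-0 t)
    ; has-+ = λ a b → ∧-intro (has-+ s (∧-fst a) (∧-fst b)) (has-+ t (∧-snd a) (∧-snd b))
    ; has-· = λ c a → ∧-intro (has-· s c (∧-fst a)) (has-· t c (∧-snd a)) }

  ≟V-pick : ∀ a (f : V → ℕ) → ∑V (λ x → 𝟙 (does (x 𝕍.~? a)) * f x) ≡ f a
  ≟V-pick a f = 𝕍.∑-pick a f (λ x r → cong f (𝕍.~⇒≡ r))

  card : Sub → ℕ
  card S = ∑V (λ v → 𝟙 (S v))

  card-cong : ∀ {S T} → S ≈S T → card S ≡ card T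
  card-cong p = ∑-cong allV (λ v → cong 𝟙 (p v))

  ⊆∧card⇒≈ : ∀ {A C} → A ⊆S C → card C ≤ card A → A ≈S C
  ⊆∧card⇒≈ {A} {C} A⊆C h v = bool-ext (A⊆C v) C⊆A
    where
    C⊆A : C v ≡ true → A v ≡ true
    C⊆A cv with bool-cases (A v)
    ... | inj₁ av = av
    ... | inj₂ av = ⊥-elim (ℕₚ.<⇒≱ lt h)
      where
      pt : ∀ x → 𝟙 (does (x 𝕍.~? v)) + 𝟙 (A x) ≤ 𝟙 (C x)
      pt x with x 𝕍.~? v
      ... | yes r rewrite 𝕍.~⇒≡ r | av | cv = s≤s z≤n
      ... | no _ with bool-cases (A x)
      ...   | inj₁ ax rewrite ax | A⊆C x ax = s≤s z≤n
      ...   | inj₂ ax rewrite ax = z≤n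
      lt : card A < card C
      lt = subst (_≤ card C) (trans (∑-⊕ allV _ _) (cong (_+ card A) (𝕍.once v))) (∑-mono allV pt)

  card-pos : ∀ {S v} → v ∈S S → 1 ≤ card S
  card-pos {S} {v} p = subst (_≤ card S) (𝕍.once v) (∑-mono allV pt)
    where
    pt : ∀ x → 𝟙 (does (x 𝕍.~? v)) ≤ 𝟙 (S x)
    pt x with x 𝕍.~? v
    ... | yes r rewrite 𝕍.~⇒≡ r | p = s≤s z≤n
    ... | no _ = z≤n

  infixr 5 _⊞_

  abstract
    _⊞_ : Sub → Sub → Sub
    (A ⊞ C) v = does (∃V? (λ a → (A a ∧ C (v +V a)) 𝔹ₚ.≟ true))

    ⊞-intro : ∀ A C {v} a → a ∈S A → (v +V a) ∈S C → v ∈S (A ⊞ C)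
    ⊞-intro A C {v} a p r = does-intro (∃V? (λ a → (A a ∧ C (v +V a)) 𝔹ₚ.≟ true)) (a , ∧-intro p r)

    ⊞-elim : ∀ A C {v} → v ∈S (A ⊞ C) → ∃ λ a → a ∈S A × (v +V a) ∈S C
    ⊞-elim A C {v} p with does-elim (∃V? (λ a → (A a ∧ C (v +V a)) 𝔹ₚ.≟ true)) p
    ... | a , r = a , ∧-fst r , ∧-snd r

  private
    swap-middle : ∀ u v a b → (u +V a) +V (v +V b) ≡ (u +V v) +V (a +V b)
    swap-middle u v a b = trans (+V-assoc u a _) (trans (cong (u +V_)
      (trans (sym (+V-assoc a v b)) (trans (cong (_+V b) (+V-comm a v)) (+V-assoc v a b)))) (sym (+V-assoc u v _)))

    rotate : ∀ v a a₀ → v +V (a +V a₀) ≡ a +V (v +V a₀)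
    rotate v a a₀ = trans (sym (+V-assoc v a a₀)) (trans (cong (_+V a₀) (+V-comm v a)) (+V-assoc a v a₀))

  module _ {A C : Sub} (sA : IsSubspace A) (sC : IsSubspace C) where
    ⊞-subspace : IsSubspace (A ⊞ C)
    ⊞-subspace = record
      { has-0 = ⊞-intro A C zeroV (has-0 sA) (subst (_∈S C) (sym (+V-idˡ zeroV)) (has-0 sC))
      ; has-+ = λ {u} {v} p r → let (a , p₁ , p₂) = ⊞-elim A C p ; (b , r₁ , r₂) = ⊞-elim A C r in
          ⊞-intro A C (a +V b) (has-+ sA p₁ r₁) (subst (_∈S C) (swap-middle u v a b) (has-+ sC p₂ r₂))
      ; has-· = λ c {v} p → let (a , p₁ , p₂) = ⊞-elim A C p in
          ⊞-intro A C (c ·V a) (has-· sA c p₁) (subst (_∈S C) (·V-distribˡ c v a) (has-· sC c p₂)) }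

    ⊆⊞ˡ : A ⊆S (A ⊞ C)
    ⊆⊞ˡ v p = ⊞-intro A C (-V v) (has-· sA -1# p) (subst (_∈S C) (sym (+V-inv v)) (has-0 sC))

    ⊆⊞ʳ : C ⊆S (A ⊞ C)
    ⊆⊞ʳ v p = ⊞-intro A C zeroV (has-0 sA) (subst (_∈S C) (sym (+V-idʳ v)) p)

    coset-count : ∀ v → ∑V (λ a → 𝟙 (A a ∧ C (v +V a))) ≡ 𝟙 ((A ⊞ C) v) * card (A ∩S C)
    coset-count v with bool-cases ((A ⊞ C) v)
    ... | inj₁ p with ⊞-elim A C p
    ...   | a₀ , r₁ , r₂ rewrite p = trans (sym (∑V-shift a₀ _)) (trans
            (∑-cong allV (λ a → cong 𝟙 (cong₂ _∧_ (shift sA r₁ a)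
              (trans (cong C (rotate v a a₀)) (shift sC r₂ a)))))
            (sym (ℕₚ.*-identityˡ _)))
    coset-count v | inj₂ p rewrite p = trans (∑-cong allV (λ a → cong 𝟙 (not-true (λ r →
      false≢true p (⊞-intro A C a (∧-fst r) (∧-snd r)))))) (∑-0 allV)

    ⊞-card : card (A ⊞ C) * card (A ∩S C) ≡ card A * card C
    ⊞-card = begin
      card (A ⊞ C) * card (A ∩S C)
        ≡⟨ sym (∑-*ʳ allV _ _) ⟩
      ∑V (λ v → 𝟙 ((A ⊞ C) v) * card (A ∩S C))
        ≡⟨ ∑-cong allV (λ v → sym (coset-count v)) ⟩
      ∑V (λ v → ∑V (λ a → 𝟙 (A a ∧ C (v +V a))))
        ≡⟨ ∑-swap allV allV _ ⟩
      ∑V (λ a → ∑V (λ v → 𝟙 (A a ∧ C (v +V a))))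
        ≡⟨ ∑-cong allV (λ a → trans (∑-cong allV (λ v → 𝟙-∧ (A a) _)) (trans (∑-*ˡ allV (𝟙 (A a)) _)
             (cong (𝟙 (A a) *_) (∑V-shift a _)))) ⟩
      ∑V (λ a → 𝟙 (A a) * card C)
        ≡⟨ ∑-*ʳ allV (card C) _ ⟩
      card A * card C ∎
      where open ≡-Reasoning

  abstract
    ext : Sub → V → Sub
    ext S b v = does (∃F? (λ c → (v +V (c ·V b)) ∈? S))

    ext-intro : ∀ S b {v} c → (v +V (c ·V b)) ∈S S → v ∈S ext S b
    ext-intro S b {v} c p = does-intro (∃F? (λ c → (v +V (c ·V b)) ∈? S)) (c , p)

    ext-elim : ∀ S b {v} → v ∈S ext S b → ∃ λ c → (v +V (c ·V b)) ∈S S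
    ext-elim S b {v} = does-elim (∃F? (λ c → (v +V (c ·V b)) ∈? S))

  module _ {S : Sub} (s : IsSubspace S) (b : V) where
    ext-⊇ : S ⊆S ext S b
    ext-⊇ v p = ext-intro S b 0# (subst (_∈S S) (sym (trans (cong (v +V_) (0·V b)) (+V-idʳ v))) p)

    ext-∋ : b ∈S ext S b
    ext-∋ = ext-intro S b -1# (subst (_∈S S) (sym (+V-inv b)) (has-0 s))

    ext-subspace : IsSubspace (ext S b)
    ext-subspace = record
      { has-0 = ext-⊇ zeroV (has-0 s)
      ; has-+ = λ {u} {v} p r → let (c , p′) = ext-elim S b p ; (e , r′) = ext-elim S b r in
          ext-intro S b (c +F e) (subst (_∈S S) (trans (swap-middle u v _ _)
            (cong ((u +V v) +V_) (sym (·V-distribʳ c e b)))) (has-+ s p′ r′))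
      ; has-· = λ k {v} p → let (c , p′) = ext-elim S b p in
          ext-intro S b (k *F c) (subst (_∈S S) (trans (·V-distribˡ k v _)
            (cong ((k ·V v) +V_) (sym (·V-assoc k c b)))) (has-· s k p′)) }

    ext-⊆ : ∀ {T} → IsSubspace T → S ⊆S T → b ∈S T → ext S b ⊆S T
    ext-⊆ {T} t S⊆T b∈T v p = let (c , p′) = ext-elim S b p in
      trans (sym (shift t (has-· t c b∈T) v)) (S⊆T _ p′)

    ext-card : S b ≡ false → card (ext S b) ≡ q * card S
    ext-card b∉S = begin
      card (ext S b)
        ≡⟨ ∑-cong allV pt ⟩
      ∑V (λ v → ∑F (λ c → 𝟙 (S (v +V (c ·V b)))))
        ≡⟨ ∑-swap allV (allFin q) _ ⟩
      ∑F (λ c → ∑V (λ v → 𝟙 (S (v +V (c ·V b)))))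
        ≡⟨ ∑-cong (allFin q) (λ c → trans (∑V-shift (c ·V b) _) (sym (ℕₚ.*-identityˡ _))) ⟩
      ∑F (λ c → 1 * card S)
        ≡⟨ trans (∑-*ʳ (allFin q) (card S) _) (cong (_* card S) ∑F-count) ⟩
      q * card S ∎
      where
      open ≡-Reasoning
      split : ∀ c c₀ → c ≡ c₀ +F (c +F (-F c₀))
      split c c₀ = sym (trans (F.+-comm c₀ _) (trans (F.+-assoc c _ c₀)
        (trans (cong (c +F_) (F.-‿inverseˡ c₀)) (F.+-identityʳ c))))
      uniq : ∀ v c₀ → (v +V (c₀ ·V b)) ∈S S → ∀ c → S (v +V (c ·V b)) ≡ does (c Finₚ.≟ c₀)
      uniq v c₀ p c with c Finₚ.≟ c₀
      ... | yes refl = p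
      ... | no c≢c₀ = not-true (λ r → false≢true b∉S (unscale s e≢0 (trans (sym (shiftˡ s p _)) (subst (_∈S S) eq r))))
        where
        e : Fin q
        e = c +F (-F c₀)
        e≢0 : e ≢ 0#
        e≢0 z = c≢c₀ (trans (split c c₀) (trans (cong (c₀ +F_) z) (F.+-identityʳ c₀)))
        eq : v +V (c ·V b) ≡ (v +V (c₀ ·V b)) +V (e ·V b)
        eq = trans (cong (λ x → v +V (x ·V b)) (split c c₀))
          (trans (cong (v +V_) (·V-distribʳ c₀ e b)) (sym (+V-assoc v _ _)))
      pt : ∀ v → 𝟙 (ext S b v) ≡ ∑F (λ c → 𝟙 (S (v +V (c ·V b))))
      pt v with bool-cases (ext S b v)
      ... | inj₁ p rewrite p = let (c₀ , p′) = ext-elim S b p in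
        sym (trans (∑-cong (allFin q) (λ c → cong 𝟙 (uniq v c₀ p′ c))) (𝔽.once c₀))
      ... | inj₂ p rewrite p = sym (trans (∑-cong (allFin q) (λ c → cong 𝟙 (not-true (λ r →
              false≢true p (ext-intro S b c r))))) (∑-0 (allFin q)))

  0S : Sub
  0S v = does (v 𝕍.~? zeroV)

  0S-elim : ∀ {v} → v ∈S 0S → v ≡ zeroV
  0S-elim {v} p = 𝕍.~⇒≡ (does-elim (v 𝕍.~? zeroV) p)

  0S-zero : zeroV ∈S 0S
  0S-zero = does-intro (zeroV 𝕍.~? zeroV) 𝕍.~-refl

  0S-intro : ∀ {v} → v ≡ zeroV → v ∈S 0S
  0S-intro refl = 0S-zero

  0S-subspace : IsSubspace 0S
  0S-subspace = record
    { has-0 = 0S-zero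
    ; has-+ = λ p r → 0S-intro (trans (cong₂ _+V_ (0S-elim p) (0S-elim r)) (+V-idʳ zeroV))
    ; has-· = λ c p → 0S-intro (trans (cong (c ·V_) (0S-elim p)) (·V-zero c)) }

  span : ∀ {t} → Vec V t → Sub
  span []       = 0S
  span (b ∷ bs) = ext (span bs) b

  span-subspace : ∀ {t} (bs : Vec V t) → IsSubspace (span bs)
  span-subspace []       = 0S-subspace
  span-subspace (b ∷ bs) = ext-subspace (span-subspace bs) b

  Ind : ∀ {t} → Vec V t → Set
  Ind []       = Data.Unit.⊤
  Ind (b ∷ bs) = (span bs b ≡ false) × Ind bs

  span-card : ∀ {t} (bs : Vec V t) → Ind bs → card (span bs) ≡ q ^ t
  span-card []       _         = 𝕍.once zeroV
  span-card (b ∷ bs) (b∉ , ind) = trans (ext-card (span-subspace bs) b b∉) (cong (q *_) (span-card bs ind))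

  all∈ : ∀ {t} → Vec V t → Sub → Bool
  all∈ []       σ = true
  all∈ (v ∷ vs) σ = σ v ∧ all∈ vs σ

  all∈-resp : ∀ {t} (vs : Vec V t) {σ τ} → σ ≈S τ → all∈ vs σ ≡ all∈ vs τ
  all∈-resp []       p = refl
  all∈-resp (v ∷ vs) p = cong₂ _∧_ (p v) (all∈-resp vs p)

  all∈⇒⊆ : ∀ {t} (vs : Vec V t) {σ} → IsSubspace σ → all∈ vs σ ≡ true → span vs ⊆S σ
  all∈⇒⊆ []       {σ} s p v r = subst (_∈S σ) (sym (0S-elim r)) (has-0 s)
  all∈⇒⊆ (b ∷ bs) s p = ext-⊆ (span-subspace bs) b s (all∈⇒⊆ bs s (∧-snd p)) (∧-fst p)

  ⊆⇒all∈ : ∀ {t} (vs : Vec V t) {σ} → span vs ⊆S σ → all∈ vs σ ≡ true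
  ⊆⇒all∈ []       p = refl
  ⊆⇒all∈ (b ∷ bs) p = ∧-intro (p b (ext-∋ (span-subspace bs) b))
                              (⊆⇒all∈ bs (λ v r → p v (ext-⊇ (span-subspace bs) b v r)))

  record Basis (S : Sub) : Set where
    field
      dim    : ℕ
      vecs   : Vec V dim
      ind    : Ind vecs
      span≈  : span vecs ≈S S

    card≡ : card S ≡ q ^ dim
    card≡ = trans (sym (card-cong span≈)) (span-card vecs ind)

  private
    grow : ∀ {S} → IsSubspace S → ∀ n {t} (bs : Vec V t) → Ind bs → span bs ⊆S S →
           card S ≤ n + card (span bs) → Basis S
    grow {S} s zero bs ind sub h = record { vecs = bs ; ind = ind ; span≈ = ⊆∧card⇒≈ sub h }
    grow {S} s (suc n) bs ind sub h with ∃V? (λ v → (S v ∧ not (span bs v)) 𝔹ₚ.≟ true)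
    ... | no none = record { vecs = bs ; ind = ind ; span≈ = λ v → bool-ext (sub v) (λ p → back v p) }
      where
      back : ∀ v → v ∈S S → span bs v ≡ true
      back v p with bool-cases (span bs v)
      ... | inj₁ r = r
      ... | inj₂ r = ⊥-elim (none (v , ∧-intro p (cong not r)))
    ... | yes (v , p) = grow s n (v ∷ bs) (v∉ , ind)
            (ext-⊆ (span-subspace bs) v s sub (∧-fst p))
            (ℕₚ.≤-trans h (ℕₚ.≤-trans (ℕₚ.≤-reflexive (sym (ℕₚ.+-suc n _))) (ℕₚ.+-monoʳ-≤ n bigger)))
      where
      v∉ : span bs v ≡ false
      v∉ = not-true (λ r → false≢true (cong not r) (∧-snd p))
      bigger : suc (card (span bs)) ≤ card (span (v ∷ bs))
      bigger = ℕₚ.≤-trans (ℕₚ.+-monoˡ-≤ (card (span bs)) (card-pos (has-0 (span-subspace bs))))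
        (ℕₚ.≤-trans (ℕₚ.≤-reflexive (cong (card (span bs) +_) (sym (ℕₚ.+-identityʳ _))))
        (ℕₚ.≤-trans (ℕₚ.*-monoˡ-≤ (card (span bs)) 2≤q)
          (ℕₚ.≤-reflexive (sym (ext-card (span-subspace bs) v v∉)))))

  basis : ∀ {S} → IsSubspace S → Basis S
  basis {S} s = grow s (card S) [] _ (λ v p → subst (_∈S S) (sym (0S-elim p)) (has-0 s)) (ℕₚ.m≤m+n (card S) _)

module Orthogonality {q : ℕ} (F : FiniteField q) (d : ℕ) where
  open Subspaces F d public
  open Geometry F d
  open +-*-Solver using (solve; _:+_; _:*_; _:=_; con)

  _⊥_≟0 : (v a : V) → Dec (B v a ≡ 0#)
  v ⊥ a ≟0 = B v a Finₚ.≟ 0#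

  perp? : ∀ A v → Dec (∀ a → a ∈S A → B v a ≡ 0#)
  perp? A v = ∀V? (λ a → (a ∈? A) Dec.→-dec (v ⊥ a ≟0))

  abstract
    perp : Sub → Sub
    perp A v = does (perp? A v)

    perp-intro : ∀ A {v} → (∀ a → a ∈S A → B v a ≡ 0#) → v ∈S perp A
    perp-intro A {v} = does-intro (perp? A v)

    perp-elim : ∀ A {v} → v ∈S perp A → ∀ a → a ∈S A → B v a ≡ 0#
    perp-elim A {v} = does-elim (perp? A v)

  perp-subspace : ∀ A → IsSubspace (perp A)
  perp-subspace A = record
    { has-0 = perp-intro A (λ a _ → trans (B-sym zeroV a) (B-0ʳ a))
    ; has-+ = λ {u} {v} p r → perp-intro A (λ a m → trans (B-+ u v a)
        (trans (cong₂ _+F_ (perp-elim A p a m) (perp-elim A r a m)) (F.+-identityʳ _)))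
    ; has-· = λ c {v} p → perp-intro A (λ a m → trans (B-· c v a)
        (trans (cong (c *F_) (perp-elim A p a m)) (F.zeroʳ c))) }

  non-perp : ∀ A {v} → perp A v ≡ false → ∃ λ a → a ∈S A × B v a ≢ 0#
  non-perp A {v} p with ∃V? (λ a → (a ∈? A) Dec.×-dec Dec.¬? (v ⊥ a ≟0))
  ... | yes r = r
  ... | no ¬r = ⊥-elim (false≢true p (perp-intro A (λ a m → Dec.decidable-stable (v ⊥ a ≟0) (λ n → ¬r (a , m , n)))))

  F-cancel : ∀ {a b c} → a +F c ≡ b +F c → a ≡ b
  F-cancel {a} {b} {c} p = trans (sym (lem a)) (trans (cong (_+F (-F c)) p) (lem b))
    where
    lem : ∀ a → (a +F c) +F (-F c) ≡ a
    lem a = trans (F.+-assoc a c _) (trans (cong (a +F_) (F.-‿inverseʳ c)) (F.+-identityʳ a))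

  level-count : ∀ {A} → IsSubspace A → ∀ x → perp A x ≡ false → ∀ r →
                q * ∑V (λ a → 𝟙 (A a ∧ does (r Finₚ.≟ B x a))) ≡ card A
  level-count {A} s x np r = begin
    q * N r
      ≡⟨ cong (_* N r) (sym ∑F-count) ⟩
    ∑F (λ _ → 1) * N r
      ≡⟨ sym (∑-*ʳ (allFin q) (N r) _) ⟩
    ∑F (λ _ → 1 * N r)
      ≡⟨ ∑-cong (allFin q) (λ r′ → trans (ℕₚ.*-identityˡ _) (sym (N-const r′ r))) ⟩
    ∑F N
      ≡⟨ ∑-swap (allFin q) allV _ ⟩
    ∑V (λ a → ∑F (λ r → 𝟙 (A a ∧ does (r Finₚ.≟ B x a))))
      ≡⟨ ∑-cong allV (λ a → trans (∑-cong (allFin q) (λ r → 𝟙-∧ (A a) _)) (trans (∑-*ˡ (allFin q) (𝟙 (A a)) _)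
          (trans (cong (𝟙 (A a) *_) (𝔽.once (B x a))) (ℕₚ.*-identityʳ _)))) ⟩
    card A ∎
    where
    open ≡-Reasoning
    N : Fin q → ℕ
    N r = ∑V (λ a → 𝟙 (A a ∧ does (r Finₚ.≟ B x a)))
    a₀ : V
    a₀ = proj₁ (non-perp A np)
    N-const : ∀ r′ r → N r′ ≡ N r
    N-const r′ r = trans (sym (∑V-shift (k ·V a₀) _)) (∑-cong allV (λ a → cong 𝟙 (cong₂ _∧_
        (shift s (has-· s k (proj₁ (proj₂ (non-perp A np)))) a)
        (does-⇔ (r′ Finₚ.≟ _) (r Finₚ.≟ _)
          (λ p → F-cancel (trans (sym r′≡) (trans p (Bk a))))
          (λ p → trans r′≡ (trans (cong (_+F e) p) (sym (Bk a))))))))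
      where
      e k : Fin q
      e = r′ +F (-F r)
      k = e *F inv (B x a₀)
      r′≡ : r′ ≡ r +F e
      r′≡ = sym (trans (F.+-comm r e) (trans (F.+-assoc r′ _ r) (trans (cong (r′ +F_) (F.-‿inverseˡ r)) (F.+-identityʳ r′))))
      Bk : ∀ a → B x (a +V (k ·V a₀)) ≡ B x a +F e
      Bk a = trans (B-+ʳ x a _) (cong (B x a +F_) (trans (B-·ʳ k x a₀) (trans (F.*-assoc e _ _)
        (trans (cong (e *F_) (trans (F.*-comm _ _) (inv-* (proj₂ (proj₂ (non-perp A np)))))) (F.*-identityʳ e)))))

  pairs : Sub → Sub → ℕ
  pairs A C = ∑V (λ a → ∑V (λ b → 𝟙 (A a ∧ (C b ∧ does (0# Finₚ.≟ B a b)))))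

  pairs-sym : ∀ A C → pairs A C ≡ pairs C A
  pairs-sym A C = trans (∑-swap allV allV _) (∑-cong allV (λ b → ∑-cong allV (λ a → cong 𝟙
    (trans (sym (𝔹ₚ.∧-assoc (A a) (C b) _)) (trans (cong (_∧ _) (𝔹ₚ.∧-comm (A a) (C b))) (trans (𝔹ₚ.∧-assoc (C b) (A a) _)
      (cong (λ z → C b ∧ (A a ∧ does (0# Finₚ.≟ z))) (B-sym a b))))))))

  private
    p : ℕ
    p = q ∸ 1
    q≡ : q ≡ suc p
    q≡ = sym (ℕₚ.m+[n∸m]≡n (ℕₚ.≤-trans (ℕₚ.n≤1+n 1) 2≤q))
    p-nz : NonZero p
    p-nz = Data.Nat.>-nonZero (ℕₚ.m<n⇒0<n∸m 2≤q)
  q-nz : NonZero q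
  q-nz = subst NonZero (sym q≡) _

  pairs-count : ∀ A {C} → IsSubspace C →
                q * pairs A C ≡ card A * card C + p * (card (A ∩S perp C) * card C)
  pairs-count A {C} s = begin
    q * pairs A C
      ≡⟨ sym (∑-*ˡ allV q _) ⟩
    ∑V (λ a → q * ∑V (λ b → 𝟙 (A a ∧ (C b ∧ does (0# Finₚ.≟ B a b)))))
      ≡⟨ ∑-cong allV row ⟩
    ∑V (λ a → 𝟙 (A a) * card C + p * (𝟙 ((A ∩S perp C) a) * card C))
      ≡⟨ ∑-⊕ allV _ _ ⟩
    ∑V (λ a → 𝟙 (A a) * card C) + ∑V (λ a → p * (𝟙 ((A ∩S perp C) a) * card C))
      ≡⟨ cong₂ _+_ (∑-*ʳ allV (card C) _) (trans (∑-*ˡ allV p _) (cong (p *_) (∑-*ʳ allV (card C) _))) ⟩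
    card A * card C + p * (card (A ∩S perp C) * card C) ∎
    where
    open ≡-Reasoning
    row : ∀ a → q * ∑V (λ b → 𝟙 (A a ∧ (C b ∧ does (0# Finₚ.≟ B a b)))) ≡
                𝟙 (A a) * card C + p * (𝟙 ((A ∩S perp C) a) * card C)
    row a with A a
    ... | false = trans (cong (q *_) (∑-0 allV)) (trans (ℕₚ.*-zeroʳ q) (sym (ℕₚ.*-zeroʳ p)))
    ... | true with bool-cases (perp C a)
    ...   | inj₂ np rewrite np = trans (level-count s a np 0#)
              (solve 2 (λ c p → c := con 1 :* c :+ p :* con 0) refl (card C) p)
    ...   | inj₁ ip rewrite ip = trans (cong (q *_) (∑-cong allV (λ b → cong 𝟙 (bool-ext {b = C b} ∧-fst
                (λ m → ∧-intro m (does-intro (0# Finₚ.≟ B a b) (sym (perp-elim C ip b m))))))))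
              (trans (cong (_* card C) q≡) (solve 2 (λ c p → (con 1 :+ p) :* c := con 1 :* c :+ p :* (con 1 :* c)) refl (card C) p))

  duality : ∀ {A C} → IsSubspace A → IsSubspace C →
            card (A ∩S perp C) * card C ≡ card (C ∩S perp A) * card A
  duality {A} {C} a c = ℕₚ.*-cancelˡ-≡ _ _ p ⦃ p-nz ⦄ (ℕₚ.+-cancelˡ-≡ (card A * card C) _ _ (begin
    card A * card C + p * (card (A ∩S perp C) * card C)
      ≡⟨ sym (pairs-count A c) ⟩
    q * pairs A C
      ≡⟨ cong (q *_) (pairs-sym A C) ⟩
    q * pairs C A
      ≡⟨ pairs-count C a ⟩
    card C * card A + p * (card (C ∩S perp A) * card A)
      ≡⟨ cong (_+ p * (card (C ∩S perp A) * card A)) (ℕₚ.*-comm (card C) (card A)) ⟩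
    card A * card C + p * (card (C ∩S perp A) * card A) ∎))
    where open ≡-Reasoning

  whole : Sub
  whole _ = true

  perp-card : ∀ {A} → IsSubspace A → card (perp A) * card A ≡ q ^ (d + d)
  perp-card {A} s = trans (duality {whole} {A} (record { has-0 = refl ; has-+ = λ _ _ → refl ; has-· = λ _ _ → refl }) s)
    (trans (cong₂ _*_ (trans (card-cong {A ∩S perp whole} {0S} (λ v → bool-ext
        (λ r → 0S-intro (B-nondeg v (λ u → perp-elim whole (∧-snd r) u refl)))
        (λ r → subst (_∈S (A ∩S perp whole)) (sym (0S-elim r)) (∧-intro (has-0 s) (has-0 (perp-subspace whole))))))
      (𝕍.once zeroV)) ∑V-count) (ℕₚ.*-identityˡ _))

  ts-⊥ : ∀ {S} → IsSubspace S → TotallySingular S → ∀ {u v} → u ∈S S → v ∈S S → B u v ≡ 0#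
  ts-⊥ s ts {u} {v} p r = trans (sym (F.+-identityˡ _)) (trans (cong (_+F B u v)
    (sym (trans (cong₂ _+F_ (ts u p) (ts v r)) (F.+-identityʳ _)))) (trans (sym (Q-+ u v)) (ts _ (has-+ s p r))))

  record IsGen (π : Sub) : Set where
    field
      subspace : IsSubspace π
      size     : card π ≡ q ^ d
      singular : TotallySingular π

    ⊥-mem : ∀ {u v} → u ∈S π → v ∈S π → B u v ≡ 0#
    ⊥-mem = ts-⊥ subspace singular

    self-perp : π ≈S perp π
    self-perp = ⊆∧card⇒≈ (λ v p → perp-intro π (λ a m → ⊥-mem p m)) (ℕₚ.≤-reflexive
      (trans (ℕₚ.*-cancelʳ-≡ _ _ (q ^ d) ⦃ ℕₚ.m^n≢0 q d ⦃ q-nz ⦄ ⦄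
        (trans (cong (card (perp π) *_) (sym size)) (trans (perp-card subspace) (ℕₚ.^-distribˡ-+-* q d d)))) (sym size)))

  open IsGen public

  sing : V → Bool
  sing v = does (Qf v Finₚ.≟ 0#)

  singular-count : ∀ {π U} → IsGen π → IsSubspace U → π ⊆S U →
    q * ∑V (λ v → 𝟙 ((U v ∧ not (π v)) ∧ sing v)) + q ^ d ≡ card U
  singular-count {π} {U} g u π⊆U = trans (cong₂ _+_ qN≡ (sym (size g))) (trans (sym (∑-⊕ allV _ _)) (∑-cong allV part))
    where
    open ≡-Reasoning
    O : Sub
    O v = U v ∧ not (π v)
    part : ∀ v → 𝟙 (O v) + 𝟙 (π v) ≡ 𝟙 (U v)
    part v with bool-cases (π v)
    ... | inj₁ m rewrite m | π⊆U v m = refl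
    ... | inj₂ m rewrite m | 𝔹ₚ.∧-identityʳ (U v) = ℕₚ.+-identityʳ _
    N : ℕ
    N = ∑V (λ v → 𝟙 (O v ∧ sing v))
    Q-row : ∀ x → O x ≡ true → q * ∑V (λ a → 𝟙 (π a ∧ sing (x +V a))) ≡ card π
    Q-row x o = trans (cong (q *_) (∑-cong allV (λ a → cong 𝟙 (bool-ext
        (λ r → ∧-intro (∧-fst r) (trans (sym (same a (∧-fst r))) (∧-snd {π a} r)))
        (λ r → ∧-intro (∧-fst r) (trans (same a (∧-fst r)) (∧-snd {π a} r)))))))
      (level-count (subspace g) x (trans (sym (self-perp g x)) (notπ x o)) (-F Qf x))
      where
      notπ : ∀ x → O x ≡ true → π x ≡ false
      notπ x o with π x | ∧-snd {U x} o
      ... | false | _ = refl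
      Q≡ : ∀ a → a ∈S π → Qf (x +V a) ≡ Qf x +F B x a
      Q≡ a m = trans (Q-+ x a) (cong (_+F B x a) (trans (cong (Qf x +F_) (singular g a m)) (F.+-identityʳ _)))
      same : ∀ a → a ∈S π → sing (x +V a) ≡ does ((-F Qf x) Finₚ.≟ B x a)
      same a m = does-⇔ (Qf (x +V a) Finₚ.≟ 0#) ((-F Qf x) Finₚ.≟ B x a)
        (λ z → F-cancel (trans (F.-‿inverseˡ (Qf x)) (trans (sym z) (trans (Q≡ a m) (F.+-comm _ _)))))
        (λ z → trans (Q≡ a m) (trans (cong (Qf x +F_) (sym z)) (F.-‿inverseʳ (Qf x))))
    M : ℕ
    M = ∑V (λ x → ∑V (λ a → 𝟙 (O x ∧ (π a ∧ sing (x +V a)))))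
    M₁ : q * M ≡ ∑V (λ x → 𝟙 (O x)) * card π
    M₁ = trans (sym (∑-*ˡ allV q _)) (trans (∑-cong allV (λ x →
        trans (cong (q *_) (trans (∑-cong allV (λ a → 𝟙-∧ (O x) _)) (∑-*ˡ allV (𝟙 (O x)) _)))
        (trans (solve 3 (λ q o s → q :* (o :* s) := o :* (q :* s)) refl q (𝟙 (O x)) _)
               (𝟙-on (O x) (Q-row x)))))
      (∑-*ʳ allV (card π) _))
    M₂ : M ≡ card π * N
    M₂ = trans (∑-swap allV allV _) (trans (∑-cong allV (λ a → trans
        (trans (∑-cong allV (λ x → trans (cong 𝟙 (move (O x) (π a) _)) (𝟙-∧ (π a) _)))
               (∑-*ˡ allV (𝟙 (π a)) _))
        (𝟙-on (π a) (λ m → trans (∑-cong allV (λ x → cong (λ z → 𝟙 (z ∧ sing (x +V a))) (O-shift a m x)))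
          (∑V-shift a (λ v → 𝟙 (O v ∧ sing v)))))))
      (∑-*ʳ allV N _))
      where
      move : ∀ a b c → a ∧ (b ∧ c) ≡ b ∧ (a ∧ c)
      move true  b     c = refl
      move false true  c = refl
      move false false c = refl
      O-shift : ∀ a → a ∈S π → ∀ x → O x ≡ O (x +V a)
      O-shift a m x = sym (cong₂ (λ s t → s ∧ not t) (shift u (π⊆U a m) x) (shift (subspace g) m x))
    qN≡ : q * N ≡ ∑V (λ x → 𝟙 (O x))
    qN≡ = ℕₚ.*-cancelʳ-≡ _ _ (q ^ d) ⦃ ℕₚ.m^n≢0 q d ⦃ q-nz ⦄ ⦄ (begin
      q * N * q ^ d
        ≡⟨ solve 3 (λ q n c → q :* n :* c := q :* (c :* n)) refl q N (q ^ d) ⟩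
      q * (q ^ d * N)
        ≡⟨ cong (λ z → q * (z * N)) (sym (size g)) ⟩
      q * (card π * N)
        ≡⟨ cong (q *_) (sym M₂) ⟩
      q * M
        ≡⟨ M₁ ⟩
      ∑V (λ x → 𝟙 (O x)) * card π
        ≡⟨ cong (∑V (λ x → 𝟙 (O x)) *_) (size g) ⟩
      ∑V (λ x → 𝟙 (O x)) * q ^ d ∎)

module Generators {q : ℕ} (F : FiniteField q) (d : ℕ) where
  open Orthogonality F d public
  open Geometry F d

  q^-nz : ∀ n → NonZero (q ^ n)
  q^-nz n = ℕₚ.m^n≢0 q n ⦃ q-nz ⦄

  q^-inj : ∀ {a b} → q ^ a ≡ q ^ b → a ≡ b
  q^-inj {a} {b} p with ℕₚ.<-cmp a b
  ... | Relation.Binary.tri< h _ _ = ⊥-elim (ℕₚ.<⇒≢ (ℕₚ.^-monoʳ-< q 2≤q h) p)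
  ... | Relation.Binary.tri≈ _ e _ = e
  ... | Relation.Binary.tri> _ _ h = ⊥-elim (ℕₚ.<⇒≢ (ℕₚ.^-monoʳ-< q 2≤q h) (sym p))

  private
    -1≢0 : -1# ≢ 0#
    -1≢0 p = 0≢1 (trans (sym (F.-‿inverseʳ 1#)) (trans (cong (1# +F_) p) (F.+-identityʳ 1#)))

    neg-self : ∀ v → (-V v) +V v ≡ zeroV
    neg-self v = trans (+V-comm _ v) (+V-inv v)

    lincomb∈ : ∀ {k} (c : Vec (Fin q) k) (b : Vec V k) → lincomb c b ∈S span b
    lincomb∈ []       []       = 0S-zero
    lincomb∈ (c ∷ cs) (b ∷ bs) = has-+ e (has-· e c (ext-∋ s b)) (ext-⊇ s b _ (lincomb∈ cs bs))
      where
      s : IsSubspace (span bs)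
      s = span-subspace bs
      e : IsSubspace (ext (span bs) b)
      e = ext-subspace s b

    neg-· : ∀ c v → (-F c) ·V v ≡ -V (c ·V v)
    neg-· c v = trans (cong (_·V v) (sym (RP.-1*x≈-x c))) (·V-assoc -1# c v)
      where
      module RP = Algebra.Properties.Ring F.ring

    ∈lincomb : ∀ {k} (b : Vec V k) v → v ∈S span b → ∃ λ (c : Vec (Fin q) k) → lincomb c b ≡ v
    ∈lincomb []       v p = [] , sym (0S-elim p)
    ∈lincomb (b ∷ bs) v p with ext-elim (span bs) b p
    ... | c , r with ∈lincomb bs _ r
    ...   | cs , e = (-F c) ∷ cs , (begin
        ((-F c) ·V b) +V lincomb cs bs
          ≡⟨ cong₂ _+V_ (neg-· c b) e ⟩
        (-V (c ·V b)) +V (v +V (c ·V b))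
          ≡⟨ +V-comm _ _ ⟩
        (v +V (c ·V b)) +V (-V (c ·V b))
          ≡⟨ +V-cancel v _ ⟩
        v ∎)
      where open ≡-Reasoning

    indep⇒Ind : ∀ {k} (b : Vec V k) →
      (∀ (c : Vec (Fin q) k) → lincomb c b ≡ zeroV → c ≡ replicate k 0#) → Ind b
    indep⇒Ind []       _ = _
    indep⇒Ind (b ∷ bs) h =
        not-true (λ r → let (cs , e) = ∈lincomb bs b r in
          -1≢0 (Vecₚ.∷-injectiveˡ (h (-1# ∷ cs) (trans (cong ((-V b) +V_) e) (neg-self b)))))
      , indep⇒Ind bs (λ cs e → Vecₚ.∷-injectiveʳ (h (0# ∷ cs)
          (trans (cong (_+V lincomb cs bs) (0·V b)) (trans (+V-idˡ _) e))))

    Ind⇒indep : ∀ {k} (b : Vec V k) → Ind b →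
      (c : Vec (Fin q) k) → lincomb c b ≡ zeroV → c ≡ replicate k 0#
    Ind⇒indep []       _          []       _ = refl
    Ind⇒indep (b ∷ bs) (b∉ , ind) (c ∷ cs) e with c Finₚ.≟ 0#
    ... | yes refl = cong (0# ∷_) (Ind⇒indep bs ind cs
                       (trans (sym (+V-idˡ _)) (trans (cong (_+V lincomb cs bs) (sym (0·V b))) e)))
    ... | no c≢0 = ⊥-elim (false≢true b∉ (unscale s c≢0 (trans (sym (shift s (lincomb∈ cs bs) (c ·V b)))
                       (subst (_∈S span bs) (sym e) (has-0 s)))))
      where
      s : IsSubspace (span bs)
      s = span-subspace bs

  hasDim⇒ : ∀ {S k} → HasDim S k → IsSubspace S × card S ≡ q ^ k
  hasDim⇒ {S} (b , ind , sp , inS) = subspace-resp eq (span-subspace b) ,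
      trans (sym (card-cong eq)) (span-card b (indep⇒Ind b ind))
    where
    eq : span b ≈S S
    eq v = bool-ext (λ p → let (c , e) = ∈lincomb b v p in subst (_∈S S) e (inS c))
                    (λ p → let (c , e) = sp v p in subst (_∈S span b) e (lincomb∈ c b))

  ⇒hasDim : ∀ {S k} → IsSubspace S → card S ≡ q ^ k → HasDim S k
  ⇒hasDim {S} {k} s e = subst (HasDim S) (q^-inj (trans (sym card≡) e))
      (vecs , Ind⇒indep vecs ind
            , (λ v p → ∈lincomb vecs v (trans (span≈ v) p))
            , (λ c → trans (sym (span≈ _)) (lincomb∈ c vecs)))
    where open Basis (basis s)

  generator⇒ : ∀ {π} → IsGenerator π → IsGen π
  generator⇒ (h , ts) = record { subspace = proj₁ (hasDim⇒ h) ; size = proj₂ (hasDim⇒ h) ; singular = ts }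

  ⇒generator : ∀ {π} → IsGen π → IsGenerator π
  ⇒generator g = ⇒hasDim (subspace g) (size g) , singular g

  abstract
    isSubspace? : ∀ S → Dec (IsSubspace S)
    isSubspace? S = Dec.map′
      (λ (z , p , s) → record { has-0 = z ; has-+ = λ {u} {v} → p u v ; has-· = λ c {v} → s c v })
      (λ s → has-0 s , (λ u v → has-+ s {u} {v}) , (λ c v → has-· s c {v}))
      ((zeroV ∈? S) Dec.×-dec
       (∀V? (λ u → ∀V? (λ v → (u ∈? S) Dec.→-dec ((v ∈? S) Dec.→-dec ((u +V v) ∈? S)))) Dec.×-dec
        ∀F? (λ c → ∀V? (λ v → (v ∈? S) Dec.→-dec ((c ·V v) ∈? S)))))

    hasDim? : ∀ S k → Dec (HasDim S k)
    hasDim? S k = Dec.map′ (λ (s , e) → ⇒hasDim s e) hasDim⇒ (isSubspace? S Dec.×-dec (card S ℕₚ.≟ q ^ k))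

    ts? : ∀ S → Dec (TotallySingular S)
    ts? S = ∀V? (λ v → (v ∈? S) Dec.→-dec (Qf v Finₚ.≟ 0#))

    isGen? : ∀ S → Dec (IsGen S)
    isGen? S = Dec.map′ generator⇒ ⇒generator (hasDim? S d Dec.×-dec ts? S)

  isPoint? : ∀ S → Dec (IsPoint S)
  isPoint? S = hasDim? S 1 Dec.×-dec ts? S

  ts-resp : ∀ {S T} → S ≈S T → TotallySingular S → TotallySingular T
  ts-resp p ts v m = ts v (trans (p v) m)

  isGen-resp : ∀ {S T} → S ≈S T → IsGen S → IsGen T
  isGen-resp p g = record { subspace = subspace-resp p (subspace g)
                          ; size = trans (sym (card-cong p)) (size g)
                          ; singular = ts-resp p (singular g) }

  abstract
    _≈?_ : ∀ S T → Dec (S ≈S T)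
    S ≈? T = ∀V? (λ v → S v 𝔹ₚ.≟ T v)

  private
    set : V → Bool → Sub → Sub
    set x b S v = if does (v ≟V x) then b else S v

    set-at : ∀ x b S → set x b S x ≡ b
    set-at x b S with x ≟V x
    ... | yes _ = refl
    ... | no n = ⊥-elim (n refl)

    set-off : ∀ x b S v → v ≢ x → set x b S v ≡ S v
    set-off x b S v n with v ≟V x
    ... | yes p = ⊥-elim (n p)
    ... | no _ = refl

    agree? : ∀ xs (S a : Sub) → Dec (All (λ v → S v ≡ a v) xs)
    agree? xs S a = All.all? (λ v → S v 𝔹ₚ.≟ a v) xs

    subs : List V → List Sub
    subs [] = (λ _ → false) ∷ []
    subs (x ∷ xs) with Any.any? (x ≟V_) xs
    ... | yes _ = subs xs
    ... | no _  = concatMap (λ S → set x true S ∷ set x false S ∷ []) (subs xs)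

    lookup-agree : ∀ {xs} (S a : Sub) x → Any (x ≡_) xs → All (λ v → S v ≡ a v) xs → S x ≡ a x
    lookup-agree S a x (here refl) (p ∷ _) = p
    lookup-agree S a x (there i) (_ ∷ ps) = lookup-agree S a x i ps

    agree-set : ∀ x b (S a : Sub) xs → ¬ Any (x ≡_) xs → All (λ v → S v ≡ a v) xs → All (λ v → set x b S v ≡ a v) xs
    agree-set x b S a []       n []       = []
    agree-set x b S a (y ∷ ys) n (p ∷ ps) =
      trans (set-off x b S y (λ r → n (here (sym r)))) p ∷ agree-set x b S a ys (λ i → n (there i)) ps

    agree-unset : ∀ x b (S a : Sub) xs → ¬ Any (x ≡_) xs → All (λ v → set x b S v ≡ a v) xs → All (λ v → S v ≡ a v) xs
    agree-unset x b S a []       n []       = []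
    agree-unset x b S a (y ∷ ys) n (p ∷ ps) =
      trans (sym (set-off x b S y (λ r → n (here (sym r))))) p ∷ agree-unset x b S a ys (λ i → n (there i)) ps

    subs-once : ∀ xs a → ∑ (subs xs) (λ S → 𝟙 (does (agree? xs S a))) ≡ 1
    subs-once [] a = refl
    subs-once (x ∷ xs) a with Any.any? (x ≟V_) xs
    ... | yes i = trans (∑-cong (subs xs) (λ S → cong 𝟙 (does-⇔ (agree? (x ∷ xs) S a) (agree? xs S a)
                    (λ { (_ ∷ ps) → ps }) (λ ps → lookup-agree S a x i ps ∷ ps)))) (subs-once xs a)
    ... | no n = trans (∑-concatMap _ (subs xs) _) (trans (∑-cong (subs xs) pt) (subs-once xs a))
      where
      hit : ∀ S b → a x ≡ b → does (agree? (x ∷ xs) (set x b S) a) ≡ does (agree? xs S a)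
      hit S b e = does-⇔ (agree? (x ∷ xs) (set x b S) a) (agree? xs S a)
        (λ { (_ ∷ ps) → agree-unset x b S a xs n ps })
        (λ ps → trans (set-at x b S) (sym e) ∷ agree-set x b S a xs n ps)
      miss : ∀ S b → a x ≡ not b → does (agree? (x ∷ xs) (set x b S) a) ≡ false
      miss S b e = not-true (λ r → 𝔹ₚ.not-¬ {b} refl (trans (sym (set-at x b S)) (trans (All.head (does-elim (agree? (x ∷ xs) (set x b S) a) r)) e)))
      pt : ∀ S → 𝟙 (does (agree? (x ∷ xs) (set x true S) a)) + (𝟙 (does (agree? (x ∷ xs) (set x false S) a)) + 0)
               ≡ 𝟙 (does (agree? xs S a))
      pt S with bool-cases (a x)
      ... | inj₁ e rewrite hit S true e | miss S false e = ℕₚ.+-identityʳ _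
      ... | inj₂ e rewrite hit S false e | miss S true e = ℕₚ.+-identityʳ _

  abstract
    allS : List Sub
    allS = subs allV

    allS-once : ∀ a → ∑ allS (λ S → 𝟙 (does (S ≈? a))) ≡ 1
    allS-once a = trans (∑-cong (subs allV) (λ S → cong 𝟙 (does-⇔ (S ≈? a) (agree? allV S a)
        (λ p → All.tabulate (λ {v} _ → p v))
        (λ ps v → lookup-agree S a v (𝕍.find v (λ x r → sym (𝕍.~⇒≡ r))) ps)))) (subs-once allV a)

  subFinite : Finite Sub
  subFinite = record
    { _~_ = _≈S_ ; ~-refl = λ _ → refl ; ~-sym = ≈S-sym ; _~?_ = _≈?_ ; elems = allS ; once = allS-once }
  module 𝕊 = Finite subFinite

  filter-pick : ∀ {P : Sub → Set} (P? : ∀ S → Dec (P S)) → (∀ {S T} → S ≈S T → P S → P T) →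
    ∀ {σ} → P σ → ∀ (f : Sub → ℕ) → (∀ τ → τ ≈S σ → f τ ≡ f σ) →
    ∑ (filter P? 𝕊.elems) (λ τ → 𝟙 (does (τ ≈? σ)) * f τ) ≡ f σ
  filter-pick P? resp {σ} pσ f inv = trans (∑-filter P? 𝕊.elems _) (trans (∑-cong 𝕊.elems
      (λ τ → trans (sym (ℕₚ.*-assoc (𝟙 (does (P? τ))) _ (f τ))) (cong (_* f τ) (trans (sym (𝟙-∧ (does (P? τ)) _)) (cong 𝟙
        (bool-ext {b = does (τ ≈? σ)} ∧-snd (λ r → ∧-intro (does-intro (P? τ) (resp (≈S-sym (does-elim (τ ≈? σ) r)) pσ)) r)))))))
    (𝕊.∑-pick σ f inv))

  gens : List Sub
  gens = filter isGen? 𝕊.elems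

  gens-all : All IsGen gens
  gens-all = Allₚ.all-filter isGen? 𝕊.elems

  gens-pick : ∀ {σ} → IsGen σ → ∀ (f : Sub → ℕ) → (∀ τ → τ ≈S σ → f τ ≡ f σ) →
              ∑ gens (λ τ → 𝟙 (does (τ ≈? σ)) * f τ) ≡ f σ
  gens-pick = filter-pick isGen? isGen-resp

  module Join {π T : Sub} (g : IsGen π) (t : IsSubspace T) (ts : TotallySingular T) where
    join : Sub
    join = T ⊞ (π ∩S perp T)

    T⊆perp : T ⊆S perp T
    T⊆perp v p = perp-intro T (λ a m → ts-⊥ t ts p m)

    private
      u : IsSubspace (π ∩S perp T)
      u = ∩-subspace (subspace g) (perp-subspace T)

    T⊆join : T ⊆S join
    T⊆join = ⊆⊞ˡ t u

    join⊆perp : join ⊆S perp T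
    join⊆perp v p = let (a , m , r) = ⊞-elim T (π ∩S perp T) p in
      trans (sym (shift (perp-subspace T) (T⊆perp a m) v)) (∧-snd r)

    join-mem : ∀ {v} → v ∈S perp T → (T ⊞ π) v ≡ join v
    join-mem {v} p = bool-ext
      (λ r → let (a , m , r′) = ⊞-elim T π r in
        ⊞-intro T (π ∩S perp T) a m (∧-intro r′ (has-+ (perp-subspace T) p (T⊆perp a m))))
      (λ r → let (a , m , r′) = ⊞-elim T (π ∩S perp T) r in ⊞-intro T π a m (∧-fst r′))

    join-gen : IsGen join
    join-gen = record { subspace = ⊞-subspace t u ; size = sz ; singular = sg }
      where
      open ≡-Reasoning
      sg : TotallySingular join
      sg v p = let (a , m , r) = ⊞-elim T (π ∩S perp T) p
                   w = v +V a
                   v≡ : w +V (-V a) ≡ v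
                   v≡ = +V-cancel v a
                   -a∈ : (-V a) ∈S T
                   -a∈ = has-· t -1# m
               in trans (cong Qf (sym v≡)) (trans (Q-+ w (-V a))
                    (trans (cong₂ _+F_ (cong₂ _+F_ (singular g w (∧-fst r)) (ts _ -a∈))
                                       (perp-elim T (∧-snd r) (-V a) -a∈))
                      (trans (F.+-identityʳ _) (F.+-identityʳ _))))
      c : ℕ
      c = card (T ∩S π)
      c≡ : card (T ∩S (π ∩S perp T)) ≡ c
      c≡ = card-cong {T ∩S (π ∩S perp T)} {T ∩S π} (λ v → bool-ext
        (λ r → ∧-intro {T v} {π v} (∧-fst r) (∧-fst {π v} {perp T v} (∧-snd {T v} r)))
        (λ r → ∧-intro {T v} {π v ∧ perp T v} (∧-fst {T v} {π v} r)
          (∧-intro {π v} {perp T v} (∧-snd {T v} {π v} r) (T⊆perp v (∧-fst {T v} {π v} r)))))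
      sz : card join ≡ q ^ d
      sz = ℕₚ.*-cancelʳ-≡ _ _ c
        ⦃ Data.Nat.>-nonZero (card-pos {T ∩S π} (∧-intro (has-0 t) (has-0 (subspace g)))) ⦄ (begin
        card join * c
          ≡⟨ cong (card join *_) (sym c≡) ⟩
        card join * card (T ∩S (π ∩S perp T))
          ≡⟨ ⊞-card t u ⟩
        card T * card (π ∩S perp T)
          ≡⟨ ℕₚ.*-comm (card T) _ ⟩
        card (π ∩S perp T) * card T
          ≡⟨ duality (subspace g) t ⟩
        card (T ∩S perp π) * card π
          ≡⟨ cong₂ _*_ (card-cong {T ∩S perp π} {T ∩S π} (λ v → cong (T v ∧_) (sym (self-perp g v)))) (size g) ⟩
        c * q ^ d
          ≡⟨ ℕₚ.*-comm c _ ⟩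
        q ^ d * c ∎)

-- cc q n k is the coefficient of zᵏ in ∏_{j<n} (1 + qʲ z).

cc : ℕ → ℕ → ℕ → ℕ
cc q n       zero    = 1
cc q zero    (suc k) = 0
cc q (suc n) (suc k) = cc q n (suc k) + q ^ n * cc q n k

sh : ℕ → (ℕ → ℕ) → ℕ → ℕ
sh zero    f k       = f k
sh (suc a) f zero    = 0
sh (suc a) f (suc k) = sh a f k

sh-cc : ∀ q n a k → sh a (cc q (suc n)) k ≡ sh a (cc q n) k + q ^ n * sh (suc a) (cc q n) k
sh-cc q n zero    zero    = cong suc (sym (ℕₚ.*-zeroʳ (q ^ n)))
sh-cc q n zero    (suc k) = refl
sh-cc q n (suc a) zero    = sym (ℕₚ.*-zeroʳ (q ^ n))
sh-cc q n (suc a) (suc k) = sh-cc q n a k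

sh-cc₀ : ∀ q a k → sh a (cc q 0) k ≡ 𝟙 (does (a ℕₚ.≟ k))
sh-cc₀ q zero    zero    = refl
sh-cc₀ q zero    (suc k) = refl
sh-cc₀ q (suc a) zero    = refl
sh-cc₀ q (suc a) (suc k) = trans (sh-cc₀ q a k) (cong 𝟙 (does-⇔ (a ℕₚ.≟ k) (suc a ℕₚ.≟ suc k) (cong suc) ℕₚ.suc-injective))

module Counting {q : ℕ} (F : FiniteField q) (d : ℕ) where
  open Generators F d public
  open Geometry F d
  open +-*-Solver using (solve; _:+_; _:*_; _:=_; con)

  -- The codimension of span vs ∩ π in span vs, for independent vs.

  corank : ∀ {t} → Vec V t → Sub → ℕ
  corank []       π = 0
  corank (v ∷ vs) π = if (span vs ⊞ π) v then corank vs π else suc (corank vs π)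

  corank-card : ∀ {t} (vs : Vec V t) {π} → IsSubspace π → Ind vs → card (span vs ∩S π) * q ^ corank vs π ≡ q ^ t
  corank-card []       {π} s _ = trans (ℕₚ.*-identityʳ _) (trans (card-cong {0S ∩S π} {0S}
    (λ v → bool-ext ∧-fst (λ r → ∧-intro r (subst (_∈S π) (sym (0S-elim r)) (has-0 s))))) (𝕍.once zeroV))
  corank-card (v ∷ vs) {π} s (v∉ , ind) with bool-cases ((span vs ⊞ π) v)
  ... | inj₂ p rewrite p = trans (cong (_* q ^ suc (corank vs π)) (card-cong {span (v ∷ vs) ∩S π} {span vs ∩S π} same))
          (trans (solve 3 (λ c q e → c :* (q :* e) := q :* (c :* e)) refl (card (span vs ∩S π)) q (q ^ corank vs π))
            (cong (q *_) (corank-card vs s ind)))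
    where
    H : Sub
    H = span vs
    h : IsSubspace H
    h = span-subspace vs
    toH : ∀ w → w ∈S ext H v → w ∈S π → w ∈S H
    toH w m m′ with ext-elim H v m
    ... | c , r with c Finₚ.≟ 0#
    ...   | yes refl = subst (_∈S H) (trans (cong (w +V_) (0·V v)) (+V-idʳ w)) r
    ...   | no c≢0 = ⊥-elim (false≢true p (unscale (⊞-subspace h s) c≢0
              (trans (sym (shiftˡ (⊞-subspace h s) (⊆⊞ʳ h s w m′) (c ·V v))) (⊆⊞ˡ h s _ r))))
    same : ∀ w → (ext H v ∩S π) w ≡ (H ∩S π) w
    same w = bool-ext (λ r → ∧-intro (toH w (∧-fst r) (∧-snd {ext H v w} r)) (∧-snd {ext H v w} r))
                      (λ r → ∧-intro (ext-⊇ h v w (∧-fst r)) (∧-snd {H w} r))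
  ... | inj₁ p rewrite p = trans (cong (_* q ^ corank vs π) (trans (card-cong {span (v ∷ vs) ∩S π} same)
          (ext-card (∩-subspace h s) v′ (not-true (λ r → false≢true v∉ (trans (sym (shift h a∈H v)) (∧-fst r)))))))
          (trans (ℕₚ.*-assoc q _ _) (cong (q *_) (corank-card vs s ind)))
    where
    H : Sub
    H = span vs
    h : IsSubspace H
    h = span-subspace vs
    a : V
    a = proj₁ (⊞-elim H π p)
    a∈H : a ∈S H
    a∈H = proj₁ (proj₂ (⊞-elim H π p))
    v′ : V
    v′ = v +V a
    v′∈π : v′ ∈S π
    v′∈π = proj₂ (proj₂ (⊞-elim H π p))
    move : ∀ w c → w +V (c ·V v′) ≡ (w +V (c ·V v)) +V (c ·V a)
    move w c = trans (cong (w +V_) (·V-distribˡ c v a)) (sym (+V-assoc w _ _))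
    same : ∀ w → (ext H v ∩S π) w ≡ ext (H ∩S π) v′ w
    same w = bool-ext
      (λ r → let (c , r′) = ext-elim H v (∧-fst r) in ext-intro (H ∩S π) v′ c (∧-intro
         (subst (_∈S H) (sym (move w c)) (has-+ h r′ (has-· h c a∈H)))
         (has-+ s (∧-snd {ext H v w} r) (has-· s c v′∈π))))
      (λ r → let (c , r′) = ext-elim (H ∩S π) v′ r in ∧-intro
         (ext-intro H v c (trans (sym (shift h (has-· h c a∈H) _)) (subst (_∈S H) (move w c) (∧-fst r′))))
         (trans (sym (shift s (has-· s c v′∈π) w)) (∧-snd {H _} r′)))

  codim? : ∀ (σ π : Sub) k → Dec (card (σ ∩S π) * q ^ k ≡ q ^ d)
  codim? σ π k = card (σ ∩S π) * q ^ k ℕₚ.≟ q ^ d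

  codim : Sub → Sub → ℕ → Bool
  codim σ π k = does (codim? σ π k)

  codim-resp : ∀ {σ τ} → σ ≈S τ → ∀ π k → codim σ π k ≡ codim τ π k
  codim-resp {σ} {τ} p π k = does-⇔ (codim? σ π k) (codim? τ π k)
    (λ e → trans (cong (_* q ^ k) (sym eq)) e) (λ e → trans (cong (_* q ^ k) eq) e)
    where
    eq : card (σ ∩S π) ≡ card (τ ∩S π)
    eq = card-cong {σ ∩S π} {τ ∩S π} (∩-cong p (λ _ → refl))

  Φ : ∀ {t} → Vec V t → Sub → ℕ → ℕ
  Φ vs π k = ∑ gens (λ σ → 𝟙 (all∈ vs σ ∧ codim σ π k))

  module _ {π : Sub} (g : IsGen π) where
    private
      Φ-full : ∀ (vs : Vec V d) → Ind vs → TotallySingular (span vs) → ∀ k →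
               Φ vs π k ≡ sh (corank vs π) (cc q 0) k
      Φ-full vs ind ts k = begin
        Φ vs π k
          ≡⟨ ∑-congAll gens-all (λ σ gσ → trans (cong 𝟙 (cong (_∧ codim σ π k) (contains σ gσ))) (𝟙-∧ (does (σ ≈? T)) (codim σ π k))) ⟩
        ∑ gens (λ σ → 𝟙 (does (σ ≈? T)) * 𝟙 (codim σ π k))
          ≡⟨ gens-pick gT _ (λ τ p → cong 𝟙 (codim-resp p π k)) ⟩
        𝟙 (codim T π k)
          ≡⟨ cong 𝟙 (does-⇔ (codim? T π k) (corank vs π ℕₚ.≟ k)
               (λ e → q^-inj (ℕₚ.*-cancelˡ-≡ _ _ (card (T ∩S π)) ⦃ nz ⦄ (trans ck (sym e))))
               (λ e → subst (λ k → card (T ∩S π) * q ^ k ≡ q ^ d) e ck)) ⟩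
        𝟙 (does (corank vs π ℕₚ.≟ k))
          ≡⟨ sym (sh-cc₀ q (corank vs π) k) ⟩
        sh (corank vs π) (cc q 0) k ∎
        where
        open ≡-Reasoning
        T : Sub
        T = span vs
        gT : IsGen T
        gT = record { subspace = span-subspace vs ; size = span-card vs ind ; singular = ts }
        ck : card (T ∩S π) * q ^ corank vs π ≡ q ^ d
        ck = corank-card vs (subspace g) ind
        nz : NonZero (card (T ∩S π))
        nz = Data.Nat.>-nonZero (card-pos {T ∩S π} (∧-intro (has-0 (subspace gT)) (has-0 (subspace g))))
        contains : ∀ σ → IsGen σ → all∈ vs σ ≡ does (σ ≈? T)
        contains σ gσ = bool-ext
          (λ r → does-intro (σ ≈? T) (≈S-sym {T} {σ} (⊆∧card⇒≈ (all∈⇒⊆ vs (subspace gσ) r)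
             (ℕₚ.≤-reflexive (trans (size gσ) (sym (size gT)))))))
          (λ r → ⊆⇒all∈ vs (λ v m → trans (does-elim (σ ≈? T) r v) m))

    Φ-count : ∀ n {t} (vs : Vec V t) → Ind vs → TotallySingular (span vs) → n + t ≡ d → ∀ k →
              Φ vs π k ≡ sh (corank vs π) (cc q n) k
    Φ-count zero    vs ind ts refl k = Φ-full vs ind ts k
    Φ-count (suc n) {t} vs ind ts n+t≡d k = trans Φ≡ (sym (sh-cc q n a k))
      where
      open ≡-Reasoning
      T : Sub
      T = span vs
      sT : IsSubspace T
      sT = span-subspace vs
      open Join g sT ts
      a X Y N₁ N₂ : ℕ
      a = corank vs π
      X = sh a (cc q n) k
      Y = sh (suc a) (cc q n) k
      N₁ = ∑V (λ v → 𝟙 (join v ∧ not (T v)))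
      N₂ = ∑V (λ v → 𝟙 ((perp T v ∧ not (join v)) ∧ sing v))

      flags : ∑V (λ v → Φ (v ∷ vs) π k) ≡ q ^ d * Φ vs π k
      flags = trans (∑-swap allV gens _) (trans (∑-congAll gens-all (λ σ gσ → trans
        (∑-cong allV (λ v → trans (cong 𝟙 (𝔹ₚ.∧-assoc (σ v) _ _)) (𝟙-∧ (σ v) _)))
        (trans (∑-*ʳ allV _ _) (cong (_* 𝟙 (all∈ vs σ ∧ codim σ π k)) (size gσ)))))
        (∑-*ˡ gens (q ^ d) _))

      inside : ∀ v → v ∈S T → Φ (v ∷ vs) π k ≡ Φ vs π k
      inside v m = ∑-congAll gens-all (λ σ gσ → cong 𝟙 (cong (_∧ codim σ π k) (bool-ext {b = all∈ vs σ} ∧-snd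
        (λ r → ∧-intro (all∈⇒⊆ vs (subspace gσ) r v m) r))))

      extend : ∀ v → T v ≡ false → v ∈S perp T → Qf v ≡ 0# →
               Φ (v ∷ vs) π k ≡ sh (corank (v ∷ vs) π) (cc q n) k
      extend v v∉ v⊥ qv = Φ-count n (v ∷ vs) (v∉ , ind) ts′ (trans (ℕₚ.+-suc n t) n+t≡d) k
        where
        ts′ : TotallySingular (ext T v)
        ts′ w m with ext-elim T v m
        ... | c , r = trans (cong Qf (sym (+V-cancel w (c ·V v)))) (trans (Q-+ u x)
              (trans (cong₂ _+F_ (cong₂ _+F_ (ts u r) Qx) Bux) (trans (F.+-identityʳ _) (F.+-identityʳ _))))
          where
          u x : V
          u = w +V (c ·V v)
          x = -V (c ·V v)
          x≡ : x ≡ (-1# *F c) ·V v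
          x≡ = sym (·V-assoc -1# c v)
          Qx : Qf x ≡ 0#
          Qx = trans (cong Qf x≡) (trans (Q-· _ v) (trans (cong (_ *F_) qv) (F.zeroʳ _)))
          Bux : B u x ≡ 0#
          Bux = trans (cong (B u) x≡) (trans (B-·ʳ _ u v) (trans (cong (_ *F_)
                  (trans (B-sym u v) (perp-elim T v⊥ u r))) (F.zeroʳ _)))

      outside : ∀ v → (perp T v ∧ sing v) ≡ false → Φ (v ∷ vs) π k ≡ 0
      outside v p = trans (∑-congAll gens-all (λ σ gσ → cong 𝟙 (not-true (λ r → false≢true p (∧-intro
          (perp-intro T (λ b m → ⊥-mem gσ {v} {b} (∧-fst (∧-fst {σ v ∧ all∈ vs σ} r))
             (all∈⇒⊆ vs (subspace gσ) (∧-snd {σ v} (∧-fst {σ v ∧ all∈ vs σ} r)) b m)))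
          (does-intro (Qf v Finₚ.≟ 0#) (singular gσ v (∧-fst (∧-fst {σ v ∧ all∈ vs σ} r)))))))))
        (∑-0 gens)

      cases : ∀ v → Φ (v ∷ vs) π k ≡ 𝟙 (T v) * Φ vs π k +
                (𝟙 (join v ∧ not (T v)) * X + 𝟙 ((perp T v ∧ not (join v)) ∧ sing v) * Y)
      cases v with bool-cases (T v)
      ... | inj₁ m rewrite m | T⊆join v m | T⊆perp v m = trans (inside v m)
              (solve 1 (λ p → p := con 1 :* p :+ (con 0 :+ con 0)) refl (Φ vs π k))
      ... | inj₂ m rewrite m with bool-cases (join v)
      ...   | inj₁ j = trans (extend v m v⊥ (singular join-gen v j))
                (trans (cong (λ z → sh z (cc q n) k) cr) (sym (rhs j v⊥)))
        where
        v⊥ : v ∈S perp T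
        v⊥ = join⊆perp v j
        cr : corank (v ∷ vs) π ≡ a
        cr rewrite join-mem v⊥ | j = refl
        rhs : join v ≡ true → v ∈S perp T → 𝟙 (join v ∧ true) * X + 𝟙 ((perp T v ∧ not (join v)) ∧ sing v) * Y ≡ X
        rhs j p rewrite j | p = solve 1 (λ x → con 1 :* x :+ con 0 := x) refl X
      ...   | inj₂ j rewrite j with bool-cases (perp T v ∧ sing v)
      ...     | inj₂ n rewrite 𝔹ₚ.∧-identityʳ (perp T v) | n = outside v n
      ...     | inj₁ y rewrite 𝔹ₚ.∧-identityʳ (perp T v) | y =
                trans (extend v m (∧-fst y) (does-elim (Qf v Finₚ.≟ 0#) (∧-snd {perp T v} y)))
                (trans (cong (λ z → sh z (cc q n) k) cr) (sym (ℕₚ.*-identityˡ Y)))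
        where
        cr : corank (v ∷ vs) π ≡ suc a
        cr rewrite join-mem (∧-fst y) | j = refl

      total : q ^ d * Φ vs π k ≡ q ^ t * Φ vs π k + (N₁ * X + N₂ * Y)
      total = trans (sym flags) (trans (∑-cong allV cases) (trans (∑-⊕ allV _ _)
        (cong₂ _+_ (trans (∑-*ʳ allV (Φ vs π k) _) (cong (_* Φ vs π k) (span-card vs ind)))
          (trans (∑-⊕ allV _ _) (cong₂ _+_ (∑-*ʳ allV X _) (∑-*ʳ allV Y _))))))

      N₁-eq : N₁ + q ^ t ≡ q ^ d
      N₁-eq = trans (cong (N₁ +_) (sym (span-card vs ind))) (trans (sym (∑-⊕ allV _ _))
        (trans (∑-cong allV part) (size join-gen)))
        where
        part : ∀ v → 𝟙 (join v ∧ not (T v)) + 𝟙 (T v) ≡ 𝟙 (join v)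
        part v with bool-cases (T v)
        ... | inj₁ m rewrite m | T⊆join v m = refl
        ... | inj₂ m rewrite m | 𝔹ₚ.∧-identityʳ (join v) = ℕₚ.+-identityʳ _

      N₂-eq : N₂ ≡ q ^ n * N₁
      N₂-eq = ℕₚ.*-cancelˡ-≡ _ _ (q ^ suc t) ⦃ q^-nz (suc t) ⦄ (ℕₚ.+-cancelʳ-≡ (q ^ d * q ^ t) _ _ (begin
        q ^ suc t * N₂ + q ^ d * q ^ t
          ≡⟨ solve 4 (λ q t m d → q :* t :* m :+ d :* t := (q :* m :+ d) :* t) refl q (q ^ t) N₂ (q ^ d) ⟩
        (q * N₂ + q ^ d) * q ^ t
          ≡⟨ cong₂ _*_ (singular-count join-gen (perp-subspace T) join⊆perp) (sym (span-card vs ind)) ⟩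
        card (perp T) * card T
          ≡⟨ trans (perp-card sT) (ℕₚ.^-distribˡ-+-* q d d) ⟩
        q ^ d * q ^ d
          ≡⟨ cong (q ^ d *_) (sym N₁-eq) ⟩
        q ^ d * (N₁ + q ^ t)
          ≡⟨ ℕₚ.*-distribˡ-+ (q ^ d) N₁ (q ^ t) ⟩
        q ^ d * N₁ + q ^ d * q ^ t
          ≡⟨ cong (λ z → z * N₁ + q ^ d * q ^ t) (trans (cong (q ^_) (sym (trans (ℕₚ.+-comm (suc t) n) (trans (ℕₚ.+-suc n t) n+t≡d))))
               (ℕₚ.^-distribˡ-+-* q (suc t) n)) ⟩
        q ^ suc t * q ^ n * N₁ + q ^ d * q ^ t
          ≡⟨ cong (_+ q ^ d * q ^ t) (ℕₚ.*-assoc (q ^ suc t) (q ^ n) N₁) ⟩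
        q ^ suc t * (q ^ n * N₁) + q ^ d * q ^ t ∎))

      N₁-nz : NonZero N₁
      N₁-nz = Data.Nat.≢-nonZero (λ z → ℕₚ.<⇒≢ (ℕₚ.^-monoʳ-< q 2≤q t<d) (trans (cong (_+ q ^ t) (sym z)) N₁-eq))
        where
        t<d : t < d
        t<d = subst (t <_) n+t≡d (s≤s (ℕₚ.m≤n+m t n))

      Φ≡ : Φ vs π k ≡ X + q ^ n * Y
      Φ≡ = ℕₚ.*-cancelˡ-≡ _ _ N₁ ⦃ N₁-nz ⦄ (ℕₚ.+-cancelʳ-≡ (q ^ t * Φ vs π k) _ _ (begin
        N₁ * Φ vs π k + q ^ t * Φ vs π k
          ≡⟨ sym (ℕₚ.*-distribʳ-+ (Φ vs π k) N₁ (q ^ t)) ⟩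
        (N₁ + q ^ t) * Φ vs π k
          ≡⟨ cong (_* Φ vs π k) N₁-eq ⟩
        q ^ d * Φ vs π k
          ≡⟨ total ⟩
        q ^ t * Φ vs π k + (N₁ * X + N₂ * Y)
          ≡⟨ cong (λ z → q ^ t * Φ vs π k + (N₁ * X + z * Y)) N₂-eq ⟩
        q ^ t * Φ vs π k + (N₁ * X + q ^ n * N₁ * Y)
          ≡⟨ solve 5 (λ z n x p y → z :+ (n :* x :+ p :* n :* y) := n :* (x :+ p :* y) :+ z) refl
               (q ^ t * Φ vs π k) N₁ X (q ^ n) Y ⟩
        N₁ * (X + q ^ n * Y) + q ^ t * Φ vs π k ∎))

even : ℕ → Bool
even zero    = true
even (suc n) = not (even n)

even-+ : ∀ m {n} → even m ≡ true → even (m + n) ≡ even n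
even-+ zero          p = refl
even-+ (suc (suc m)) {n} p = trans (𝔹ₚ.not-involutive (even (m + n))) (even-+ m (trans (sym (𝔹ₚ.not-involutive (even m))) p))

even⇒%2 : ∀ n → even n ≡ true → n % 2 ≡ 0
even⇒%2 zero          p = refl
even⇒%2 (suc (suc n)) p = even⇒%2 n (trans (sym (𝔹ₚ.not-involutive (even n))) p)

%2⇒even : ∀ n → n % 2 ≡ 0 → even n ≡ true
%2⇒even zero          p = refl
%2⇒even (suc (suc n)) p = trans (𝔹ₚ.not-involutive (even n)) (%2⇒even n p)

even-2* : ∀ n → even (2 * n) ≡ true
even-2* zero    = refl
even-2* (suc n) = trans (cong (λ z → not (even z)) (ℕₚ.+-suc n (n + 0))) (trans (𝔹ₚ.not-involutive _) (even-2* n))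

even-half : ∀ n → even n ≡ true → ∃ λ j → n ≡ 2 * j
even-half zero          p = 0 , refl
even-half (suc (suc n)) p with even-half n (trans (sym (𝔹ₚ.not-involutive (even n))) p)
... | j , e = suc j , cong suc (trans (cong suc e) (sym (ℕₚ.+-suc j (j + 0))))

sh-cc₁-≤1 : ∀ q a k → sh a (cc q 1) k ≤ 1
sh-cc₁-≤1 q zero    zero          = s≤s z≤n
sh-cc₁-≤1 q zero    (suc zero)    = s≤s z≤n
sh-cc₁-≤1 q zero    (suc (suc k)) = z≤n
sh-cc₁-≤1 q (suc a) zero          = z≤n
sh-cc₁-≤1 q (suc a) (suc k)       = sh-cc₁-≤1 q a k

sh-cc₁-supp : ∀ q a k → 1 ≤ sh a (cc q 1) k → k ≡ a ⊎ k ≡ suc a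
sh-cc₁-supp q zero    zero          p = inj₁ refl
sh-cc₁-supp q zero    (suc zero)    p = inj₂ refl
sh-cc₁-supp q (suc a) (suc k)       p with sh-cc₁-supp q a k p
... | inj₁ e = inj₁ (cong suc e)
... | inj₂ e = inj₂ (cong suc e)

module Classes {q : ℕ} (F : FiniteField q) (d : ℕ) where
  open Counting F d public
  open Geometry F d

  record Codim (σ π : Sub) (k : ℕ) : Set where
    constructor mkCodim
    field eqn : card (σ ∩S π) * q ^ k ≡ q ^ d

  open Codim public

  Codim-sym : ∀ {σ π k} → Codim σ π k → Codim π σ k
  Codim-sym {σ} {π} {k} e = mkCodim (trans (cong (_* q ^ k) (card-cong (∩-comm π σ))) (eqn e))

  Codim-resp : ∀ {σ τ} → σ ≈S τ → ∀ π k → Codim σ π k → Codim τ π k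
  Codim-resp {σ} {τ} p π k e = mkCodim (trans (cong (_* q ^ k)
    (card-cong {τ ∩S π} {σ ∩S π} (∩-cong (≈S-sym p) (λ _ → refl)))) (eqn e))

  module _ {σ π : Sub} (gσ : IsGen σ) (gπ : IsGen π) where
    private
      s : IsSubspace (σ ∩S π)
      s = ∩-subspace (subspace gσ) (subspace gπ)
    card∩-nz : NonZero (card (σ ∩S π))
    card∩-nz = Data.Nat.>-nonZero (card-pos (has-0 s))

    Codim-unique : ∀ {a b} → Codim σ π a → Codim σ π b → a ≡ b
    Codim-unique e e′ = q^-inj (ℕₚ.*-cancelˡ-≡ _ _ (card (σ ∩S π)) ⦃ card∩-nz ⦄ (trans (eqn e) (sym (eqn e′))))

    Codim-exists : ∃ λ k → Codim σ π k × k ≤ d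
    Codim-exists = d ∸ dim , mkCodim (trans (cong (_* q ^ (d ∸ dim)) card≡)
        (trans (sym (ℕₚ.^-distribˡ-+-* q dim (d ∸ dim))) (cong (q ^_) (ℕₚ.m+[n∸m]≡n dim≤d)))) , ℕₚ.m∸n≤m d dim
      where
      open Basis (basis s)
      dim≤d : dim ≤ d
      dim≤d = ℕₚ.≮⇒≥ (λ h → ℕₚ.<⇒≱ (ℕₚ.^-monoʳ-< q 2≤q h)
        (subst (_≤ q ^ d) card≡ (subst (card (σ ∩S π) ≤_) (size gσ) (∑-mono allV (λ v → le (σ v) (π v))))))
        where
        le : ∀ a b → 𝟙 (a ∧ b) ≤ 𝟙 a
        le true  b = 𝟙-≤1 b
        le false b = z≤n

    Codim⇒≤ : ∀ {k} → Codim σ π k → k ≤ d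
    Codim⇒≤ e = let (k , e′ , h) = Codim-exists in subst (_≤ d) (Codim-unique e′ e) h

    Codim⇒hasDim : ∀ {k} → Codim σ π k → HasDim (σ ∩S π) (d ∸ k)
    Codim⇒hasDim {k} e = ⇒hasDim s (ℕₚ.*-cancelʳ-≡ _ _ (q ^ k) ⦃ q^-nz k ⦄
      (trans (eqn e) (trans (cong (q ^_) (sym (ℕₚ.m∸n+n≡m (Codim⇒≤ e)))) (ℕₚ.^-distribˡ-+-* q (d ∸ k) k))))

    Codim₀ : Codim σ π 0 → σ ≈S π
    Codim₀ e = ⊆∧card⇒≈ (λ v m → ∧-snd {σ v} (trans (same v) m)) (ℕₚ.≤-reflexive (trans (size gπ) (sym (size gσ))))
      where
      same : (σ ∩S π) ≈S σ
      same = ⊆∧card⇒≈ (λ v → ∧-fst) (ℕₚ.≤-reflexive (trans (size gσ) (trans (sym (eqn e)) (ℕₚ.*-identityʳ _))))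

  hasDim⇒Codim : ∀ {σ π k} → k ≤ d → HasDim (σ ∩S π) (d ∸ k) → Codim σ π k
  hasDim⇒Codim {k = k} h e = mkCodim (trans (cong (_* q ^ k) (proj₂ (hasDim⇒ e)))
    (trans (sym (ℕₚ.^-distribˡ-+-* q (d ∸ k) k)) (cong (q ^_) (ℕₚ.m∸n+n≡m h))))

  Adjacent : ℕ → ℕ → Set
  Adjacent a b = a ≡ suc b ⊎ b ≡ suc a

  -- By Φ-count a (d-1)-space lies in exactly two generators, and their codimensions in a
  -- third generator differ by one.
  adjacent : ∀ {n} (vs : Vec V n) → Ind vs → suc n ≡ d → ∀ {σ σ′ τ} → IsGen σ → IsGen σ′ → IsGen τ →
    all∈ vs σ ≡ true → all∈ vs σ′ ≡ true → ¬ (σ ≈S σ′) → ∀ {a b} → Codim σ τ a → Codim σ′ τ b → Adjacent a b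
  adjacent vs ind sn {σ} {σ′} {τ} gσ gσ′ gτ m m′ σ≉σ′ {a} {b} ea eb = conclude (supp gσ m ea) (supp gσ′ m′ eb)
    where
    A : ℕ
    A = corank vs τ
    Φ≡ : ∀ k → Φ vs τ k ≡ sh A (cc q 1) k
    Φ≡ = Φ-count gτ 1 vs ind (λ v p → singular gσ v (all∈⇒⊆ vs (subspace gσ) m v p)) sn
    p : ℕ → Sub → Bool
    p k σ = all∈ vs σ ∧ codim σ τ k
    p-resp : ∀ k {σ σ′} → σ ≈S σ′ → p k σ ≡ p k σ′
    p-resp k r = cong₂ _∧_ (all∈-resp vs r) (codim-resp r τ k)
    one : ∀ {σ k} → IsGen σ → p k σ ≡ true → ∑ gens (λ υ → 𝟙 (does (υ ≈? σ)) * 𝟙 (p k υ)) ≡ 1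
    one {σ} {k} g r = trans (gens-pick g (λ υ → 𝟙 (p k υ)) (λ υ e → cong 𝟙 (p-resp k e))) (cong 𝟙 r)
    p-true : ∀ {σ k} → all∈ vs σ ≡ true → Codim σ τ k → p k σ ≡ true
    p-true {σ} {k} r e = ∧-intro r (does-intro (codim? σ τ k) (eqn e))
    supp : ∀ {σ k} → IsGen σ → all∈ vs σ ≡ true → Codim σ τ k → k ≡ A ⊎ k ≡ suc A
    supp {σ} {k} g r e = sh-cc₁-supp q A k (subst (1 ≤_) (Φ≡ k) (subst (_≤ Φ vs τ k) (one {σ} {k} g (p-true {σ} {k} r e))
      (∑-mono gens (λ υ → le (does (υ ≈? σ)) (p k υ)))))
      where
      le : ∀ a b → 𝟙 a * 𝟙 b ≤ 𝟙 b
      le true  b = ℕₚ.≤-reflexive (ℕₚ.*-identityˡ _)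
      le false b = z≤n
    a≢b : a ≢ b
    a≢b refl = ℕₚ.<⇒≱ (ℕₚ.n<1+n 1) (ℕₚ.≤-trans two (subst (_≤ 1) (sym (Φ≡ a)) (sh-cc₁-≤1 q A a)))
      where
      pt : ∀ υ → 𝟙 (does (υ ≈? σ)) * 𝟙 (p a υ) + 𝟙 (does (υ ≈? σ′)) * 𝟙 (p a υ) ≤ 𝟙 (p a υ)
      pt υ with υ ≈? σ | υ ≈? σ′
      ... | yes r | yes r′ = ⊥-elim (σ≉σ′ (≈S-trans (≈S-sym r) r′))
      ... | yes r | no _ = ℕₚ.≤-reflexive (trans (ℕₚ.+-identityʳ _) (ℕₚ.*-identityˡ _))
      ... | no _ | yes r′ = ℕₚ.≤-reflexive (ℕₚ.*-identityˡ _)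
      ... | no _ | no _ = z≤n
      two : 2 ≤ Φ vs τ a
      two = subst (_≤ Φ vs τ a) (trans (∑-⊕ gens _ _) (cong₂ _+_ (one {σ} {a} gσ (p-true {σ} {a} m ea)) (one {σ′} {a} gσ′ (p-true {σ′} {a} m′ eb))))
              (∑-mono gens pt)
    conclude : a ≡ A ⊎ a ≡ suc A → b ≡ A ⊎ b ≡ suc A → Adjacent a b
    conclude (inj₁ e) (inj₁ e′) = ⊥-elim (a≢b (trans e (sym e′)))
    conclude (inj₁ e) (inj₂ e′) = inj₂ (trans e′ (cong suc (sym e)))
    conclude (inj₂ e) (inj₁ e′) = inj₁ (trans e (cong suc (sym e′)))
    conclude (inj₂ e) (inj₂ e′) = ⊥-elim (a≢b (trans e (sym e′)))

  abstract
    closer : ∀ {σ ρ} → IsGen σ → IsGen ρ → ∀ k → Codim σ ρ (suc k) → ∃ λ σ′ → IsGen σ′ × Codim σ′ ρ k ×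
      (∀ {τ} → IsGen τ → ∀ {a b} → Codim σ τ a → Codim σ′ τ b → Adjacent a b)
    closer {σ} {ρ} gσ gρ k e = join , join-gen , codim′ , adj
      where
      witness : ∃ λ x → x ∈S ρ × σ x ≡ false
      witness with ∃V? (λ x → (x ∈? ρ) Dec.×-dec (σ x 𝔹ₚ.≟ false))
      ... | yes w = w
      ... | no none = ⊥-elim (absurd (Codim-unique gσ gρ e (mkCodim (trans (ℕₚ.*-identityʳ _) (trans (card-cong {σ ∩S ρ} {ρ}
              (λ v → bool-ext (∧-snd {σ v}) (λ m → ∧-intro (ρ⊆σ v m) m))) (size gρ))))))
        where
        absurd : suc k ≢ 0
        absurd ()
        ρ⊆σ : ρ ⊆S σ
        ρ⊆σ v m with bool-cases (σ v)
        ... | inj₁ r = r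
        ... | inj₂ r = ⊥-elim (none (v , m , r))
      x : V
      x = proj₁ witness
      x∈ρ : x ∈S ρ
      x∈ρ = proj₁ (proj₂ witness)
      x∉σ : σ x ≡ false
      x∉σ = proj₂ (proj₂ witness)
      T : Sub
      T = span (x ∷ [])
      sT : IsSubspace T
      sT = span-subspace (x ∷ [])
      T⊆ρ : T ⊆S ρ
      T⊆ρ = all∈⇒⊆ (x ∷ []) (subspace gρ) (∧-intro x∈ρ refl)
      open Join gσ sT (λ v m → singular gρ v (T⊆ρ v m))
      W : Sub
      W = σ ∩S perp T
      sW : IsSubspace W
      sW = ∩-subspace (subspace gσ) (perp-subspace T)
      indx : Ind (x ∷ [])
      indx = not-true (λ r → false≢true x∉σ (subst (_∈S σ) (sym (0S-elim r)) (has-0 (subspace gσ)))) , _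
      corank₁ : corank (x ∷ []) σ ≡ 1
      corank₁ with bool-cases ((0S ⊞ σ) x)
      ... | inj₂ r rewrite r = refl
      ... | inj₁ r = let (a , m , r′) = ⊞-elim 0S σ r in
              ⊥-elim (false≢true x∉σ (subst (_∈S σ) (trans (cong (x +V_) (0S-elim m)) (+V-idʳ x)) r′))
      T∩σ : card (T ∩S perp σ) ≡ 1
      T∩σ = trans (card-cong {T ∩S perp σ} {T ∩S σ} (λ v → cong (T v ∧_) (sym (self-perp gσ v))))
        (ℕₚ.*-cancelʳ-≡ _ _ (q ^ 1) ⦃ q^-nz 1 ⦄ (trans (trans (cong (λ z → card (T ∩S σ) * q ^ z) (sym corank₁))
          (corank-card (x ∷ []) (subspace gσ) indx)) (sym (ℕₚ.*-identityˡ _))))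
      open Basis (basis sW)
      sn : suc dim ≡ d
      sn = q^-inj (begin
        q * q ^ dim
          ≡⟨ ℕₚ.*-comm q _ ⟩
        q ^ dim * q
          ≡⟨ cong₂ _*_ (sym card≡) (sym (trans (span-card (x ∷ []) indx) (ℕₚ.*-identityʳ q))) ⟩
        card W * card T
          ≡⟨ duality (subspace gσ) sT ⟩
        card (T ∩S perp σ) * card σ
          ≡⟨ cong₂ _*_ T∩σ (size gσ) ⟩
        1 * q ^ d
          ≡⟨ ℕₚ.*-identityˡ _ ⟩
        q ^ d ∎)
        where open ≡-Reasoning
      adj : ∀ {τ} → IsGen τ → ∀ {a b} → Codim σ τ a → Codim join τ b → Adjacent a b
      adj gτ = adjacent vecs ind sn gσ join-gen gτ
        (⊆⇒all∈ vecs (λ v m → ∧-fst (trans (sym (span≈ v)) m)))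
        (⊆⇒all∈ vecs (λ v m → ⊆⊞ʳ sT sW v (trans (sym (span≈ v)) m)))
        (λ σ≈ → false≢true x∉σ (trans (σ≈ x) (T⊆join x (ext-∋ 0S-subspace x))))
      le : card (σ ∩S ρ) ≤ card (join ∩S ρ)
      le = ∑-mono allV pt
        where
        pt : ∀ v → 𝟙 ((σ ∩S ρ) v) ≤ 𝟙 ((join ∩S ρ) v)
        pt v with bool-cases ((σ ∩S ρ) v)
        ... | inj₂ r = subst (_≤ 𝟙 ((join ∩S ρ) v)) (cong 𝟙 (sym r)) z≤n
        ... | inj₁ r = subst (λ z → 𝟙 ((σ ∩S ρ) v) ≤ 𝟙 z) (sym (∧-intro {join v} {ρ v}
                (⊆⊞ʳ sT sW v (∧-intro (∧-fst {σ v} r) (perp-intro T (λ a m → ⊥-mem gρ (∧-snd {σ v} r) (T⊆ρ a m)))))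
                (∧-snd {σ v} r))) (𝟙-≤1 _)
      not-farther : ∀ {b} → Codim join ρ b → b ≢ suc (suc k)
      not-farther {b} eb refl = ℕₚ.<⇒≢ lt (trans (eqn e) (sym (eqn eb)))
        where
        lt : card (σ ∩S ρ) * q ^ suc k < card (join ∩S ρ) * q ^ b
        lt = ℕₚ.<-≤-trans (ℕₚ.*-monoʳ-< (card (σ ∩S ρ)) ⦃ card∩-nz gσ gρ ⦄ (ℕₚ.^-monoʳ-< q 2≤q (ℕₚ.n<1+n (suc k))))
               (ℕₚ.*-monoˡ-≤ (q ^ b) le)
      codim-from : ∀ {b} → Codim join ρ b → Adjacent (suc k) b → Codim join ρ k
      codim-from eb (inj₁ p) = subst (Codim join ρ) (sym (ℕₚ.suc-injective p)) eb
      codim-from eb (inj₂ p) = ⊥-elim (not-farther eb p)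
      codim′ : Codim join ρ k
      codim′ = let (b , eb , _) = Codim-exists join-gen gρ in codim-from eb (adj gρ e eb)

  parity : ∀ k {σ ρ} → IsGen σ → IsGen ρ → Codim σ ρ k → ∀ {τ} → IsGen τ → ∀ {a b} →
           Codim σ τ a → Codim ρ τ b → even a ≡ even (k + b)
  parity zero    gσ gρ e {τ} gτ {a} ea eb =
    cong even (Codim-unique gρ gτ (Codim-resp (Codim₀ gσ gρ e) τ a ea) eb)
  parity (suc k) gσ gρ e gτ {a} {b} ea eb =
    let (σ′ , g′ , e′ , adj) = closer gσ gρ k e
        (c , ec , _) = Codim-exists g′ gτ
    in trans (flip (adj gτ ea ec)) (cong not (parity k g′ gρ e′ gτ ec eb))
    where
    flip : ∀ {a c} → Adjacent a c → even a ≡ not (even c)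
    flip (inj₁ refl) = refl
    flip {a} (inj₂ refl) = sym (𝔹ₚ.not-involutive (even a))

  module _ (d-even : d % 2 ≡ 0) {ρ : Sub} (gρ : IsGen ρ) where
    EvenTo : Sub → Set
    EvenTo π = IsGen π × (∀ {a} → Codim π ρ a → even a ≡ true)

    private
      even-∸ : ∀ {a} → a ≤ d → even (d ∸ a) ≡ true → even a ≡ true
      even-∸ {a} h p = trans (sym (even-+ (d ∸ a) p)) (trans (cong even (ℕₚ.m∸n+n≡m h)) (%2⇒even d d-even))

    inClass⇒ : ∀ {π} → InClass ρ π → EvenTo π
    inClass⇒ {π} (gen , k , h , p) = g , λ {a} e → let a≤d = Codim⇒≤ g gρ e in
        even-∸ a≤d (trans (cong even (q^-inj {d ∸ a} {k} (trans (sym (proj₂ (hasDim⇒ (Codim⇒hasDim g gρ e)))) (proj₂ (hasDim⇒ h)))))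
                          (%2⇒even k (trans p d-even)))
      where
      g : IsGen π
      g = generator⇒ gen

    ⇒inClass : ∀ {π} → EvenTo π → InClass ρ π
    ⇒inClass {π} (g , p) with Codim-exists g gρ
    ... | a , e , a≤d = ⇒generator g , d ∸ a , Codim⇒hasDim g gρ e ,
            trans (even⇒%2 (d ∸ a) (even-∸ {d ∸ a} (ℕₚ.m∸n≤m d a)
              (trans (cong even (ℕₚ.m∸[m∸n]≡n a≤d)) (p e)))) (sym d-even)

    class-even : ∀ {σ π} → EvenTo σ → EvenTo π → ∀ {a} → Codim σ π a → even a ≡ true
    class-even {σ} {π} (gσ , pσ) (gπ , pπ) e with Codim-exists gσ gρ | Codim-exists gπ gρ
    ... | k , ek , _ | b , eb , _ = trans (parity k gσ gρ ek gπ e (Codim-sym {π} {ρ} eb))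
            (trans (even-+ k (pσ ek)) (pπ eb))

    even-class : ∀ {σ π} → IsGen σ → EvenTo π → ∀ {a} → Codim σ π a → even a ≡ true → EvenTo σ
    even-class {σ} {π} gσ (gπ , pπ) {a} e p = gσ , λ eb → let (k , ek , _) = Codim-exists gπ gρ in
      trans (parity a gσ gπ e gρ eb ek) (trans (even-+ a p) (pπ ek))

cc-q : ∀ q n k → cc q (suc n) (suc k) ≡ q ^ suc k * cc q n (suc k) + q ^ k * cc q n k
cc-q q zero    zero    = sym (cong (_+ 1) (ℕₚ.*-zeroʳ (q * 1)))
cc-q q zero    (suc k) = sym (cong₂ _+_ (ℕₚ.*-zeroʳ (q ^ suc (suc k))) (ℕₚ.*-zeroʳ (q ^ suc k)))
cc-q q (suc n) zero    = trans (cong (_+ q ^ suc n * 1) (cc-q q n zero))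
  (solve 3 (λ q c p → (q :* con 1 :* c :+ con 1 :* con 1) :+ q :* p :* con 1 :=
     q :* con 1 :* (c :+ p :* con 1) :+ con 1 :* con 1) refl q (cc q n 1) (q ^ n))
  where open +-*-Solver
cc-q q (suc n) (suc k) = trans (cong₂ (λ x y → x + q ^ suc n * y) (cc-q q n (suc k)) (cc-q q n k))
  (solve 6 (λ q a b c p r → (q :* (q :* r) :* a :+ q :* r :* b) :+ q :* p :* (q :* r :* b :+ r :* c) :=
     q :* (q :* r) :* (a :+ p :* b) :+ q :* r :* (b :+ p :* c)) refl
     q (cc q n (suc (suc k))) (cc q n (suc k)) (cc q n k) (q ^ n) (q ^ k))
  where open +-*-Solver

tri : ℕ → ℕ
tri zero    = 0
tri (suc k) = tri k + k

cc-gauss : ∀ q n k → cc q n k ≡ q ^ tri k * gauss q n k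
cc-gauss q n       zero    = refl
cc-gauss q zero    (suc k) = sym (ℕₚ.*-zeroʳ (q ^ tri (suc k)))
cc-gauss q (suc n) (suc k) rewrite cc-q q n k | cc-gauss q n (suc k) | cc-gauss q n k | ℕₚ.^-distribˡ-+-* q (tri k) k =
  solve 5 (λ q r t g h → q :* r :* (t :* r :* h) :+ r :* (t :* g) := t :* r :* (g :+ q :* r :* h)) refl
    q (q ^ k) (q ^ tri k) (gauss q n k) (gauss q n (suc k))
  where open +-*-Solver

tri-odd : ∀ i → tri (suc (2 * i)) ≡ suc (2 * i) * i
tri-odd zero    = refl
tri-odd (suc i) rewrite ℕₚ.+-suc i (i + 0) = trans
  (cong (λ z → z + suc (2 * i) + suc (suc (2 * i))) (tri-odd i))
  (solve 1 (λ i → (con 1 :+ con 2 :* i) :* i :+ (con 1 :+ con 2 :* i) :+ (con 2 :+ con 2 :* i) :=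
     (con 3 :+ con 2 :* i) :* (con 1 :+ i)) refl i)
  where open +-*-Solver

module Coefficients (q : ℕ) (2≤q : 2 ≤ q) where
  open ℤ using (ℤ; +_; 0ℤ; 1ℤ)
  open Data.Integer.Solver.+-*-Solver using (solve; _:+_; _:*_; _:-_; :-_; _:=_; con)

  infixl 6 _⊕_ _⊖_
  infixl 7 _⊗_

  _⊕_ _⊖_ _⊗_ : ℤ → ℤ → ℤ
  _⊕_ = ℤ._+_
  _⊖_ = ℤ._-_
  _⊗_ = ℤ._*_

  abstract
    Q^ : ℕ → ℤ
    Q^ n = + (q ^ n)

    Q^≡ : ∀ n → Q^ n ≡ + (q ^ n)
    Q^≡ n = refl

    Q^-0 : Q^ 0 ≡ 1ℤ
    Q^-0 = refl

    Q^-+ : ∀ m n → Q^ (m + n) ≡ Q^ m ⊗ Q^ n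
    Q^-+ m n = trans (cong +_ (ℕₚ.^-distribˡ-+-* q m n)) (ℤₚ.pos-* (q ^ m) (q ^ n))

    Q^-suc : ∀ n → Q^ (suc n) ≡ + q ⊗ Q^ n
    Q^-suc n = ℤₚ.pos-* q (q ^ n)

    Q^-nz : ∀ n → ℤ.NonZero (Q^ n)
    Q^-nz n = ℕₚ.m^n≢0 q n ⦃ Data.Nat.>-nonZero (ℕₚ.<-trans (s≤s z≤n) 2≤q) ⦄

    Q^-pos : ∀ n x → + (q ^ n * x) ≡ Q^ n ⊗ + x
    Q^-pos n x = ℤₚ.pos-* (q ^ n) x

  -- Power series are given by their coefficients: M a multiplies by 1 + a z, D substitutes q z for z.

  Series : Set
  Series = ℕ → ℤ

  infix 4 _≗_
  _≗_ : Series → Series → Set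
  P ≗ R = ∀ k → P k ≡ R k

  M : ℤ → Series → Series
  M a P zero    = P 0
  M a P (suc k) = P (suc k) ⊕ a ⊗ P k

  D : Series → Series
  D P k = Q^ k ⊗ P k

  M-cong : ∀ {a P R} → P ≗ R → M a P ≗ M a R
  M-cong         p zero    = p 0
  M-cong {a}     p (suc k) = cong₂ (λ x y → x ⊕ a ⊗ y) (p (suc k)) (p k)

  M-comm : ∀ a b P → M a (M b P) ≗ M b (M a P)
  M-comm a b P zero          = refl
  M-comm a b P (suc zero)    = solve 4 (λ a b x y → (x :+ b :* y) :+ a :* y := (x :+ a :* y) :+ b :* y) refl a b (P 1) (P 0)
  M-comm a b P (suc (suc k)) = solve 5 (λ a b x y z → (x :+ b :* y) :+ a :* (y :+ b :* z) := (x :+ a :* y) :+ b :* (y :+ a :* z))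
    refl a b (P (suc (suc k))) (P (suc k)) (P k)

  D-M : ∀ a P → D (M a P) ≗ M (+ q ⊗ a) (D P)
  D-M a P zero    = refl
  D-M a P (suc k) = begin
    Q^ (suc k) ⊗ (P (suc k) ⊕ a ⊗ P k)
      ≡⟨ ℤₚ.*-distribˡ-+ (Q^ (suc k)) (P (suc k)) (a ⊗ P k) ⟩
    Q^ (suc k) ⊗ P (suc k) ⊕ Q^ (suc k) ⊗ (a ⊗ P k)
      ≡⟨ cong (λ z → Q^ (suc k) ⊗ P (suc k) ⊕ z ⊗ (a ⊗ P k)) (Q^-suc k) ⟩
    Q^ (suc k) ⊗ P (suc k) ⊕ (+ q ⊗ Q^ k) ⊗ (a ⊗ P k)
      ≡⟨ cong (Q^ (suc k) ⊗ P (suc k) ⊕_) (solve 4 (λ q r a y → q :* r :* (a :* y) := q :* a :* (r :* y)) refl (+ q) (Q^ k) a (P k)) ⟩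
    Q^ (suc k) ⊗ P (suc k) ⊕ (+ q ⊗ a) ⊗ (Q^ k ⊗ P k) ∎
    where open ≡-Reasoning

  C : ℕ → Series
  C n k = + cc q n k

  C-q : ∀ n → C (suc n) ≗ M 1ℤ (D (C n))
  C-q n zero    = sym (trans (cong (_⊗ 1ℤ) Q^-0) refl)
  C-q n (suc k) = trans (cong +_ (cc-q q n k)) (cong₂ _⊕_ (Q^-pos (suc k) (cc q n (suc k)))
    (trans (Q^-pos k (cc q n k)) (sym (ℤₚ.*-identityˡ _))))

  -- R r t multiplies by ∏_{r ≤ j < r+t} (1 - qʲ z).

  R : ℕ → ℕ → Series → Series
  R r zero    P = P
  R r (suc t) P = R (suc r) t (M (ℤ.- Q^ r) P)

  R-cong : ∀ {P S} r t → P ≗ S → R r t P ≗ R r t S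
  R-cong r zero    p = p
  R-cong r (suc t) p = R-cong (suc r) t (M-cong p)

  R-M : ∀ r t a P → R r t (M a P) ≗ M a (R r t P)
  R-M r zero    a P k = refl
  R-M r (suc t) a P k = trans (R-cong (suc r) t (M-comm (ℤ.- Q^ r) a P) k) (R-M (suc r) t a (M (ℤ.- Q^ r) P) k)

  R-D : ∀ r t P → R (suc r) t (D P) ≗ D (R r t P)
  R-D r zero    P k = refl
  R-D r (suc t) P k = trans (R-cong (suc (suc r)) t (λ j → sym (trans (D-M (ℤ.- Q^ r) P j)
      (cong (λ z → M z (D P) j) (trans (sym (ℤₚ.neg-distribʳ-* (+ q) (Q^ r))) (cong ℤ.-_ (sym (Q^-suc r))))))) k)
    (R-D (suc r) t (M (ℤ.- Q^ r) P) k)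

  abstract
    H : ℕ → ℕ → Series
    H t n = R 0 t (C n)

    H≡ : ∀ t n k → H t n k ≡ R 0 t (C n) k
    H≡ t n k = refl

    H-1 : ∀ n k → H 1 n (suc k) ≡ C n (suc k) ⊖ C n k
    H-1 n k = cong (C n (suc k) ⊕_) (trans (cong (λ z → ℤ.- z ⊗ C n k) Q^-0)
      (solve 1 (λ x → con (ℤ.- 1ℤ) :* x := :- x) refl (C n k)))

    -- The factors with j = 0 are split off: their product is 1 - z², and q z replaces z in the rest.
    H-step : ∀ t n k → H (suc t) (suc n) (2 + k) ≡ Q^ (2 + k) ⊗ H t n (2 + k) ⊖ Q^ k ⊗ H t n k
    H-step t n k = begin
      R 1 t (M (ℤ.- Q^ 0) (C (suc n))) (2 + k)
        ≡⟨ cong (λ z → R 1 t (M (ℤ.- z) (C (suc n))) (2 + k)) Q^-0 ⟩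
      R 1 t (M (ℤ.- 1ℤ) (C (suc n))) (2 + k)
        ≡⟨ R-cong 1 t (M-cong (C-q n)) (2 + k) ⟩
      R 1 t (M (ℤ.- 1ℤ) (M 1ℤ (D (C n)))) (2 + k)
        ≡⟨ R-M 1 t (ℤ.- 1ℤ) _ (2 + k) ⟩
      M (ℤ.- 1ℤ) (R 1 t (M 1ℤ (D (C n)))) (2 + k)
        ≡⟨ M-cong {ℤ.- 1ℤ} (R-M 1 t 1ℤ _) (2 + k) ⟩
      M (ℤ.- 1ℤ) (M 1ℤ (R 1 t (D (C n)))) (2 + k)
        ≡⟨ M-cong {ℤ.- 1ℤ} (M-cong {1ℤ} (R-D 0 t (C n))) (2 + k) ⟩
      M (ℤ.- 1ℤ) (M 1ℤ (D (H t n))) (2 + k)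
        ≡⟨ solve 3 (λ x y z → (x :+ con 1ℤ :* y) :+ con (ℤ.- 1ℤ) :* (y :+ con 1ℤ :* z) := x :- z) refl
             (D (H t n) (2 + k)) (D (H t n) (suc k)) (D (H t n) k) ⟩
      Q^ (2 + k) ⊗ H t n (2 + k) ⊖ Q^ k ⊗ H t n k ∎
      where open ≡-Reasoning

    H-0 : ∀ t n → H t n 0 ≡ 1ℤ
    H-0 t n = go 0 t (C n)
      where
      go : ∀ r t P → R r t P 0 ≡ P 0
      go r zero    P = refl
      go r (suc t) P = go (suc r) t (M (ℤ.- Q^ r) P)

  -- w t i is the exponent of q in the coefficient H t n (2 i) (for 2 i ≤ t + n).

  w : ℕ → ℕ → ℕ
  w zero    i       = tri (2 * i)
  w (suc t) zero    = 0
  w (suc t) (suc i) = 2 * i + w t i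

  2*suc : ∀ i → 2 * suc i ≡ 2 + 2 * i
  2*suc i = cong suc (ℕₚ.+-suc i (i + 0))

  tri-step : ∀ i → tri (2 * suc i) ≡ tri (2 * i) + suc (4 * i)
  tri-step i = trans (cong tri (2*suc i)) (solveℕ 2 (λ t i → t ∔ con′ 2 ∗ i ∔ (con′ 1 ∔ con′ 2 ∗ i) ≔ t ∔ (con′ 1 ∔ con′ 4 ∗ i))
      refl (tri (2 * i)) i)
    where open +-*-Solver using () renaming (solve to solveℕ; _:+_ to _∔_; _:*_ to _∗_; con to con′; _:=_ to _≔_)

  w-0 : ∀ t → w t 0 ≡ 0
  w-0 zero    = refl
  w-0 (suc t) = refl

  w-mono : ∀ t i → w t i ≤ w t (suc i)
  w-mono zero    i       = subst (tri (2 * i) ≤_) (sym (tri-step i)) (ℕₚ.m≤m+n _ _)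
  w-mono (suc t) zero    = z≤n
  w-mono (suc t) (suc i) = ℕₚ.+-mono-≤ (ℕₚ.*-monoʳ-≤ 2 (ℕₚ.n≤1+n i)) (w-mono t i)

  w-≤ : ∀ t i → w t i ≤ tri (2 * i)
  w-≤ zero    i       = ℕₚ.≤-refl
  w-≤ (suc t) zero    = z≤n
  w-≤ (suc t) (suc i) = ℕₚ.≤-trans (ℕₚ.+-mono-≤ (ℕₚ.≤-trans (ℕₚ.*-monoˡ-≤ i {2} {4} (s≤s (s≤s z≤n))) (ℕₚ.n≤1+n (4 * i))) (w-≤ t i))
    (ℕₚ.≤-reflexive (trans (ℕₚ.+-comm (suc (4 * i)) _) (sym (tri-step i))))

  Unit : ℤ → Set
  Unit u = ∀ x → u ≢ + q ⊗ x

  unit-1 : ∀ y → Unit (1ℤ ⊕ + q ⊗ y)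
  unit-1 y x p = ℕₚ.<⇒≢ 2≤q (sym (ℕₚ.m*n≡1⇒m≡1 q ℤ.∣ x ⊖ y ∣ (trans (sym (ℤₚ.abs-* (+ q) (x ⊖ y))) (cong ℤ.∣_∣ (begin
    + q ⊗ (x ⊖ y)
      ≡⟨ solve 3 (λ q x y → q :* (x :- y) := q :* x :- q :* y) refl (+ q) x y ⟩
    + q ⊗ x ⊖ + q ⊗ y
      ≡⟨ cong (_⊖ + q ⊗ y) (sym p) ⟩
    (1ℤ ⊕ + q ⊗ y) ⊖ + q ⊗ y
      ≡⟨ solve 1 (λ z → (con 1ℤ :+ z) :- z := con 1ℤ) refl (+ q ⊗ y) ⟩
    1ℤ ∎)))))
    where open ≡-Reasoning

  unit-minus : ∀ {u} y → Unit u → Unit (+ q ⊗ y ⊖ u)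
  unit-minus {u} y n x p = n (y ⊖ x) (begin
    u
      ≡⟨ solve 2 (λ u z → u := z :- (z :- u)) refl u (+ q ⊗ y) ⟩
    + q ⊗ y ⊖ (+ q ⊗ y ⊖ u)
      ≡⟨ cong (+ q ⊗ y ⊖_) p ⟩
    + q ⊗ y ⊖ + q ⊗ x
      ≡⟨ solve 3 (λ q x y → q :* y :- q :* x := q :* (y :- x)) refl (+ q) x y ⟩
    + q ⊗ (y ⊖ x) ∎)
    where open ≡-Reasoning

  gauss-mod : ∀ a b → b ≤ a → ∃ λ x → gauss q a b ≡ 1 + q * x
  gauss-mod a       zero    _       = 0 , cong suc (sym (ℕₚ.*-zeroʳ q))
  gauss-mod (suc a) (suc b) (s≤s h) with gauss-mod a b h
  ... | x , e = x + q ^ b * gauss q a (suc b) , trans (cong₂ _+_ e (ℕₚ.*-assoc q (q ^ b) _))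
          (cong suc (sym (ℕₚ.*-distribˡ-+ q x _)))

  abstract
    valuation : ∀ t m i → ∃ λ u → H t (t + m) (2 * i) ≡ Q^ (w t i) ⊗ u × (2 * i ≤ t + (t + m) → Unit u)
    valuation zero m i = + gauss q m (2 * i) ,
        trans (H≡ 0 m (2 * i)) (trans (cong +_ (cc-gauss q m (2 * i))) (Q^-pos (tri (2 * i)) _)) ,
        λ h → let (x , e) = gauss-mod m (2 * i) h in
          subst Unit (sym (trans (cong +_ e) (cong (1ℤ ⊕_) (ℤₚ.pos-* q x)))) (unit-1 (+ x))
    valuation (suc t) m zero = 1ℤ , trans (H-0 (suc t) (suc t + m)) (sym (trans (cong (_⊗ 1ℤ) Q^-0) refl)) ,
        λ _ → subst Unit (trans (cong (1ℤ ⊕_) (ℤₚ.*-zeroʳ (+ q))) refl) (unit-1 0ℤ)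
    valuation (suc t) m (suc i) with valuation t m i | valuation t m (suc i)
    ... | u , e , h | u′ , e′ , _ = + q ⊗ (Q^ z ⊗ u′) ⊖ u , eq , λ le → unit-minus (Q^ z ⊗ u′) (h (bound le))
      where
      open ≡-Reasoning
      z : ℕ
      z = suc (w t (suc i) ∸ w t i)
      bound : 2 * suc i ≤ suc t + (suc t + m) → 2 * i ≤ t + (t + m)
      bound le = ℕₚ.≤-pred (ℕₚ.≤-pred (subst (2 + 2 * i ≤_) (cong suc (ℕₚ.+-suc t (t + m))) (subst (_≤ suc t + (suc t + m)) (2*suc i) le)))
      w≡ : 2 + w t (suc i) ≡ w t i + suc z
      w≡ = sym (trans (ℕₚ.+-suc (w t i) z) (cong suc (trans (ℕₚ.+-suc (w t i) _) (cong suc (ℕₚ.m+[n∸m]≡n (w-mono t i))))))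
      eq : H (suc t) (suc t + m) (2 * suc i) ≡ Q^ (2 * i + w t i) ⊗ (+ q ⊗ (Q^ z ⊗ u′) ⊖ u)
      eq = begin
        H (suc t) (suc t + m) (2 * suc i)
          ≡⟨ cong (H (suc t) (suc t + m)) (2*suc i) ⟩
        H (suc t) (suc t + m) (2 + 2 * i)
          ≡⟨ H-step t (t + m) (2 * i) ⟩
        Q^ (2 + 2 * i) ⊗ H t (t + m) (2 + 2 * i) ⊖ Q^ (2 * i) ⊗ H t (t + m) (2 * i)
          ≡⟨ cong₂ (λ x y → Q^ (2 + 2 * i) ⊗ x ⊖ Q^ (2 * i) ⊗ y)
               (trans (cong (H t (t + m)) (sym (2*suc i))) e′) e ⟩
        Q^ (2 + 2 * i) ⊗ (Q^ (w t (suc i)) ⊗ u′) ⊖ Q^ (2 * i) ⊗ (Q^ (w t i) ⊗ u)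
          ≡⟨ cong (_⊖ Q^ (2 * i) ⊗ (Q^ (w t i) ⊗ u)) (trans (sym (ℤₚ.*-assoc (Q^ (2 + 2 * i)) _ u′)) (cong (_⊗ u′) (begin
               Q^ (2 + 2 * i) ⊗ Q^ (w t (suc i))
                 ≡⟨ sym (Q^-+ (2 + 2 * i) _) ⟩
               Q^ (2 + 2 * i + w t (suc i))
                 ≡⟨ cong Q^ (trans (sym (trans (ℕₚ.+-suc (2 * i) _) (cong suc (ℕₚ.+-suc (2 * i) _)))) (cong (λ x → 2 * i + x) w≡)) ⟩
               Q^ (2 * i + (w t i + suc z))
                 ≡⟨ trans (Q^-+ (2 * i) _) (cong ((Q^ (2 * i)) ⊗_) (trans (Q^-+ (w t i) (suc z)) (cong (Q^ (w t i) ⊗_) (Q^-suc z)))) ⟩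
               Q^ (2 * i) ⊗ (Q^ (w t i) ⊗ (+ q ⊗ Q^ z)) ∎))) ⟩
        Q^ (2 * i) ⊗ (Q^ (w t i) ⊗ (+ q ⊗ Q^ z)) ⊗ u′ ⊖ Q^ (2 * i) ⊗ (Q^ (w t i) ⊗ u)
          ≡⟨ solve 6 (λ a b q z v u → a :* (b :* (q :* z)) :* v :- a :* (b :* u) := a :* b :* (q :* (z :* v) :- u)) refl
               (Q^ (2 * i)) (Q^ (w t i)) (+ q) (Q^ z) u′ u ⟩
        Q^ (2 * i) ⊗ Q^ (w t i) ⊗ (+ q ⊗ (Q^ z ⊗ u′) ⊖ u)
          ≡⟨ cong (_⊗ (+ q ⊗ (Q^ z ⊗ u′) ⊖ u)) (sym (Q^-+ (2 * i) (w t i))) ⟩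
        Q^ (2 * i + w t i) ⊗ (+ q ⊗ (Q^ z ⊗ u′) ⊖ u) ∎

  unit-low : ∀ {a b u v} → a < b → Unit u → Q^ a ⊗ u ≢ Q^ b ⊗ v
  unit-low {a} {b} {u} {v} a<b n p = n (Q^ c ⊗ v) (ℤₚ.*-cancelˡ-≡ (Q^ a) u (+ q ⊗ (Q^ c ⊗ v)) ⦃ Q^-nz a ⦄ (begin
    Q^ a ⊗ u
      ≡⟨ p ⟩
    Q^ b ⊗ v
      ≡⟨ cong (λ z → Q^ z ⊗ v) (sym (trans (ℕₚ.+-suc a c) (ℕₚ.m+[n∸m]≡n a<b))) ⟩
    Q^ (a + suc c) ⊗ v
      ≡⟨ cong (_⊗ v) (trans (Q^-+ a (suc c)) (cong (Q^ a ⊗_) (Q^-suc c))) ⟩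
    Q^ a ⊗ (+ q ⊗ Q^ c) ⊗ v
      ≡⟨ solve 4 (λ a q c v → a :* (q :* c) :* v := a :* (q :* (c :* v))) refl (Q^ a) (+ q) (Q^ c) v ⟩
    Q^ a ⊗ (+ q ⊗ (Q^ c ⊗ v)) ∎))
    where
    open ≡-Reasoning
    c : ℕ
    c = b ∸ suc a

  private
    ⊖-cancel : ∀ {x y} z → x ⊖ z ≡ y ⊖ z → x ≡ y
    ⊖-cancel {x} {y} z p = trans (solve 2 (λ x z → x := (x :- z) :+ z) refl x z)
      (trans (cong (_⊕ z) p) (solve 2 (λ x z → (x :- z) :+ z := x) refl y z))

    cancel-q² : ∀ {t n n′} → H (suc t) (suc n) 2 ≡ H 1 (suc n′) 2 → H t n 2 ≡ H 0 n′ 2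
    cancel-q² {t} {n} {n′} p = ℤₚ.*-cancelˡ-≡ (Q^ 2) _ _ ⦃ Q^-nz 2 ⦄ (⊖-cancel (Q^ 0 ⊗ 1ℤ)
      (trans (cong (λ z → Q^ 2 ⊗ H t n 2 ⊖ Q^ 0 ⊗ z) (sym (H-0 t n))) (trans (sym (H-step t n 0)) (trans p
        (trans (H-step 0 n′ 0) (cong (λ z → Q^ 2 ⊗ H 0 n′ 2 ⊖ Q^ 0 ⊗ z) (H-0 0 n′)))))))

  eigenvalues-differ : ∀ s m n i → (2 + s) + ((2 + s) + m) ≡ 2 + n → 2 * suc i ≤ (2 + s) + ((2 + s) + m) →
    H (2 + s) ((2 + s) + m) (2 * suc i) ≢ H 1 (suc n) (2 * suc i)
  eigenvalues-differ s m n zero e h p =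
    let (u , eu , hu) = valuation (suc s) m 1
        (v , ev , _)  = valuation 0 n 1
    in unit-low {w (suc s) 1} {1} {u} {v} (s≤s (ℕₚ.≤-reflexive (w-0 s)))
         (hu (s≤s (subst (1 ≤_) (sym (ℕₚ.+-suc s (s + m))) (s≤s z≤n))))
         (trans (sym eu) (trans (cancel-q² p) ev))
  eigenvalues-differ s m n (suc j) e h p =
    let (u , eu , hu) = valuation (2 + s) m (2 + j)
        (v , ev , _)  = valuation 1 n (2 + j)
    in unit-low {w (2 + s) (2 + j)} {w 1 (2 + j)} {u} {v} w< (hu h) (trans (sym eu) (trans p ev))
    where
    w< : w (2 + s) (2 + j) < w 1 (2 + j)
    w< = ℕₚ.+-monoʳ-< (2 * suc j) (ℕₚ.≤-trans (s≤s (ℕₚ.+-mono-≤ (ℕₚ.*-monoˡ-≤ j {2} {4} (s≤s (s≤s z≤n))) (w-≤ s j)))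
      (ℕₚ.≤-reflexive (trans (ℕₚ.+-comm (suc (4 * j)) _) (sym (tri-step j)))))

module Expansion (q : ℕ) (2≤q : 2 ≤ q) where
  open Coefficients q 2≤q public
  open ℤ using (ℤ; +_; 0ℤ; 1ℤ)
  open Data.Integer.Solver.+-*-Solver using (solve; _:+_; _:*_; _:-_; :-_; _:=_; con)

  δ : (ℕ → ℤ) → ℕ → ℤ
  δ ψ a = Q^ a ⊗ (ψ a ⊖ ψ (suc a))

  E : ℕ → (ℕ → ℤ) → ℤ
  E zero    ψ = ψ 0
  E (suc t) ψ = E t (δ ψ)

  private
    E-cong : ∀ t {ψ φ} → (∀ a → ψ a ≡ φ a) → E t ψ ≡ E t φ
    E-cong zero    p = p 0
    E-cong (suc t) p = E-cong t (λ a → cong₂ (λ x y → Q^ a ⊗ (x ⊖ y)) (p a) (p (suc a)))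

    shift-series : ℕ → Series → Series
    shift-series zero    P k       = P k
    shift-series (suc a) P zero    = 0ℤ
    shift-series (suc a) P (suc k) = shift-series a P k

    shift-sh : ∀ n a k → + sh a (cc q n) k ≡ shift-series a (C n) k
    shift-sh n zero    k       = refl
    shift-sh n (suc a) zero    = refl
    shift-sh n (suc a) (suc k) = shift-sh n a k

    shift-M : ∀ b P a k → shift-series a (M b P) k ≡ shift-series a P k ⊕ b ⊗ shift-series (suc a) P k
    shift-M b P zero    zero    = sym (trans (cong (P 0 ⊕_) (ℤₚ.*-zeroʳ b)) (ℤₚ.+-identityʳ (P 0)))
    shift-M b P zero    (suc k) = refl
    shift-M b P (suc a) zero    = sym (trans (cong (0ℤ ⊕_) (ℤₚ.*-zeroʳ b)) refl)
    shift-M b P (suc a) (suc k) = shift-M b P a k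

    E-shift : ∀ t r P k → E t (λ a → Q^ (r * a) ⊗ shift-series a P k) ≡ R r t P k
    E-shift zero    r P k = trans (cong (_⊗ P k) (trans (cong Q^ (ℕₚ.*-zeroʳ r)) Q^-0)) (ℤₚ.*-identityˡ (P k))
    E-shift (suc t) r P k = trans (E-cong t step) (E-shift t (suc r) (M (ℤ.- Q^ r) P) k)
      where
      open ≡-Reasoning
      step : ∀ a → δ (λ a → Q^ (r * a) ⊗ shift-series a P k) a ≡ Q^ (suc r * a) ⊗ shift-series a (M (ℤ.- Q^ r) P) k
      step a = begin
        Q^ a ⊗ (Q^ (r * a) ⊗ shift-series a P k ⊖ Q^ (r * suc a) ⊗ shift-series (suc a) P k)
          ≡⟨ cong (λ z → Q^ a ⊗ (Q^ (r * a) ⊗ shift-series a P k ⊖ z ⊗ shift-series (suc a) P k))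
               (trans (cong Q^ (ℕₚ.*-suc r a)) (Q^-+ r (r * a))) ⟩
        Q^ a ⊗ (Q^ (r * a) ⊗ shift-series a P k ⊖ Q^ r ⊗ Q^ (r * a) ⊗ shift-series (suc a) P k)
          ≡⟨ solve 5 (λ a b x r y → a :* (b :* x :- r :* b :* y) := a :* b :* (x :+ (:- r) :* y)) refl
               (Q^ a) (Q^ (r * a)) (shift-series a P k) (Q^ r) (shift-series (suc a) P k) ⟩
        Q^ a ⊗ Q^ (r * a) ⊗ (shift-series a P k ⊕ ℤ.- Q^ r ⊗ shift-series (suc a) P k)
          ≡⟨ cong₂ _⊗_ (sym (Q^-+ a (r * a))) (sym (shift-M (ℤ.- Q^ r) P a k)) ⟩
        Q^ (suc r * a) ⊗ shift-series a (M (ℤ.- Q^ r) P) k ∎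

  abstract
    E-sh : ∀ t n k → E t (λ a → + sh a (cc q n) k) ≡ H t n k
    E-sh t n k = trans (E-cong t (λ a → trans (shift-sh n a k)
        (sym (trans (cong (_⊗ shift-series a (C n) k) Q^-0) (ℤₚ.*-identityˡ _)))))
      (trans (E-shift t 0 (C n) k) (sym (H≡ t n k)))

module Σℚ = Sums (IsCommutativeRing.isCommutativeSemiring ℚₚ.+-*-isCommutativeRing)

abstract
  ι : ℤ.ℤ → ℚ
  ι z = z ℚ./ 1

  ι≡ : ∀ z → ι z ≡ z ℚ./ 1
  ι≡ z = refl

  private
    toℚᵘ-ι : ∀ z → ℚ.toℚᵘ (ι z) ℚᵘ.≃ ℚᵘ.mkℚᵘ z 0
    toℚᵘ-ι z = ℚₚ.toℚᵘ-fromℚᵘ (ℚᵘ.mkℚᵘ z 0)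

  ι-+ : ∀ a b → ι (a ℤ.+ b) ≡ ι a +ᵣ ι b
  ι-+ a b = ℚₚ.toℚᵘ-injective (ℚᵘₚ.≃-trans (toℚᵘ-ι (a ℤ.+ b)) (ℚᵘₚ.≃-trans
      (ℚᵘ.*≡* (solve 2 (λ a b → (a :+ b) :* con ℤ.1ℤ := (a :* con ℤ.1ℤ :+ b :* con ℤ.1ℤ) :* con ℤ.1ℤ) refl a b))
      (ℚᵘₚ.≃-sym (ℚᵘₚ.≃-trans (ℚₚ.toℚᵘ-homo-+ (ι a) (ι b)) (ℚᵘₚ.+-cong (toℚᵘ-ι a) (toℚᵘ-ι b))))))
    where open Data.Integer.Solver.+-*-Solver

  ι-* : ∀ a b → ι (a ℤ.* b) ≡ ι a *ᵣ ι b
  ι-* a b = ℚₚ.toℚᵘ-injective (ℚᵘₚ.≃-trans (toℚᵘ-ι (a ℤ.* b))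
      (ℚᵘₚ.≃-sym (ℚᵘₚ.≃-trans (ℚₚ.toℚᵘ-homo-* (ι a) (ι b)) (ℚᵘₚ.*-cong (toℚᵘ-ι a) (toℚᵘ-ι b)))))

  ι-inj : ∀ {a b} → ι a ≡ ι b → a ≡ b
  ι-inj {a} {b} p with ℚᵘₚ.≃-trans (ℚᵘₚ.≃-sym (toℚᵘ-ι a)) (ℚᵘₚ.≃-trans (ℚᵘₚ.≃-reflexive (cong ℚ.toℚᵘ p)) (toℚᵘ-ι b))
  ... | ℚᵘ.*≡* e = trans (sym (ℤₚ.*-identityʳ a)) (trans e (ℤₚ.*-identityʳ b))

  ι-0 : ι ℤ.0ℤ ≡ 0ℚ
  ι-0 = refl

  ι-1 : ι ℤ.1ℤ ≡ 1ℚ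
  ι-1 = refl

  ι-fraction : ∀ n m .⦃ _ : NonZero m ⦄ → ι (ℤ.+ m) *ᵣ (ℤ.+ n ℚ./ m) ≡ ι (ℤ.+ n)
  ι-fraction n (suc m) = ℚₚ.toℚᵘ-injective (ℚᵘₚ.≃-trans (ℚₚ.toℚᵘ-homo-* (ι (ℤ.+ suc m)) (ℤ.+ n ℚ./ suc m))
    (ℚᵘₚ.≃-trans (ℚᵘₚ.*-cong (toℚᵘ-ι (ℤ.+ suc m)) (ℚₚ.toℚᵘ-fromℚᵘ (ℚᵘ.mkℚᵘ (ℤ.+ n) m)))
    (ℚᵘₚ.≃-trans (ℚᵘ.*≡* (solve 2 (λ m n → (m :* n) :* con ℤ.1ℤ := n :* (con ℤ.1ℤ :* m)) refl (ℤ.+ suc m) (ℤ.+ n)))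
      (ℚᵘₚ.≃-sym (toℚᵘ-ι (ℤ.+ n))))))
    where open Data.Integer.Solver.+-*-Solver

  ℚ-inverse : ∀ {x} → x ≢ 0ℚ → ∃ λ y → y *ᵣ x ≡ 1ℚ
  ℚ-inverse {x} n = (ℚ.1/ x) ⦃ ℚ.≢-nonZero n ⦄ , ℚₚ.*-inverseˡ x ⦃ ℚ.≢-nonZero n ⦄

ιℕ : ℕ → ℚ
ιℕ n = ι (ℤ.+ n)

ιℕ-+ : ∀ a b → ιℕ (a + b) ≡ ιℕ a +ᵣ ιℕ b
ιℕ-+ a b = ι-+ (ℤ.+ a) (ℤ.+ b)

ιℕ-* : ∀ a b → ιℕ (a * b) ≡ ιℕ a *ᵣ ιℕ b
ιℕ-* a b = trans (cong ι (ℤₚ.pos-* a b)) (ι-* (ℤ.+ a) (ℤ.+ b))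

ιℕ-inj : ∀ {a b} → ιℕ a ≡ ιℕ b → a ≡ b
ιℕ-inj p = ℤₚ.+-injective (ι-inj p)

ιℕ-𝟙 : ∀ b → ιℕ (𝟙 b) ≡ Σℚ.𝟙 b
ιℕ-𝟙 true  = ι-1
ιℕ-𝟙 false = ι-0

ιℕ-∑ : ∀ {A : Set} (xs : List A) (f : A → ℕ) → ιℕ (∑ xs f) ≡ Σℚ.∑ xs (λ x → ιℕ (f x))
ιℕ-∑ []       f = ι-0
ιℕ-∑ (x ∷ xs) f = trans (ιℕ-+ (f x) _) (cong (ιℕ (f x) +ᵣ_) (ιℕ-∑ xs f))

ι-− : ∀ a b → ι (a ℤ.- b) ≡ ι a -ᵣ ι b
ι-− a b = begin
  ι (a ℤ.- b)
    ≡⟨ solve 2 (λ x y → x := (x :+ y) :- y) refl (ι (a ℤ.- b)) (ι b) ⟩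
  (ι (a ℤ.- b) +ᵣ ι b) -ᵣ ι b
    ≡⟨ cong (_-ᵣ ι b) (trans (sym (ι-+ (a ℤ.- b) b)) (cong ι (zsolve 2 (λ a b → (a ∸′ b) +′ b =′ a) refl a b))) ⟩
  ι a -ᵣ ι b ∎
  where
  open ≡-Reasoning
  open Data.Rational.Solver.+-*-Solver using (solve; _:+_; _:-_; _:=_)
  open Data.Integer.Solver.+-*-Solver using () renaming (solve to zsolve; _:-_ to _∸′_; _:+_ to _+′_; _:=_ to _=′_)

filter-Any : ∀ {A : Set} {P Q : A → Set} (Q? : ∀ x → Dec (Q x)) xs → (∀ x → P x → Q x) →
             Any P xs → Any P (filter Q? xs)
filter-Any Q? (x ∷ xs) h (here p) with Q? x
... | yes _ = here p
... | no ¬q = ⊥-elim (¬q (h x p))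
filter-Any Q? (x ∷ xs) h (there i) with Q? x
... | yes _ = there (filter-Any Q? xs h i)
... | no _  = filter-Any Q? xs h i

module _ {A : Set} {P : A → Set} (P? : ∀ x → Dec (P x)) where
  countIn-∑ : ∀ xs → CountIn P xs (∑ xs (λ x → 𝟙 (does (P? x))))
  countIn-∑ []       = c-nil
  countIn-∑ (x ∷ xs) with P? x
  ... | yes p = c-yes p (countIn-∑ xs)
  ... | no ¬p = c-no ¬p (countIn-∑ xs)

  countIn-unique : ∀ {xs n} → CountIn P xs n → n ≡ ∑ xs (λ x → 𝟙 (does (P? x)))
  countIn-unique c-nil = refl
  countIn-unique (c-yes {x} p c) with P? x
  ... | yes _ = cong suc (countIn-unique c)
  ... | no ¬p = ⊥-elim (¬p p)
  countIn-unique (c-no {x} ¬p c) with P? x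
  ... | yes p = ⊥-elim (¬p p)
  ... | no _ = countIn-unique c

  sumIn-∑ : ∀ y xs → SumIn P y xs (Σℚ.∑ xs (λ x → Σℚ.𝟙 (does (P? x)) *ᵣ y x))
  sumIn-∑ y []       = s-nil
  sumIn-∑ y (x ∷ xs) with P? x
  ... | yes p = subst (λ z → SumIn P y (x ∷ xs) (z +ᵣ _)) (sym (ℚₚ.*-identityˡ (y x))) (s-yes p (sumIn-∑ y xs))
  ... | no ¬p = subst (SumIn P y (x ∷ xs)) (sym (trans (cong (_+ᵣ _) (ℚₚ.*-zeroˡ (y x))) (ℚₚ.+-identityˡ _)))
                  (s-no ¬p (sumIn-∑ y xs))

  sumIn-unique : ∀ {y xs s} → SumIn P y xs s → s ≡ Σℚ.∑ xs (λ x → Σℚ.𝟙 (does (P? x)) *ᵣ y x)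
  sumIn-unique s-nil = refl
  sumIn-unique {y} (s-yes {x} p c) with P? x
  ... | yes _ = cong₂ _+ᵣ_ (sym (ℚₚ.*-identityˡ (y x))) (sumIn-unique c)
  ... | no ¬p = ⊥-elim (¬p p)
  sumIn-unique {y} (s-no {x} ¬p c) with P? x
  ... | yes p = ⊥-elim (¬p p)
  ... | no _ = trans (sumIn-unique c) (sym (trans (cong (_+ᵣ _) (ℚₚ.*-zeroˡ (y x))) (ℚₚ.+-identityˡ _)))

down : ℕ → List ℕ
down zero    = []
down (suc n) = n ∷ down n

down-once : ∀ n j → j < n → ∑ (down n) (λ x → 𝟙 (does (x ℕₚ.≟ j))) ≡ 1
down-once (suc n) j (s≤s h) = by (n ℕₚ.≟ j)
  where
  off : ∀ m → m ≤ j → ∑ (down m) (λ x → 𝟙 (does (x ℕₚ.≟ j))) ≡ 0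
  off zero    _  = refl
  off (suc m) le = cong₂ _+_ (cong 𝟙 (not-true {does (m ℕₚ.≟ j)} (λ r → ℕₚ.<⇒≢ le (does-elim (m ℕₚ.≟ j) r))))
                     (off m (ℕₚ.<⇒≤ le))
  by : Dec (n ≡ j) → 𝟙 (does (n ℕₚ.≟ j)) + ∑ (down n) (λ x → 𝟙 (does (x ℕₚ.≟ j))) ≡ 1
  by (yes e)  = cong₂ _+_ (cong 𝟙 (does-intro (n ℕₚ.≟ j) e)) (off n (ℕₚ.≤-reflexive e))
  by (no n≢j) = cong₂ _+_ (cong 𝟙 (not-true {does (n ℕₚ.≟ j)} (λ r → n≢j (does-elim (n ℕₚ.≟ j) r))))
                  (down-once n j (ℕₚ.≤∧≢⇒< h (λ e → n≢j (sym e))))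

cc-zero : ∀ q n k → n < k → cc q n k ≡ 0
cc-zero q zero    (suc k) _       = refl
cc-zero q (suc n) (suc k) (s≤s h) = trans (cong₂ (λ x y → x + q ^ n * y) (cc-zero q n (suc k) (ℕₚ.m≤n⇒m≤1+n h)) (cc-zero q n k h))
  (ℕₚ.*-zeroʳ (q ^ n))

evenSum : ℕ → (ℕ → ℕ) → ℕ
evenSum N f = ∑ (down (suc N)) (λ j → f (2 * j))

private
  evenSum-sh₂ : ∀ N f → evenSum (suc N) (sh 2 f) ≡ evenSum N f
  evenSum-sh₂ zero    f = refl
  evenSum-sh₂ (suc N) f = cong₂ _+_ (cong (sh 2 f) (cong suc (ℕₚ.+-suc (suc N) (suc N + 0)))) (evenSum-sh₂ N f)

  evenSum-sh-cc : ∀ N q n a → evenSum N (sh a (cc q (suc n))) ≡ evenSum N (sh a (cc q n)) + q ^ n * evenSum N (sh (suc a) (cc q n))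
  evenSum-sh-cc N q n a = trans (∑-cong (down (suc N)) (λ j → sh-cc q n a (2 * j)))
    (trans (∑-⊕ (down (suc N)) (λ j → sh a (cc q n) (2 * j)) _) (cong (evenSum N (sh a (cc q n)) +_) (∑-*ˡ (down (suc N)) (q ^ n) _)))

  evenSum-zero : ∀ N f → (∀ j → f (2 * suc j) ≡ 0) → evenSum N f ≡ f 0
  evenSum-zero zero    f p = ℕₚ.+-identityʳ (f 0)
  evenSum-zero (suc N) f p = cong₂ _+_ (p N) (evenSum-zero N f p)

-- At z = ±1 the product ∏_{j ≤ n} (1 + qʲ z) is 2 ∏_{1 ≤ j ≤ n} (1 + qʲ) and 0, so its even and
-- its odd coefficients have the same sum.
evenSum-cc : ∀ q n N a → a ≤ 1 → n < 2 * suc N → evenSum (suc N) (sh a (cc q (suc n))) ≡ prodPlus q n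
evenSum-cc q zero N zero _ _ = trans (evenSum-zero (suc N) (sh 0 (cc q 1)) (λ j → off j (j + suc (j + 0)) (ℕₚ.+-suc j (j + 0)))) refl
  where
  off : ∀ j m → m ≡ suc (j + (j + 0)) → cc q 1 (suc m) ≡ 0
  off j _ refl = refl
evenSum-cc q zero N (suc zero) _ _ = go N
  where
  off : ∀ j m → m ≡ suc (j + (j + 0)) → m ≢ 1 → cc q 1 m ≡ 0
  off zero    _ refl n = ⊥-elim (n refl)
  off (suc j) _ refl n = refl
  go : ∀ N → evenSum (suc N) (sh 1 (cc q 1)) ≡ 1
  go zero    = refl
  go (suc N) = cong₂ _+_ (off (suc N) (suc N + suc (suc N + 0)) (ℕₚ.+-suc (suc N) (suc N + 0))
     (λ e → absurd (trans (sym (ℕₚ.+-suc (suc N) (suc N + 0))) e))) (go N)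
    where
    absurd : ∀ {x} → suc (suc x) ≢ 1
    absurd ()
evenSum-cc q zero N (suc (suc a)) (s≤s ()) _
evenSum-cc q (suc n) N zero _ h = begin
  evenSum (suc N) (sh 0 (cc q (suc (suc n))))
    ≡⟨ evenSum-sh-cc (suc N) q (suc n) 0 ⟩
  evenSum (suc N) (sh 0 (cc q (suc n))) + q ^ suc n * evenSum (suc N) (sh 1 (cc q (suc n)))
    ≡⟨ cong₂ (λ x y → x + q ^ suc n * y) (evenSum-cc q n N 0 z≤n (ℕₚ.<⇒≤ h)) (evenSum-cc q n N 1 (s≤s z≤n) (ℕₚ.<⇒≤ h)) ⟩
  prodPlus q n + q ^ suc n * prodPlus q n
    ≡⟨ ℕₚ.*-comm (suc (q ^ suc n)) (prodPlus q n) ⟩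
  prodPlus q n * suc (q ^ suc n) ∎
  where open ≡-Reasoning
evenSum-cc q (suc n) N (suc zero) _ h = begin
  evenSum (suc N) (sh 1 (cc q (suc (suc n))))
    ≡⟨ evenSum-sh-cc (suc N) q (suc n) 1 ⟩
  evenSum (suc N) (sh 1 (cc q (suc n))) + q ^ suc n * evenSum (suc N) (sh 2 (cc q (suc n)))
    ≡⟨ cong₂ (λ x y → x + q ^ suc n * y) (evenSum-cc q n N 1 (s≤s z≤n) (ℕₚ.<⇒≤ h)) (trans (evenSum-sh₂ N (cc q (suc n))) top) ⟩
  prodPlus q n + q ^ suc n * prodPlus q n
    ≡⟨ ℕₚ.*-comm (suc (q ^ suc n)) (prodPlus q n) ⟩
  prodPlus q n * suc (q ^ suc n) ∎
  where
  open ≡-Reasoning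
  top : evenSum N (cc q (suc n)) ≡ prodPlus q n
  top = trans (cong (_+ evenSum N (cc q (suc n))) (sym (cc-zero q (suc n) (2 * suc N) h)))
          (evenSum-cc q n N 0 z≤n (ℕₚ.<⇒≤ h))
evenSum-cc q (suc n) N (suc (suc a)) (s≤s ()) _

module Points {q : ℕ} (F : FiniteField q) (d : ℕ) where
  open Classes F d public
  open Geometry F d

  _⊆?_ : ∀ S T → Dec (S ⊆S T)
  S ⊆? T = ∀V? (λ v → (v ∈? S) Dec.→-dec (v ∈? T))

  point-subspace : ∀ {P} → IsPoint P → IsSubspace P
  point-subspace (h , _) = proj₁ (hasDim⇒ h)

  point-card : ∀ {P} → IsPoint P → card P ≡ q ^ 1
  point-card (h , _) = proj₂ (hasDim⇒ h)

  isPoint-resp : ∀ {P R} → P ≈S R → IsPoint P → IsPoint R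
  isPoint-resp {P} {R} p pt@(_ , ts) = ⇒hasDim (subspace-resp {P} {R} p (point-subspace pt))
      (trans (sym (card-cong {P} {R} p)) (point-card pt)) , ts-resp p ts

  nonzero-ind : ∀ {v} → v ≢ zeroV → Ind (v ∷ [])
  nonzero-ind n = not-true (λ r → n (0S-elim r)) , _

  point-basis : ∀ {P} → IsPoint P → ∃ λ u → Ind (u ∷ []) × span (u ∷ []) ≈S P
  point-basis {P} pt = go vecs ind span≈ (q^-inj (trans (sym card≡) (point-card pt)))
    where
    open Basis (basis (point-subspace pt))
    go : ∀ {k} (vs : Vec V k) → Ind vs → span vs ≈S P → k ≡ 1 → ∃ λ u → Ind (u ∷ []) × span (u ∷ []) ≈S P
    go (u ∷ []) i p refl = u , i , p

  through-count : ∀ {P π} → IsPoint P → IsGen π → 1 ≤ d → ∀ k →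
    ∑ gens (λ σ → 𝟙 (does (P ⊆? σ) ∧ codim σ π k)) ≡ sh (if does (P ⊆? π) then 0 else 1) (cc q (d ∸ 1)) k
  through-count {P} {π} pt g 1≤d k =
    let (u , ind , sp) = point-basis pt
        flag : ∀ {σ} → IsGen σ → does (P ⊆? σ) ≡ all∈ (u ∷ []) σ
        flag = λ {σ} gσ → bool-ext
          (λ r → ⊆⇒all∈ (u ∷ []) (λ v m → does-elim (P ⊆? σ) r v (trans (sym (sp v)) m)))
          (λ r → does-intro (P ⊆? σ) (λ v m → all∈⇒⊆ (u ∷ []) (subspace gσ) r v (trans (sp v) m)))
    in trans (∑-congAll gens-all (λ σ gσ → cong (λ z → 𝟙 (z ∧ codim σ π k)) (flag gσ)))
         (trans (Φ-count g (d ∸ 1) (u ∷ []) ind (ts-resp (≈S-sym {span (u ∷ [])} {P} sp) (proj₂ pt)) (ℕₚ.m∸n+n≡m 1≤d) k)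
           (cong (λ a → sh (if a then 0 else 1) (cc q (d ∸ 1)) k)
             (trans (0⊞ u) (trans (sym (𝔹ₚ.∧-identityʳ (π u))) (sym (flag g))))))
    where
    0⊞ : ∀ u → (0S ⊞ π) u ≡ π u
    0⊞ u = bool-ext
      (λ r → let (a , m , r′) = ⊞-elim 0S π r in subst (_∈S π) (trans (cong (u +V_) (0S-elim m)) (+V-idʳ u)) r′)
      (⊆⊞ʳ 0S-subspace (subspace g) u)

  points : List Sub
  points = filter isPoint? 𝕊.elems

  private
    distinct : ∀ xs → (∀ a → ∑ xs (λ S → 𝟙 (does (S ≈? a))) ≤ 1) → AllPairs (λ σ τ → ¬ (σ ≈S τ)) xs
    distinct []       h = []
    distinct (x ∷ xs) h = All.tabulate (λ {y} y∈ x≈y → ℕₚ.<⇒≱ (ℕₚ.n<1+n 1) (ℕₚ.≤-trans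
        (ℕₚ.+-mono-≤ (ℕₚ.≤-reflexive (sym (cong 𝟙 (does-intro (x ≈? y) x≈y)))) (hit xs y∈)) (h y)))
      ∷ distinct xs (λ a → ℕₚ.≤-trans (ℕₚ.m≤n+m _ _) (h a))
      where
      hit : ∀ xs {y} → Any (y ≡_) xs → 1 ≤ ∑ xs (λ S → 𝟙 (does (S ≈? y)))
      hit (x ∷ xs) {y} (here refl) = ℕₚ.≤-trans (ℕₚ.≤-reflexive (sym (cong 𝟙 (does-intro (x ≈? x) (λ _ → refl))))) (ℕₚ.m≤m+n _ _)
      hit (x ∷ xs) (there i) = ℕₚ.≤-trans (hit xs i) (ℕₚ.m≤n+m _ _)

  pointList : PointList points
  pointList = Allₚ.all-filter isPoint? 𝕊.elems ,
    AllPairsₚ.filter⁺ isPoint? (distinct 𝕊.elems (λ a → ℕₚ.≤-reflexive (𝕊.once a))) ,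
    λ P pt → filter-Any isPoint? 𝕊.elems (λ S p → isPoint-resp {P} {S} p pt) (𝕊.find P (λ S r → ≈S-sym {S} {P} r))

  points-count : ∀ {π} → IsGen π → ∀ v → v ≢ zeroV → ∑ points (λ P → 𝟙 (does (P ⊆? π) ∧ P v)) ≡ 𝟙 (π v)
  points-count {π} g v n with bool-cases (π v)
  ... | inj₂ v∉ = trans (∑-cong points (λ P → cong 𝟙 (not-true (λ r → false≢true v∉ (does-elim (P ⊆? π) (∧-fst r) v (∧-snd {does (P ⊆? π)} r))))))
                    (trans (∑-0 points) (cong 𝟙 (sym v∉)))
  ... | inj₁ v∈ = trans (∑-congAll (proj₁ pointList) (λ P pt → trans (cong 𝟙 (only P pt)) (sym (ℕₚ.*-identityʳ _))))
                    (trans (filter-pick isPoint? isPoint-resp ⟨v⟩-point (λ _ → 1) (λ _ _ → refl)) (cong 𝟙 (sym v∈)))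
    where
    ⟨v⟩ : Sub
    ⟨v⟩ = span (v ∷ [])
    ⟨v⟩⊆π : ⟨v⟩ ⊆S π
    ⟨v⟩⊆π = all∈⇒⊆ (v ∷ []) (subspace g) (∧-intro v∈ refl)
    ⟨v⟩-card : card ⟨v⟩ ≡ q ^ 1
    ⟨v⟩-card = span-card (v ∷ []) (nonzero-ind n)
    ⟨v⟩-point : IsPoint ⟨v⟩
    ⟨v⟩-point = ⇒hasDim (span-subspace (v ∷ [])) ⟨v⟩-card , λ w m → singular g w (⟨v⟩⊆π w m)
    only : ∀ P → IsPoint P → (does (P ⊆? π) ∧ P v) ≡ does (P ≈? ⟨v⟩)
    only P pt = bool-ext
      (λ r → does-intro (P ≈? ⟨v⟩) (≈S-sym {⟨v⟩} {P} (⊆∧card⇒≈ {⟨v⟩} {P}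
         (all∈⇒⊆ (v ∷ []) (point-subspace pt) (∧-intro (∧-snd {does (P ⊆? π)} r) refl))
         (ℕₚ.≤-reflexive (trans (point-card pt) (sym ⟨v⟩-card))))))
      (λ r → let p = does-elim (P ≈? ⟨v⟩) r in ∧-intro
         (does-intro (P ⊆? π) (λ w m → ⟨v⟩⊆π w (trans (sym (p w)) m)))
         (trans (p v) (ext-∋ 0S-subspace v)))

-- The functions on the class of ρ spanned by the monomials [v₁ ∈ π] ⋯ [vₖ ∈ π].

module Spans {q : ℕ} (F : FiniteField q) (d : ℕ) (d-even : d % 2 ≡ 0)
             {ρ : Vec (Fin q × Fin q) d → Bool} (gρ : Classes.IsGen F d ρ) where
  open Points F d public
  open Expansion q 2≤q public using (E; δ; E-sh; H; Q^; Q^≡; H-1; eigenvalues-differ)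
  open Geometry F d
  open Σℚ using () renaming (𝟙 to 𝟙ᵣ; ∑ to ∑ᵣ)
  open Data.Rational.Solver.+-*-Solver using (solve; _:+_; _:*_; _:-_; _:=_; con)

  𝒢 : Sub → Set
  𝒢 = EvenTo d-even gρ

  Fn : Set
  Fn = Sub → ℚ

  infix 4 _≐_
  _≐_ : Fn → Fn → Set
  f ≐ g = ∀ π → 𝒢 π → f π ≡ g π

  ∑Vᵣ : (V → ℚ) → ℚ
  ∑Vᵣ = ∑ᵣ allV

  monomial : ∀ {k} → Vec V k → Fn
  monomial vs π = 𝟙ᵣ (all∈ vs π)

  data Span : ℕ → Fn → Set where
    mono  : ∀ {k} (vs : Vec V k) → Span k (monomial vs)
    add   : ∀ {k f g} → Span k f → Span k g → Span k (λ π → f π +ᵣ g π)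
    scale : ∀ {k f} c → Span k f → Span k (λ π → c *ᵣ f π)
    resp  : ∀ {k f g} → f ≐ g → Span k f → Span k g

  span-0 : ∀ {k} → Span k (λ _ → 0ℚ)
  span-0 {k} = resp (λ π _ → ℚₚ.*-zeroˡ (monomial (replicate k zeroV) π)) (scale 0ℚ (mono (replicate k zeroV)))

  span-mul : ∀ {k f} v → Span k f → Span (suc k) (λ π → 𝟙ᵣ (π v) *ᵣ f π)
  span-mul v (mono vs)   = resp (λ π _ → Σℚ.𝟙-∧ (π v) _) (mono (v ∷ vs))
  span-mul v (add {f = f} {g} s t) = resp (λ π _ → sym (ℚₚ.*-distribˡ-+ (𝟙ᵣ (π v)) (f π) (g π)))
                                          (add (span-mul v s) (span-mul v t))
  span-mul v (scale {f = f} c s) = resp (λ π _ → solve 3 (λ c e f → c :* (e :* f) := e :* (c :* f)) refl c (𝟙ᵣ (π v)) (f π))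
                                        (scale c (span-mul v s))
  span-mul v (resp p s)  = resp (λ π g → cong (𝟙ᵣ (π v) *ᵣ_) (p π g)) (span-mul v s)

  -- The zero vector lies in every π, so it pads a monomial.
  span-pad : ∀ {k f} → Span k f → Span (suc k) f
  span-pad s = resp (λ π g → Σℚ.𝟙-yes (has-0 (subspace (proj₁ g))) _) (span-mul zeroV s)

  span-∑ : ∀ {k} {A : Set} (xs : List A) {f : A → Fn} → (∀ x → Span k (f x)) → Span k (λ π → ∑ᵣ xs (λ x → f x π))
  span-∑ []       s = span-0
  span-∑ (x ∷ xs) s = add (s x) (span-∑ xs s)

  span-const : ∀ k c → Span k (λ _ → c)
  span-const zero    c = resp (λ _ _ → ℚₚ.*-identityʳ c) (scale c (mono []))
  span-const (suc k) c = span-pad (span-const k c)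

  span-linear : ∀ {f} → Span 1 f → ∃ λ (c : V → ℚ) → ∀ π → 𝒢 π → f π ≡ ∑Vᵣ (λ v → c v *ᵣ 𝟙ᵣ (π v))
  span-linear (mono (u ∷ [])) = (λ v → 𝟙ᵣ (does (v 𝕍.~? u))) , λ π _ → sym (begin
      ∑Vᵣ (λ v → 𝟙ᵣ (does (v 𝕍.~? u)) *ᵣ 𝟙ᵣ (π v))
        ≡⟨ Σℚ.∑-cong allV (λ v → trans (sym (Σℚ.𝟙-∧ _ (π v))) (sym (ιℕ-𝟙 _))) ⟩
      ∑Vᵣ (λ v → ιℕ (𝟙 (does (v 𝕍.~? u) ∧ π v)))
        ≡⟨ sym (ιℕ-∑ allV _) ⟩
      ιℕ (∑V (λ v → 𝟙 (does (v 𝕍.~? u) ∧ π v)))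
        ≡⟨ cong ιℕ (trans (∑-cong allV (λ v → 𝟙-∧ (does (v 𝕍.~? u)) (π v))) (≟V-pick u (λ v → 𝟙 (π v)))) ⟩
      ιℕ (𝟙 (π u))
        ≡⟨ trans (ιℕ-𝟙 (π u)) (cong 𝟙ᵣ (sym (𝔹ₚ.∧-identityʳ (π u)))) ⟩
      𝟙ᵣ (π u ∧ true) ∎)
    where open ≡-Reasoning
  span-linear (add s t) = let (c , p) = span-linear s ; (e , r) = span-linear t in
    (λ v → c v +ᵣ e v) , λ π g → trans (cong₂ _+ᵣ_ (p π g) (r π g)) (trans (sym (Σℚ.∑-⊕ allV _ _))
      (Σℚ.∑-cong allV (λ v → sym (ℚₚ.*-distribʳ-+ (𝟙ᵣ (π v)) (c v) (e v)))))
  span-linear (scale a s) = let (c , p) = span-linear s in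
    (λ v → a *ᵣ c v) , λ π g → trans (cong (a *ᵣ_) (p π g)) (trans (sym (Σℚ.∑-*ˡ allV a _))
      (Σℚ.∑-cong allV (λ v → sym (ℚₚ.*-assoc a (c v) _))))
  span-linear (resp e s) = let (c , p) = span-linear s in c , λ π g → trans (sym (e π g)) (p π g)

  Lower : ℕ → Fn → Set
  Lower zero    f = f ≐ λ _ → 0ℚ
  Lower (suc t) f = Span t f

  lower-resp : ∀ t {f g} → f ≐ g → Lower t f → Lower t g
  lower-resp zero    p l π g = trans (sym (p π g)) (l π g)
  lower-resp (suc t) p l     = resp p l

  lower-add : ∀ t {f g} → Lower t f → Lower t g → Lower t (λ π → f π +ᵣ g π)
  lower-add zero    l m π g = trans (cong₂ _+ᵣ_ (l π g) (m π g)) (ℚₚ.+-identityʳ 0ℚ)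
  lower-add (suc t) l m     = add l m

  lower-scale : ∀ t {f} c → Lower t f → Lower t (λ π → c *ᵣ f π)
  lower-scale zero    c l π g = trans (cong (c *ᵣ_) (l π g)) (ℚₚ.*-zeroʳ c)
  lower-scale (suc t) c l     = scale c l

  lower-mul : ∀ t {f} v → Lower t f → Lower (suc t) (λ π → 𝟙ᵣ (π v) *ᵣ f π)
  lower-mul zero    v l = resp (λ π g → sym (trans (cong (𝟙ᵣ (π v) *ᵣ_) (l π g)) (ℚₚ.*-zeroʳ (𝟙ᵣ (π v))))) span-0
  lower-mul (suc t) v l = span-mul v l

  lower⇒span : ∀ t {f} → Lower t f → Span t f
  lower⇒span zero    l = resp (λ π g → sym (l π g)) span-0
  lower⇒span (suc t) l = span-pad l

  lower-0 : ∀ t → Lower t (λ _ → 0ℚ)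
  lower-0 zero    π g = refl
  lower-0 (suc t)     = span-0

  q-inv : ∀ t → ∃ λ r → r *ᵣ ιℕ (q ^ t) ≡ 1ℚ
  q-inv t = ℚ-inverse (λ p → Data.Nat.≢-nonZero⁻¹ (q ^ t) ⦃ q^-nz t ⦄ (ιℕ-inj (trans p (sym ι-0))))

  -- With U = span hs and s = corank hs π, the event v ∈ U + π has indicator
  -- q^(s-t) Σ_{h ∈ U} [v + h ∈ π], so ψ (corank (v ∷ hs) π) expands into products of
  -- [v + h ∈ π] with a function of s; δ collects the coefficients.
  corank-expansion : ∀ {t} (vs : Vec V t) → Ind vs → ∀ ψ →
    Lower t (λ π → ι (ψ (corank vs π)) -ᵣ ι (E t ψ) *ᵣ monomial vs π)
  corank-expansion [] _ ψ π g = solve 1 (λ x → x :- x :* con 1ℚ := con 0ℚ) refl (ι (ψ 0))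
  corank-expansion {suc t} (v ∷ hs) (v∉ , ind) ψ =
    resp (λ π g → main π (proj₁ g)) (add const-part (scale r (span-∑ allV (λ h → scale (𝟙ᵣ (U h)) (lower-mul t (v +V h) low)))))
    where
    open ≡-Reasoning
    U : Sub
    U = span hs
    s : Sub → ℕ
    s = corank hs
    r : ℚ
    r = proj₁ (q-inv t)
    r-inv : r *ᵣ ιℕ (q ^ t) ≡ 1ℚ
    r-inv = proj₂ (q-inv t)
    c : ℚ
    c = ι (E t (δ ψ))
    L : Fn
    L π = ι (δ ψ (s π)) -ᵣ c *ᵣ monomial hs π
    low : Lower t L
    low = corank-expansion hs ind (δ ψ)
    const-part : Span t (λ π → ι (ψ (suc (s π))))
    const-part = resp (λ π _ → solve 2 (λ x y → (x :- y) :+ y := x) refl (ι (ψ (suc (s π)))) _)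
      (add (lower⇒span t (corank-expansion hs ind (λ a → ψ (suc a)))) (scale (ι (E t (λ a → ψ (suc a)))) (mono hs)))
    main : ∀ π → IsGen π →
      ι (ψ (suc (s π))) +ᵣ r *ᵣ ∑Vᵣ (λ h → 𝟙ᵣ (U h) *ᵣ (𝟙ᵣ (π (v +V h)) *ᵣ L π))
        ≡ ι (ψ (corank (v ∷ hs) π)) -ᵣ c *ᵣ 𝟙ᵣ (π v ∧ all∈ hs π)
    main π g = begin
      ι (ψ (suc (s π))) +ᵣ r *ᵣ ∑Vᵣ (λ h → 𝟙ᵣ (U h) *ᵣ (𝟙ᵣ (π (v +V h)) *ᵣ L π))
        ≡⟨ cong (λ z → ι (ψ (suc (s π))) +ᵣ r *ᵣ z) sum≡ ⟩
      y +ᵣ r *ᵣ (ιℕ b *ᵣ (ιℕ K *ᵣ L π))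
        ≡⟨ cong (λ z → y +ᵣ r *ᵣ (ιℕ b *ᵣ z)) (solve 4 (λ k x c m → k :* (x :- c :* m) := k :* x :- c :* (k :* m)) refl
             (ιℕ K) (ι (δ ψ (s π))) c (monomial hs π)) ⟩
      y +ᵣ r *ᵣ (ιℕ b *ᵣ (ιℕ K *ᵣ ι (δ ψ (s π)) -ᵣ c *ᵣ (ιℕ K *ᵣ monomial hs π)))
        ≡⟨ cong₂ (λ z w → y +ᵣ r *ᵣ (ιℕ b *ᵣ (z -ᵣ c *ᵣ w))) Kδ Km ⟩
      y +ᵣ r *ᵣ (ιℕ b *ᵣ (ιℕ (q ^ t) *ᵣ (x -ᵣ y) -ᵣ c *ᵣ (ιℕ (q ^ t) *ᵣ monomial hs π)))
        ≡⟨ solve 7 (λ y r b p x c m → y :+ r :* (b :* (p :* (x :- y) :- c :* (p :* m))) :=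
             y :+ (r :* p) :* (b :* (x :- y) :- c :* (b :* m))) refl y r (ιℕ b) (ιℕ (q ^ t)) x c (monomial hs π) ⟩
      y +ᵣ (r *ᵣ ιℕ (q ^ t)) *ᵣ (ιℕ b *ᵣ (x -ᵣ y) -ᵣ c *ᵣ (ιℕ b *ᵣ monomial hs π))
        ≡⟨ cong₂ (λ z w → y +ᵣ z *ᵣ (ιℕ b *ᵣ (x -ᵣ y) -ᵣ c *ᵣ w)) r-inv bm ⟩
      y +ᵣ 1ℚ *ᵣ (ιℕ b *ᵣ (x -ᵣ y) -ᵣ c *ᵣ 𝟙ᵣ (π v ∧ all∈ hs π))
        ≡⟨ solve 5 (λ y b x c m → y :+ con 1ℚ :* (b :* (x :- y) :- c :* m) := (y :+ b :* (x :- y)) :- c :* m) refl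
             y (ιℕ b) x c (𝟙ᵣ (π v ∧ all∈ hs π)) ⟩
      (y +ᵣ ιℕ b *ᵣ (x -ᵣ y)) -ᵣ c *ᵣ 𝟙ᵣ (π v ∧ all∈ hs π)
        ≡⟨ cong (_-ᵣ c *ᵣ 𝟙ᵣ (π v ∧ all∈ hs π)) (branch ((U ⊞ π) v)) ⟩
      ι (ψ (corank (v ∷ hs) π)) -ᵣ c *ᵣ 𝟙ᵣ (π v ∧ all∈ hs π) ∎
      where
      b K : ℕ
      b = 𝟙 ((U ⊞ π) v)
      K = card (U ∩S π)
      x y : ℚ
      x = ι (ψ (s π))
      y = ι (ψ (suc (s π)))
      sum≡ : ∑Vᵣ (λ h → 𝟙ᵣ (U h) *ᵣ (𝟙ᵣ (π (v +V h)) *ᵣ L π)) ≡ ιℕ b *ᵣ (ιℕ K *ᵣ L π)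
      sum≡ = begin
        ∑Vᵣ (λ h → 𝟙ᵣ (U h) *ᵣ (𝟙ᵣ (π (v +V h)) *ᵣ L π))
          ≡⟨ Σℚ.∑-cong allV (λ h → trans (sym (ℚₚ.*-assoc (𝟙ᵣ (U h)) _ (L π)))
               (cong (_*ᵣ L π) (trans (sym (Σℚ.𝟙-∧ (U h) _)) (sym (ιℕ-𝟙 (U h ∧ π (v +V h))))))) ⟩
        ∑Vᵣ (λ h → ιℕ (𝟙 (U h ∧ π (v +V h))) *ᵣ L π)
          ≡⟨ Σℚ.∑-*ʳ allV (L π) _ ⟩
        ∑Vᵣ (λ h → ιℕ (𝟙 (U h ∧ π (v +V h)))) *ᵣ L π
          ≡⟨ cong (_*ᵣ L π) (trans (sym (ιℕ-∑ allV _)) (trans (cong ιℕ (coset-count (span-subspace hs) (subspace g) v)) (ιℕ-* b K))) ⟩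
        ιℕ b *ᵣ ιℕ K *ᵣ L π
          ≡⟨ ℚₚ.*-assoc (ιℕ b) (ιℕ K) (L π) ⟩
        ιℕ b *ᵣ (ιℕ K *ᵣ L π) ∎
      Kδ : ιℕ K *ᵣ ι (δ ψ (s π)) ≡ ιℕ (q ^ t) *ᵣ (x -ᵣ y)
      Kδ = begin
        ιℕ K *ᵣ ι (δ ψ (s π))
          ≡⟨ cong (ιℕ K *ᵣ_) (trans (ι-* (Q^ (s π)) _) (cong₂ _*ᵣ_ (cong ι (Q^≡ (s π))) (ι-− (ψ (s π)) (ψ (suc (s π)))))) ⟩
        ιℕ K *ᵣ (ιℕ (q ^ s π) *ᵣ (x -ᵣ y))
          ≡⟨ sym (ℚₚ.*-assoc (ιℕ K) _ _) ⟩
        ιℕ K *ᵣ ιℕ (q ^ s π) *ᵣ (x -ᵣ y)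
          ≡⟨ cong (_*ᵣ (x -ᵣ y)) (trans (sym (ιℕ-* K (q ^ s π))) (cong ιℕ (corank-card hs (subspace g) ind))) ⟩
        ιℕ (q ^ t) *ᵣ (x -ᵣ y) ∎
      U⊆π : all∈ hs π ≡ true → U ⊆S π
      U⊆π = all∈⇒⊆ hs (subspace g)
      K≡ : all∈ hs π ≡ true → K ≡ q ^ t
      K≡ m = trans (card-cong {U ∩S π} {U} (λ w → bool-ext ∧-fst (λ h → ∧-intro h (U⊆π m w h)))) (span-card hs ind)
      Km : ιℕ K *ᵣ monomial hs π ≡ ιℕ (q ^ t) *ᵣ monomial hs π
      Km with bool-cases (all∈ hs π)
      ... | inj₁ m = cong (λ z → ιℕ z *ᵣ monomial hs π) (K≡ m)
      ... | inj₂ m = trans (zero-at (ιℕ K)) (sym (zero-at (ιℕ (q ^ t))))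
        where
        zero-at : ∀ z → z *ᵣ monomial hs π ≡ 0ℚ
        zero-at z = trans (cong (λ a → z *ᵣ 𝟙ᵣ a) m) (ℚₚ.*-zeroʳ z)
      bm : ιℕ b *ᵣ monomial hs π ≡ 𝟙ᵣ (π v ∧ all∈ hs π)
      bm = trans (cong (_*ᵣ monomial hs π) (ιℕ-𝟙 ((U ⊞ π) v))) (trans (sym (Σℚ.𝟙-∧ ((U ⊞ π) v) _)) (cong 𝟙ᵣ (bool-ext
        (λ m → let (a , p , p′) = ⊞-elim U π (∧-fst m) ; all = ∧-snd {(U ⊞ π) v} m in
           ∧-intro (trans (sym (shift (subspace g) (U⊆π all a p) v)) p′) all)
        (λ m → ∧-intro (⊆⊞ʳ (span-subspace hs) (subspace g) v (∧-fst m)) (∧-snd {π v} m)))))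
      branch : ∀ a → y +ᵣ ιℕ (𝟙 a) *ᵣ (x -ᵣ y) ≡ ι (ψ (if a then s π else suc (s π)))
      branch true  = trans (cong (λ z → y +ᵣ z *ᵣ (x -ᵣ y)) ι-1) (solve 2 (λ x y → y :+ con 1ℚ :* (x :- y) := x) refl x y)
      branch false = trans (cong (λ z → y +ᵣ z *ᵣ (x -ᵣ y)) ι-0) (solve 2 (λ x y → y :+ con 0ℚ :* (x :- y) := y) refl x y)

  dependent : ∀ {t} (vs : Vec V t) → Ind vs ⊎ (∃ λ s → ∃ λ (us : Vec V s) → suc s ≡ t ×
              (∀ {π} → IsSubspace π → all∈ us π ≡ all∈ vs π))
  dependent []       = inj₁ _
  dependent (v ∷ vs) with bool-cases (span vs v) | dependent vs
  ... | inj₁ m | _ = inj₂ (_ , vs , refl , λ {π} s → bool-ext (λ a → ∧-intro (all∈⇒⊆ vs s a v m) a) (∧-snd {π v}))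
  ... | inj₂ m | inj₁ ind = inj₁ (m , ind)
  ... | inj₂ m | inj₂ (s , us , e , p) = inj₂ (suc s , v ∷ us , cong suc e , λ {π} r → cong (π v ∧_) (p r))

  module Operator (k : ℕ) (k-even : even k ≡ true) where
    A : Fn → Fn
    A f π = ∑ᵣ gens (λ σ → 𝟙ᵣ (codim σ π k) *ᵣ f σ)

    A-resp : ∀ {f g} → f ≐ g → A f ≐ A g
    A-resp p π gπ = Σℚ.∑-congAll gens-all (λ σ gσ → Σℚ.𝟙-on (codim σ π k) (λ c → p σ
      (even-class d-even gρ gσ gπ {k} (mkCodim (does-elim (codim? σ π k) c)) k-even)))

    A-add : ∀ f g π → A (λ σ → f σ +ᵣ g σ) π ≡ A f π +ᵣ A g π
    A-add f g π = trans (Σℚ.∑-cong gens (λ σ → ℚₚ.*-distribˡ-+ (𝟙ᵣ (codim σ π k)) (f σ) (g σ))) (Σℚ.∑-⊕ gens _ _)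

    A-scale : ∀ c f π → A (λ σ → c *ᵣ f σ) π ≡ c *ᵣ A f π
    A-scale c f π = trans (Σℚ.∑-cong gens (λ σ → solve 3 (λ e c f → e :* (c :* f) := c :* (e :* f)) refl (𝟙ᵣ (codim σ π k)) c (f σ)))
      (Σℚ.∑-*ˡ gens c _)

    A-monomial : ∀ {t} (vs : Vec V t) π → A (monomial vs) π ≡ ιℕ (Φ vs π k)
    A-monomial vs π = trans (Σℚ.∑-cong gens (λ σ → trans (ℚₚ.*-comm (𝟙ᵣ (codim σ π k)) _)
        (trans (sym (Σℚ.𝟙-∧ (all∈ vs σ) _)) (sym (ιℕ-𝟙 (all∈ vs σ ∧ codim σ π k)))))) (sym (ιℕ-∑ gens _))

    Λ : ℕ → ℤ.ℤ
    Λ t = H t (d ∸ t) k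

    Shifted : ℕ → Fn → Set
    Shifted t f = Lower t (λ π → A f π -ᵣ ι (Λ t) *ᵣ f π)

    private
      shifted-resp : ∀ t {f g} → f ≐ g → Shifted t f → Shifted t g
      shifted-resp t p = lower-resp t (λ π gπ → cong₂ (λ x y → x -ᵣ ι (Λ t) *ᵣ y) (A-resp p π gπ) (p π gπ))

      shifted-0 : ∀ t → Shifted t (λ _ → 0ℚ)
      shifted-0 t = lower-resp t (λ π _ → sym (trans (cong (_-ᵣ ι (Λ t) *ᵣ 0ℚ)
          (trans (Σℚ.∑-cong gens (λ σ → ℚₚ.*-zeroʳ (𝟙ᵣ (codim σ π k)))) (Σℚ.∑-0 gens)))
          (solve 1 (λ x → con 0ℚ :- x :* con 0ℚ := con 0ℚ) refl (ι (Λ t))))) (lower-0 t)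

      shifted-independent : ∀ {t} (vs : Vec V t) → t ≤ d → Ind vs → Shifted t (monomial vs)
      shifted-independent {t} vs t≤d ind with ts? (span vs)
      ... | yes ts = lower-resp t (λ π gπ → sym (cong₂ (λ x y → x -ᵣ ι y *ᵣ monomial vs π)
              (trans (A-monomial vs π) (cong ιℕ (Φ-count (proj₁ gπ) (d ∸ t) vs ind ts (ℕₚ.m∸n+n≡m t≤d) k)))
              (sym (E-sh t (d ∸ t) k)))) (corank-expansion vs ind (λ a → ℤ.+ sh a (cc q (d ∸ t)) k))
      ... | no ¬ts = shifted-resp t (λ π gπ → sym (cong 𝟙ᵣ (not-true (λ m →
              ¬ts (λ v p → singular (proj₁ gπ) v (all∈⇒⊆ vs (subspace (proj₁ gπ)) m v p)))))) (shifted-0 t)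

    shifted : ∀ t → t ≤ d → ∀ {f} → Span t f → Shifted t f
    shifted t t≤d (mono vs) with dependent vs
    ... | inj₁ ind = shifted-independent vs t≤d ind
    ... | inj₂ (s , us , refl , p) = shifted-resp (suc s) (λ π gπ → cong 𝟙ᵣ (p (subspace (proj₁ gπ))))
            (resp (λ π _ → solve 4 (λ a m x y → (a :- x :* m) :+ (x :- y) :* m := a :- y :* m) refl
                     (A (monomial us) π) (monomial us π) (ι (Λ s)) (ι (Λ (suc s))))
              (add (lower⇒span s (shifted s (ℕₚ.<⇒≤ t≤d) (mono us))) (scale (ι (Λ s) -ᵣ ι (Λ (suc s))) (mono us))))
    shifted t t≤d (add {f = f} {g} a b) = lower-resp t (λ π _ → trans
        (solve 5 (λ x f y g z → (x :- z :* f) :+ (y :- z :* g) := (x :+ y) :- z :* (f :+ g)) refl (A f π) (f π) (A g π) (g π) (ι (Λ t)))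
        (cong (_-ᵣ ι (Λ t) *ᵣ (f π +ᵣ g π)) (sym (A-add f g π))))
      (lower-add t (shifted t t≤d a) (shifted t t≤d b))
    shifted t t≤d (scale {f = f} c a) = lower-resp t (λ π _ → trans
        (solve 4 (λ c x z f → c :* (x :- z :* f) := c :* x :- z :* (c :* f)) refl c (A f π) (ι (Λ t)) (f π))
        (cong (_-ᵣ ι (Λ t) *ᵣ (c *ᵣ f π)) (sym (A-scale c f π))))
      (lower-scale t c (shifted t t≤d a))
    shifted t t≤d (resp p a) = shifted-resp t p (shifted t t≤d a)

module Main {q : ℕ} (F : FiniteField q) (d : ℕ) (d-even : d % 2 ≡ 0)
            {ρ : Vec (Fin q × Fin q) d → Bool} (gρ : Classes.IsGen F d ρ)
            (L : List (Vec (Fin q × Fin q) d → Bool)) (inL : All (Classes.EvenTo F d d-even gρ) L)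
            (distinct : AllPairs (λ σ τ → ¬ (Geometry._≈S_ F d σ τ)) L)
            (i : ℕ) (k≤d : 2 * suc i ≤ d) where
  open Spans F d d-even gρ public
  open Geometry F d
  open CameronLiebler F d
  open Σℚ using () renaming (𝟙 to 𝟙ᵣ; ∑ to ∑ᵣ)
  open Data.Rational.Solver.+-*-Solver using (solve; _:+_; _:*_; _:-_; :-_; _:=_; con)

  k₁ k : ℕ
  k₁ = i + suc (i + 0)
  k = suc k₁

  1≤d : 1 ≤ d
  1≤d = ℕₚ.≤-trans (s≤s z≤n) k≤d

  2≤d : 2 ≤ d
  2≤d = ℕₚ.≤-trans (ℕₚ.≤-trans (s≤s (s≤s z≤n)) (ℕₚ.≤-reflexive (cong suc (sym (ℕₚ.+-suc i (i + 0)))))) k≤d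

  d-1≡ : d ∸ 1 ≡ suc (d ∸ 2)
  d-1≡ = go 2≤d
    where
    go : ∀ {n} → 2 ≤ n → n ∸ 1 ≡ suc (n ∸ 2)
    go (s≤s (s≤s h)) = refl

  χ? : ∀ π → Dec (π ∈L L)
  χ? π = Any.any? (π ≈?_) L

  χ : Sub → Bool
  χ π = does (χ? π)

  χᵣ : Fn
  χᵣ π = 𝟙ᵣ (χ π)

  χ-count : ∀ σ → 𝟙 (χ σ) ≡ ∑ L (λ τ → 𝟙 (does (σ ≈? τ)))
  χ-count σ = go L distinct
    where
    none : ∀ {x} → σ ≈S x → ∀ ys → All (λ y → ¬ (x ≈S y)) ys → ∑ ys (λ τ → 𝟙 (does (σ ≈? τ))) ≡ 0
    none p []       []       = refl
    none {x} p (y ∷ ys) (n ∷ ns) = cong₂ _+_ (cong 𝟙 (not-true (λ r →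
      n (≈S-trans {x} {σ} {y} (≈S-sym {σ} {x} p) (does-elim (σ ≈? y) r))))) (none {x} p ys ns)
    go : ∀ ys → AllPairs (λ σ τ → ¬ (σ ≈S τ)) ys →
         𝟙 (does (Any.any? (σ ≈?_) ys)) ≡ ∑ ys (λ τ → 𝟙 (does (σ ≈? τ)))
    go []       []       = refl
    go (y ∷ ys) (n ∷ ns) with σ ≈? y
    ... | yes p = cong suc (sym (none {y} p ys n))
    ... | no _  = go ys ns

  sum-L : ∀ (f : Sub → ℕ) → (∀ {σ τ} → σ ≈S τ → f σ ≡ f τ) → ∑ gens (λ σ → 𝟙 (χ σ) * f σ) ≡ ∑ L f
  sum-L f f-resp = begin
    ∑ gens (λ σ → 𝟙 (χ σ) * f σ)
      ≡⟨ ∑-cong gens (λ σ → trans (cong (_* f σ) (χ-count σ)) (sym (∑-*ʳ L (f σ) _))) ⟩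
    ∑ gens (λ σ → ∑ L (λ τ → 𝟙 (does (σ ≈? τ)) * f σ))
      ≡⟨ ∑-swap gens L _ ⟩
    ∑ L (λ τ → ∑ gens (λ σ → 𝟙 (does (σ ≈? τ)) * f σ))
      ≡⟨ ∑-congAll inL (λ τ g → gens-pick (proj₁ g) f (λ σ p → f-resp p)) ⟩
    ∑ L f ∎
    where open ≡-Reasoning

  module O k′ (k′-even : even k′ ≡ true) = Operator k′ k′-even

  A-χ : ∀ k′ (e : even k′ ≡ true) π → O.A k′ e χᵣ π ≡ ιℕ (∑ L (λ σ → 𝟙 (codim σ π k′)))
  A-χ k′ e π = trans (Σℚ.∑-cong gens (λ σ → trans (ℚₚ.*-comm (𝟙ᵣ (codim σ π k′)) (χᵣ σ))
      (trans (cong₂ _*ᵣ_ (sym (ιℕ-𝟙 (χ σ))) (sym (ιℕ-𝟙 (codim σ π k′)))) (sym (ιℕ-* (𝟙 (χ σ)) _)))))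
    (trans (sym (ιℕ-∑ gens _)) (cong ιℕ (sum-L _ (λ p → cong 𝟙 (codim-resp p π k′)))))

  open Operator k (even-2* (suc i))

  x β : ℚ
  x = param q d (length L)
  β = ιℕ (cc q (d ∸ 1) k₁)

  Eigen : Set
  Eigen = A χᵣ ≐ λ π → ι (Λ 1) *ᵣ χᵣ π +ᵣ x *ᵣ β

  Λ₁ : ι (Λ 1) ≡ ιℕ (cc q (d ∸ 1) k) -ᵣ β
  Λ₁ = trans (cong ι (H-1 (d ∸ 1) k₁)) (ι-− (ℤ.+ cc q (d ∸ 1) k) (ℤ.+ cc q (d ∸ 1) k₁))

  module Counts where
    private
      g₁ g₂ Q₁ Q₂ : ℕ
      g₁ = gauss q (d ∸ 1) k₁
      g₂ = gauss q (d ∸ 1) k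
      Q₁ = q ^ (k₁ * i)
      Q₂ = q ^ k₁

      tri₁ : tri k₁ ≡ k₁ * i
      tri₁ = subst (λ z → tri z ≡ z * i) (sym (ℕₚ.+-suc i (i + 0))) (tri-odd i)

      β≡ : β ≡ ιℕ Q₁ *ᵣ ιℕ g₁
      β≡ = trans (cong ιℕ (trans (cc-gauss q (d ∸ 1) k₁) (cong (λ z → q ^ z * g₁) tri₁))) (ιℕ-* Q₁ g₁)

      α≡ : ιℕ (cc q (d ∸ 1) k) ≡ ιℕ Q₁ *ᵣ (ιℕ Q₂ *ᵣ ιℕ g₂)
      α≡ = trans (cong ιℕ (trans (cc-gauss q (d ∸ 1) k) (trans (cong (λ z → q ^ (z + k₁) * g₂) tri₁)
             (trans (cong (_* g₂) (ℕₚ.^-distribˡ-+-* q (k₁ * i) k₁)) (ℕₚ.*-assoc Q₁ Q₂ g₂)))))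
             (trans (ιℕ-* Q₁ (Q₂ * g₂)) (cong (ιℕ Q₁ *ᵣ_) (ιℕ-* Q₂ g₂)))

      toℚ : ∀ n → ℕtoℚ n ≡ ιℕ n
      toℚ n = sym (ι≡ (ℤ.+ n))

    in-value : ∀ x → countIn q d (suc i) x ≡ ι (Λ 1) *ᵣ 1ℚ +ᵣ x *ᵣ β
    in-value x = begin
      ((x -ᵣ 1ℚ) *ᵣ ℕtoℚ g₁ +ᵣ ℕtoℚ (Q₂ * g₂)) *ᵣ ℕtoℚ Q₁
        ≡⟨ cong₂ _*ᵣ_ (cong₂ (λ a b → (x -ᵣ 1ℚ) *ᵣ a +ᵣ b) (toℚ g₁) (trans (toℚ (Q₂ * g₂)) (ιℕ-* Q₂ g₂))) (toℚ Q₁) ⟩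
      ((x -ᵣ 1ℚ) *ᵣ ιℕ g₁ +ᵣ ιℕ Q₂ *ᵣ ιℕ g₂) *ᵣ ιℕ Q₁
        ≡⟨ solve 4 (λ x g a p → ((x :- con 1ℚ) :* g :+ a) :* p := (p :* a :- p :* g) :* con 1ℚ :+ x :* (p :* g)) refl
             x (ιℕ g₁) (ιℕ Q₂ *ᵣ ιℕ g₂) (ιℕ Q₁) ⟩
      (ιℕ Q₁ *ᵣ (ιℕ Q₂ *ᵣ ιℕ g₂) -ᵣ ιℕ Q₁ *ᵣ ιℕ g₁) *ᵣ 1ℚ +ᵣ x *ᵣ (ιℕ Q₁ *ᵣ ιℕ g₁)
        ≡⟨ cong₂ (λ a b → (a -ᵣ b) *ᵣ 1ℚ +ᵣ x *ᵣ b) (sym α≡) (sym β≡) ⟩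
      (ιℕ (cc q (d ∸ 1) k) -ᵣ β) *ᵣ 1ℚ +ᵣ x *ᵣ β
        ≡⟨ cong (λ z → z *ᵣ 1ℚ +ᵣ x *ᵣ β) (sym Λ₁) ⟩
      ι (Λ 1) *ᵣ 1ℚ +ᵣ x *ᵣ β ∎
      where open ≡-Reasoning

    out-value : ∀ x → countOut q d (suc i) x ≡ ι (Λ 1) *ᵣ 0ℚ +ᵣ x *ᵣ β
    out-value x = begin
      x *ᵣ ℕtoℚ (g₁ * Q₁)
        ≡⟨ cong (x *ᵣ_) (trans (toℚ (g₁ * Q₁)) (trans (cong ιℕ (ℕₚ.*-comm g₁ Q₁)) (trans (ιℕ-* Q₁ g₁) (sym β≡)))) ⟩
      x *ᵣ β
        ≡⟨ solve 2 (λ z y → y := z :* con 0ℚ :+ y) refl (ι (Λ 1)) (x *ᵣ β) ⟩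
      ι (Λ 1) *ᵣ 0ℚ +ᵣ x *ᵣ β ∎
      where open ≡-Reasoning

    meets? : ∀ π σ → Dec (HasDim (σ ∩S π) (d ∸ k))
    meets? π σ = hasDim? (σ ∩S π) (d ∸ k)

    count≡ : ∀ {π} → IsGen π → ∑ L (λ σ → 𝟙 (does (meets? π σ))) ≡ ∑ L (λ σ → 𝟙 (codim σ π k))
    count≡ {π} g = ∑-congAll inL (λ σ gσ → cong 𝟙 (does-⇔ (meets? π σ) (codim? σ π k)
      (λ h → eqn (hasDim⇒Codim {σ} {π} k≤d h)) (λ e → Codim⇒hasDim (proj₁ gσ) g (mkCodim e))))

    CountCondition : Set
    CountCondition = ∀ π → InClass ρ π → ∀ n → CountIn (λ σ → HasDim (σ ∩S π) (d ∸ k)) L n →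
        (π ∈L L → ℕtoℚ n ≡ countIn q d (suc i) x) × (¬ (π ∈L L) → ℕtoℚ n ≡ countOut q d (suc i) x)

    eigen⇒counts : Eigen → CountCondition
    eigen⇒counts eig π π∈ n c =
        (λ m → trans n≡ (trans (cong (λ z → ι (Λ 1) *ᵣ 𝟙ᵣ z +ᵣ x *ᵣ β) (does-intro (χ? π) m)) (sym (in-value x))))
      , (λ m → trans n≡ (trans (cong (λ z → ι (Λ 1) *ᵣ 𝟙ᵣ z +ᵣ x *ᵣ β) (not-true (λ r → m (does-elim (χ? π) r)))) (sym (out-value x))))
      where
      g : 𝒢 π
      g = inClass⇒ d-even gρ π∈
      n≡ : ℕtoℚ n ≡ ι (Λ 1) *ᵣ χᵣ π +ᵣ x *ᵣ β
      n≡ = trans (toℚ n) (trans (cong ιℕ (trans (countIn-unique (meets? π) c) (count≡ (proj₁ g))))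
             (trans (sym (A-χ k (even-2* (suc i)) π)) (eig π g)))

    counts⇒eigen : CountCondition → Eigen
    counts⇒eigen cond π g = trans (A-χ k (even-2* (suc i)) π) (trans (cong ιℕ (sym (count≡ (proj₁ g)))) (by (bool-cases (χ π))))
      where
      N : ℕ
      N = ∑ L (λ σ → 𝟙 (does (meets? π σ)))
      both : (π ∈L L → ℕtoℚ N ≡ countIn q d (suc i) x) × (¬ (π ∈L L) → ℕtoℚ N ≡ countOut q d (suc i) x)
      both = cond π (⇒inClass d-even gρ g) N (countIn-∑ (meets? π) L)
      by : (χ π ≡ true) ⊎ (χ π ≡ false) → ιℕ N ≡ ι (Λ 1) *ᵣ χᵣ π +ᵣ x *ᵣ β
      by (inj₁ m) = trans (sym (toℚ N)) (trans (proj₁ both (does-elim (χ? π) m)) (trans (in-value x)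
                      (cong (λ z → ι (Λ 1) *ᵣ 𝟙ᵣ z +ᵣ x *ᵣ β) (sym m))))
      by (inj₂ m) = trans (sym (toℚ N)) (trans (proj₂ both (λ e → false≢true m (does-intro (χ? π) e))) (trans (out-value x)
                      (cong (λ z → ι (Λ 1) *ᵣ 𝟙ᵣ z +ᵣ x *ᵣ β) (sym m))))

  m : ℕ
  m = proj₁ (even-half d (%2⇒even d d-even))

  d≡2m : d ≡ 2 * m
  d≡2m = proj₂ (even-half d (%2⇒even d d-even))

  ρ∈𝒢 : 𝒢 ρ
  ρ∈𝒢 = gρ , λ e → cong even {y = 0} (Codim-unique gρ gρ e (mkCodim (trans (ℕₚ.*-identityʳ _)
    (trans (card-cong {ρ ∩S ρ} {ρ} (λ v → 𝔹ₚ.∧-idem (ρ v))) (size gρ)))))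

  half-codim : ∀ {σ π} → 𝒢 σ → 𝒢 π → ∃ λ j → Codim σ π (2 * j) × j ≤ m
  half-codim {σ} {π} gσ gπ =
    let (a , e , a≤d) = Codim-exists (proj₁ gσ) (proj₁ gπ)
        (j , a≡2j) = even-half a (class-even d-even gρ gσ gπ e)
    in j , subst (Codim σ π) a≡2j e , ℕₚ.*-cancelˡ-≤ 2 (subst (_≤ 2 * m) a≡2j (subst (a ≤_) d≡2m a≤d))

  -- Summing the counts at ρ over all even codimensions gives the size of L on one side, and
  -- the number of members of the class through each point on the other.
  module Forward (ps : List Sub) (points-ok : All IsPoint ps) (y : Sub → ℚ)
                 (y-eq : ∀ π → 𝒢 π → χᵣ π ≡ ∑ᵣ ps (λ P → 𝟙ᵣ (does (P ⊆? π)) *ᵣ y P)) where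
    local : Sub → Sub → ℕ → ℕ
    local π P = sh (if does (P ⊆? π) then 0 else 1) (cc q (d ∸ 1))

    A-points : ∀ k′ (e : even k′ ≡ true) π → 𝒢 π → O.A k′ e χᵣ π ≡ ∑ᵣ ps (λ P → ιℕ (local π P k′) *ᵣ y P)
    A-points k′ e π g = begin
      O.A k′ e χᵣ π
        ≡⟨ O.A-resp k′ e {χᵣ} y-eq π g ⟩
      ∑ᵣ gens (λ σ → 𝟙ᵣ (codim σ π k′) *ᵣ ∑ᵣ ps (λ P → 𝟙ᵣ (does (P ⊆? σ)) *ᵣ y P))
        ≡⟨ Σℚ.∑-cong gens (λ σ → sym (Σℚ.∑-*ˡ ps (𝟙ᵣ (codim σ π k′)) _)) ⟩
      ∑ᵣ gens (λ σ → ∑ᵣ ps (λ P → 𝟙ᵣ (codim σ π k′) *ᵣ (𝟙ᵣ (does (P ⊆? σ)) *ᵣ y P)))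
        ≡⟨ Σℚ.∑-swap gens ps _ ⟩
      ∑ᵣ ps (λ P → ∑ᵣ gens (λ σ → 𝟙ᵣ (codim σ π k′) *ᵣ (𝟙ᵣ (does (P ⊆? σ)) *ᵣ y P)))
        ≡⟨ Σℚ.∑-congAll points-ok (λ P pt → trans (Σℚ.∑-cong gens (λ σ → flag P σ)) (trans (Σℚ.∑-*ʳ gens (y P) _)
             (cong (_*ᵣ y P) (trans (sym (ιℕ-∑ gens _)) (cong ιℕ (through-count pt (proj₁ g) 1≤d k′)))))) ⟩
      ∑ᵣ ps (λ P → ιℕ (local π P k′) *ᵣ y P) ∎
      where
      open ≡-Reasoning
      flag : ∀ P σ → 𝟙ᵣ (codim σ π k′) *ᵣ (𝟙ᵣ (does (P ⊆? σ)) *ᵣ y P) ≡ ιℕ (𝟙 (does (P ⊆? σ) ∧ codim σ π k′)) *ᵣ y P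
      flag P σ = trans (solve 3 (λ a b y → a :* (b :* y) := (b :* a) :* y) refl (𝟙ᵣ (codim σ π k′)) (𝟙ᵣ (does (P ⊆? σ))) (y P))
        (cong (_*ᵣ y P) (trans (sym (Σℚ.𝟙-∧ (does (P ⊆? σ)) _)) (sym (ιℕ-𝟙 (does (P ⊆? σ) ∧ codim σ π k′)))))

    Y : ℚ
    Y = ∑ᵣ ps y

    js : List ℕ
    js = down (suc m)

    size-L : ιℕ (length L) ≡ ιℕ (prodPlus q (d ∸ 2)) *ᵣ Y
    size-L = begin
      ιℕ (length L)
        ≡⟨ cong ιℕ (trans (sym (length-∑ L)) (∑-congAll inL (λ σ g → sym (once-codim σ g)))) ⟩
      ιℕ (∑ L (λ σ → ∑ js (λ j → 𝟙 (codim σ ρ (2 * j)))))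
        ≡⟨ trans (cong ιℕ (∑-swap L js _)) (ιℕ-∑ js _) ⟩
      ∑ᵣ js (λ j → ιℕ (∑ L (λ σ → 𝟙 (codim σ ρ (2 * j)))))
        ≡⟨ Σℚ.∑-cong js (λ j → trans (sym (A-χ (2 * j) (even-2* j) ρ)) (A-points (2 * j) (even-2* j) ρ ρ∈𝒢)) ⟩
      ∑ᵣ js (λ j → ∑ᵣ ps (λ P → ιℕ (local ρ P (2 * j)) *ᵣ y P))
        ≡⟨ Σℚ.∑-swap js ps _ ⟩
      ∑ᵣ ps (λ P → ∑ᵣ js (λ j → ιℕ (local ρ P (2 * j)) *ᵣ y P))
        ≡⟨ Σℚ.∑-cong ps (λ P → trans (Σℚ.∑-*ʳ js (y P) (λ j → ιℕ (local ρ P (2 * j)))) (cong (_*ᵣ y P) (trans (sym (ιℕ-∑ js _)) (cong ιℕ (total P))))) ⟩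
      ∑ᵣ ps (λ P → ιℕ (prodPlus q (d ∸ 2)) *ᵣ y P)
        ≡⟨ Σℚ.∑-*ˡ ps (ιℕ (prodPlus q (d ∸ 2))) y ⟩
      ιℕ (prodPlus q (d ∸ 2)) *ᵣ Y ∎
      where
      open ≡-Reasoning
      length-∑ : ∀ (xs : List Sub) → ∑ xs (λ _ → 1) ≡ length xs
      length-∑ []       = refl
      length-∑ (x ∷ xs) = cong suc (length-∑ xs)
      once-codim : ∀ σ → 𝒢 σ → ∑ js (λ j → 𝟙 (codim σ ρ (2 * j))) ≡ 1
      once-codim σ g = let (j₀ , e , j₀≤m) = half-codim g ρ∈𝒢 in
        trans (∑-cong js (λ j → cong 𝟙 (does-⇔ (codim? σ ρ (2 * j)) (j ℕₚ.≟ j₀)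
          (λ e′ → ℕₚ.*-cancelˡ-≡ j j₀ 2 (Codim-unique (proj₁ g) gρ (mkCodim e′) e))
          (λ { refl → eqn e })))) (down-once (suc m) j₀ (s≤s j₀≤m))
      total : ∀ P → ∑ js (λ j → local ρ P (2 * j)) ≡ prodPlus q (d ∸ 2)
      total P = subst (λ z → ∑ js (λ j → sh c (cc q z) (2 * j)) ≡ prodPlus q (d ∸ 2)) (sym d-1≡) (by m d≡2m)
        where
        c : ℕ
        c = if does (P ⊆? ρ) then 0 else 1
        c≤1 : c ≤ 1
        c≤1 with does (P ⊆? ρ)
        ... | true  = z≤n
        ... | false = s≤s z≤n
        by : ∀ m → d ≡ 2 * m → evenSum m (sh c (cc q (suc (d ∸ 2)))) ≡ prodPlus q (d ∸ 2)
        by zero    e = ⊥-elim (ℕₚ.<⇒≢ 1≤d (sym e))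
        by (suc N) e = evenSum-cc q (d ∸ 2) N c c≤1 (subst (d ∸ 2 <_) e (ℕₚ.≤-trans (ℕₚ.≤-reflexive (sym d-1≡)) (ℕₚ.m∸n≤m d 1)))

    x≡Y : x ≡ Y
    x≡Y = begin
      x
        ≡⟨ sym (ℚₚ.*-identityˡ x) ⟩
      1ℚ *ᵣ x
        ≡⟨ cong (_*ᵣ x) (sym r-inv) ⟩
      r *ᵣ p *ᵣ x
        ≡⟨ trans (ℚₚ.*-assoc r p x) (cong (r *ᵣ_) (trans (ι-fraction (length L) (prodPlus q (d ∸ 2)) ⦃ prodPlus-nz q (d ∸ 2) ⦄) size-L)) ⟩
      r *ᵣ (p *ᵣ Y)
        ≡⟨ trans (sym (ℚₚ.*-assoc r p Y)) (trans (cong (_*ᵣ Y) r-inv) (ℚₚ.*-identityˡ Y)) ⟩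
      Y ∎
      where
      open ≡-Reasoning
      p : ℚ
      p = ιℕ (prodPlus q (d ∸ 2))
      p≢0 : p ≢ 0ℚ
      p≢0 z = Data.Nat.≢-nonZero⁻¹ (prodPlus q (d ∸ 2)) ⦃ prodPlus-nz q (d ∸ 2) ⦄ (ιℕ-inj (trans z (sym ι-0)))
      r : ℚ
      r = proj₁ (ℚ-inverse p≢0)
      r-inv : r *ᵣ p ≡ 1ℚ
      r-inv = proj₂ (ℚ-inverse p≢0)

    eigen : Eigen
    eigen π g = begin
      A χᵣ π
        ≡⟨ A-points k (even-2* (suc i)) π g ⟩
      ∑ᵣ ps (λ P → ιℕ (local π P k) *ᵣ y P)
        ≡⟨ Σℚ.∑-cong ps (λ P → trans (cong (_*ᵣ y P) (value (does (P ⊆? π))))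
             (solve 4 (λ l e y b → (l :* e :+ b) :* y := l :* (e :* y) :+ y :* b) refl (ι (Λ 1)) (𝟙ᵣ (does (P ⊆? π))) (y P) β)) ⟩
      ∑ᵣ ps (λ P → ι (Λ 1) *ᵣ (𝟙ᵣ (does (P ⊆? π)) *ᵣ y P) +ᵣ y P *ᵣ β)
        ≡⟨ trans (Σℚ.∑-⊕ ps _ _) (cong₂ _+ᵣ_ (Σℚ.∑-*ˡ ps (ι (Λ 1)) _) (Σℚ.∑-*ʳ ps β y)) ⟩
      ι (Λ 1) *ᵣ ∑ᵣ ps (λ P → 𝟙ᵣ (does (P ⊆? π)) *ᵣ y P) +ᵣ Y *ᵣ β
        ≡⟨ cong₂ (λ a b → ι (Λ 1) *ᵣ a +ᵣ b *ᵣ β) (sym (y-eq π g)) (sym x≡Y) ⟩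
      ι (Λ 1) *ᵣ χᵣ π +ᵣ x *ᵣ β ∎
      where
      open ≡-Reasoning
      value : ∀ b → ιℕ (sh (if b then 0 else 1) (cc q (d ∸ 1)) k) ≡ ι (Λ 1) *ᵣ 𝟙ᵣ b +ᵣ β
      value true  = trans (solve 2 (λ a b → a := (a :- b) :* con 1ℚ :+ b) refl (ιℕ (cc q (d ∸ 1) k)) β)
                      (cong (λ z → z *ᵣ 1ℚ +ᵣ β) (sym Λ₁))
      value false = solve 2 (λ l b → b := l :* con 0ℚ :+ b) refl (ι (Λ 1)) β

  cl⇒eigen : IsCLSet ρ L → Eigen
  cl⇒eigen (ps , (points-ok , _) , y , eq) = Forward.eigen ps points-ok y y-eq
    where
    y-eq : ∀ π → 𝒢 π → χᵣ π ≡ ∑ᵣ ps (λ P → 𝟙ᵣ (does (P ⊆? π)) *ᵣ y P)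
    y-eq π g = by (bool-cases (χ π))
      where
      by : (χ π ≡ true) ⊎ (χ π ≡ false) → χᵣ π ≡ ∑ᵣ ps (λ P → 𝟙ᵣ (does (P ⊆? π)) *ᵣ y P)
      by (inj₁ e) = trans (cong 𝟙ᵣ e) (sumIn-unique (_⊆? π) (proj₁ (eq π (⇒inClass d-even gρ g)) (does-elim (χ? π) e)))
      by (inj₂ e) = trans (cong 𝟙ᵣ e) (sumIn-unique (_⊆? π) (proj₂ (eq π (⇒inClass d-even gρ g)) (λ l → false≢true e (does-intro (χ? π) l))))

  descend : ∀ t → suc t ≤ m → Eigen → Span (suc t) χᵣ → Span 1 χᵣ
  descend zero    _ _   s = s
  descend (suc t) h eig s = descend t (ℕₚ.<⇒≤ h) eig
    (resp (λ π g → begin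
        κ *ᵣ ((A χᵣ π -ᵣ ι (Λ (2 + t)) *ᵣ χᵣ π) +ᵣ c)
          ≡⟨ cong (λ z → κ *ᵣ ((z -ᵣ ι (Λ (2 + t)) *ᵣ χᵣ π) +ᵣ c)) (eig π g) ⟩
        κ *ᵣ (((ι (Λ 1) *ᵣ χᵣ π +ᵣ x *ᵣ β) -ᵣ ι (Λ (2 + t)) *ᵣ χᵣ π) +ᵣ c)
          ≡⟨ solve 5 (λ κ l f xb m → κ :* (((l :* f :+ xb) :- m :* f) :+ (:- xb)) := (κ :* (l :- m)) :* f) refl
               κ (ι (Λ 1)) (χᵣ π) (x *ᵣ β) (ι (Λ (2 + t))) ⟩
        (κ *ᵣ (ι (Λ 1) -ᵣ ι (Λ (2 + t)))) *ᵣ χᵣ π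
          ≡⟨ trans (cong (_*ᵣ χᵣ π) κ-inv) (ℚₚ.*-identityˡ (χᵣ π)) ⟩
        χᵣ π ∎)
      (scale κ (add (shifted (2 + t) t≤d s) (span-const (suc t) c))))
    where
    open ≡-Reasoning
    c : ℚ
    c = ℚ.- (x *ᵣ β)
    double : (2 + t) + (2 + t) ≤ d
    double = subst ((2 + t) + (2 + t) ≤_) (sym (trans d≡2m (cong (m +_) (ℕₚ.+-identityʳ m)))) (ℕₚ.+-mono-≤ h h)
    t≤d : 2 + t ≤ d
    t≤d = ℕₚ.≤-trans (ℕₚ.m≤m+n (2 + t) (2 + t)) double
    e : ℕ
    e = d ∸ ((2 + t) + (2 + t))
    d≡ : (2 + t) + ((2 + t) + e) ≡ d
    d≡ = trans (sym (ℕₚ.+-assoc (2 + t) (2 + t) e)) (ℕₚ.m+[n∸m]≡n double)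
    differ : Λ (2 + t) ≢ Λ 1
    differ p = eigenvalues-differ t e (d ∸ 2) i (trans d≡ (sym (ℕₚ.m+[n∸m]≡n 2≤d))) (subst (k ≤_) (sym d≡) k≤d)
      (trans (cong (λ z → H (2 + t) z k) (sym (trans (cong (_∸ (2 + t)) (sym d≡)) (ℕₚ.m+n∸m≡n (2 + t) ((2 + t) + e)))))
        (trans p (cong (λ z → H 1 z k) d-1≡)))
    nonzero : ι (Λ 1) -ᵣ ι (Λ (2 + t)) ≢ 0ℚ
    nonzero p = differ (ι-inj (trans (solve 2 (λ a b → b := a :- (a :- b)) refl (ι (Λ 1)) (ι (Λ (2 + t))))
      (trans (cong (λ z → ι (Λ 1) -ᵣ z) p) (solve 1 (λ a → a :- con 0ℚ := a) refl (ι (Λ 1))))))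
    κ : ℚ
    κ = proj₁ (ℚ-inverse nonzero)
    κ-inv : κ *ᵣ (ι (Λ 1) -ᵣ ι (Λ (2 + t))) ≡ 1ℚ
    κ-inv = proj₂ (ℚ-inverse nonzero)

  -- On the class of ρ the polynomial ∏_{1 ≤ j ≤ m} (|σ ∩ π| - q^(d-2j)) in the indicators
  -- [v ∈ π] vanishes unless π = σ.

  prodP : ℕ → ℚ → ℚ
  prodP zero    z = 1ℚ
  prodP (suc j) z = (z -ᵣ ιℕ (q ^ (d ∸ 2 * suc j))) *ᵣ prodP j z

  prodP-span : ∀ σ j → Span j (λ π → prodP j (ιℕ (card (σ ∩S π))))
  prodP-span σ zero    = span-const 0 1ℚ
  prodP-span σ (suc j) = resp (λ π _ → begin
      ∑Vᵣ (λ v → 𝟙ᵣ (σ v) *ᵣ (𝟙ᵣ (π v) *ᵣ p π)) +ᵣ ℚ.- c *ᵣ p π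
        ≡⟨ cong (_+ᵣ ℚ.- c *ᵣ p π) (trans (Σℚ.∑-cong allV (λ v → trans (sym (ℚₚ.*-assoc (𝟙ᵣ (σ v)) _ (p π)))
             (cong (_*ᵣ p π) (trans (sym (Σℚ.𝟙-∧ (σ v) _)) (sym (ιℕ-𝟙 (σ v ∧ π v))))))) (trans (Σℚ.∑-*ʳ allV (p π) _)
             (cong (_*ᵣ p π) (sym (ιℕ-∑ allV _))))) ⟩
      ιℕ (card (σ ∩S π)) *ᵣ p π +ᵣ ℚ.- c *ᵣ p π
        ≡⟨ solve 3 (λ a c p → a :* p :+ (:- c) :* p := (a :- c) :* p) refl (ιℕ (card (σ ∩S π))) c (p π) ⟩
      (ιℕ (card (σ ∩S π)) -ᵣ c) *ᵣ p π ∎)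
    (add (span-∑ allV (λ v → scale (𝟙ᵣ (σ v)) (span-mul v (prodP-span σ j)))) (scale (ℚ.- c) (span-pad (prodP-span σ j))))
    where
    open ≡-Reasoning
    c : ℚ
    c = ιℕ (q ^ (d ∸ 2 * suc j))
    p : Fn
    p π = prodP j (ιℕ (card (σ ∩S π)))

  prodP-root : ∀ n j → suc j ≤ n → prodP n (ιℕ (q ^ (d ∸ 2 * suc j))) ≡ 0ℚ
  prodP-root (suc n) j (s≤s h) with ℕₚ.m≤n⇒m<n∨m≡n h
  ... | inj₁ lt = trans (cong (z *ᵣ_) (prodP-root n j lt)) (ℚₚ.*-zeroʳ z)
    where
    z : ℚ
    z = ιℕ (q ^ (d ∸ 2 * suc j)) -ᵣ ιℕ (q ^ (d ∸ 2 * suc n))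
  ... | inj₂ refl = trans (cong (_*ᵣ prodP n c) (ℚₚ.+-inverseʳ c)) (ℚₚ.*-zeroˡ (prodP n c))
    where
    c : ℚ
    c = ιℕ (q ^ (d ∸ 2 * suc n))

  prodP-nonzero : ∀ n → 2 * n ≤ d → prodP n (ιℕ (q ^ d)) ≢ 0ℚ
  prodP-nonzero zero    _ ()
  prodP-nonzero (suc n) h p = prodP-nonzero n (ℕₚ.≤-trans (ℕₚ.*-monoʳ-≤ 2 (ℕₚ.n≤1+n n)) h) (begin
      b
        ≡⟨ sym (ℚₚ.*-identityˡ b) ⟩
      1ℚ *ᵣ b
        ≡⟨ cong (_*ᵣ b) (sym (proj₂ (ℚ-inverse a≢0))) ⟩
      r *ᵣ a *ᵣ b
        ≡⟨ trans (ℚₚ.*-assoc r a b) (trans (cong (r *ᵣ_) p) (ℚₚ.*-zeroʳ r)) ⟩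
      0ℚ ∎)
    where
    open ≡-Reasoning
    a b : ℚ
    a = ιℕ (q ^ d) -ᵣ ιℕ (q ^ (d ∸ 2 * suc n))
    b = prodP n (ιℕ (q ^ d))
    a≢0 : a ≢ 0ℚ
    a≢0 e = ℕₚ.<⇒≢ (ℕₚ.∸-monoʳ-< {d} {2 * suc n} {0} (s≤s z≤n) h) (sym (q^-inj {d} {d ∸ 2 * suc n} (ιℕ-inj
      (trans (solve 2 (λ x y → x := (x :- y) :+ y) refl (ιℕ (q ^ d)) (ιℕ (q ^ (d ∸ 2 * suc n))))
        (trans (cong (_+ᵣ ιℕ (q ^ (d ∸ 2 * suc n))) e) (ℚₚ.+-identityˡ _))))))
    r : ℚ
    r = proj₁ (ℚ-inverse a≢0)

  delta-span : ∀ {σ} → 𝒢 σ → Span m (λ π → 𝟙ᵣ (does (π ≈? σ)))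
  delta-span {σ} gσ = resp (λ π g → value π g (half-codim gσ g)) (scale κ (prodP-span σ m))
    where
    top≢0 : prodP m (ιℕ (q ^ d)) ≢ 0ℚ
    top≢0 = prodP-nonzero m (ℕₚ.≤-reflexive (sym d≡2m))
    κ : ℚ
    κ = proj₁ (ℚ-inverse top≢0)
    sizes : ∀ {π j} → 𝒢 π → Codim σ π j → card (σ ∩S π) ≡ q ^ (d ∸ j)
    sizes g e = proj₂ (hasDim⇒ (Codim⇒hasDim (proj₁ gσ) (proj₁ g) e))
    value : ∀ π → 𝒢 π → (∃ λ j → Codim σ π (2 * j) × j ≤ m) →
            κ *ᵣ prodP m (ιℕ (card (σ ∩S π))) ≡ 𝟙ᵣ (does (π ≈? σ))
    value π g (zero , e , _) = trans (cong (λ z → κ *ᵣ prodP m (ιℕ z)) (sizes {π} {0} g e)) (trans (proj₂ (ℚ-inverse top≢0))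
      (cong 𝟙ᵣ (sym (does-intro (π ≈? σ) (≈S-sym {σ} {π} (Codim₀ (proj₁ gσ) (proj₁ g) e))))))
    value π g (suc j , e , h) = trans (cong (λ z → κ *ᵣ prodP m (ιℕ z)) (sizes {π} {2 * suc j} g e))
      (trans (cong (κ *ᵣ_) (prodP-root m j h)) (trans (ℚₚ.*-zeroʳ κ) (cong 𝟙ᵣ (sym (not-true {does (π ≈? σ)} differ)))))
      where
      absurd : 2 * suc j ≢ 0
      absurd ()
      differ : ¬ (does (π ≈? σ) ≡ true)
      differ r = absurd (Codim-unique (proj₁ gσ) (proj₁ g) e (mkCodim (trans (ℕₚ.*-identityʳ _) (trans
        (card-cong {σ ∩S π} {σ} (λ v → trans (cong (σ v ∧_) (does-elim (π ≈? σ) r v)) (𝔹ₚ.∧-idem (σ v)))) (size (proj₁ gσ))))))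

  χ-span : Span m χᵣ
  χ-span = resp (λ π _ → trans (Σℚ.∑-cong L (λ σ → sym (ιℕ-𝟙 (does (π ≈? σ)))))
      (trans (sym (ιℕ-∑ L _)) (trans (cong ιℕ (sym (χ-count π))) (ιℕ-𝟙 (χ π))))) (go inL)
    where
    go : ∀ {ys} → All 𝒢 ys → Span m (λ π → ∑ᵣ ys (λ σ → 𝟙ᵣ (does (π ≈? σ))))
    go []       = span-0
    go (g ∷ gs) = add (delta-span g) (go gs)

  -- The value at the zero vector is spread over the q^d - 1 nonzero vectors of each generator.
  spread : ∀ (c : V → ℚ) → ∃ λ (c′ : V → ℚ) → ∀ π → IsGen π →
    ∑Vᵣ (λ v → c v *ᵣ 𝟙ᵣ (π v)) ≡ ∑Vᵣ (λ v → 𝟙ᵣ (not (0S v)) *ᵣ (c′ v *ᵣ 𝟙ᵣ (π v)))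
  spread c = (λ v → c v +ᵣ c₀ *ᵣ r) , λ π g → let open ≡-Reasoning in begin
      ∑Vᵣ (λ v → c v *ᵣ 𝟙ᵣ (π v))
        ≡⟨ trans (Σℚ.∑-cong allV (λ v → Σℚ.𝟙-split (0S v) _)) (Σℚ.∑-⊕ allV _ _) ⟩
      ∑Vᵣ (λ v → 𝟙ᵣ (0S v) *ᵣ (c v *ᵣ 𝟙ᵣ (π v))) +ᵣ T c π
        ≡⟨ cong (_+ᵣ T c π) (trans (pick (λ v → c v *ᵣ 𝟙ᵣ (π v))) (trans (cong (λ z → c₀ *ᵣ 𝟙ᵣ z) (has-0 (subspace g))) (ℚₚ.*-identityʳ c₀))) ⟩
      c₀ +ᵣ T c π
        ≡⟨ cong (_+ᵣ T c π) (trans (sym (ℚₚ.*-identityʳ c₀)) (trans (cong (c₀ *ᵣ_) (sym r-inv)) (sym (ℚₚ.*-assoc c₀ r N)))) ⟩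
      (c₀ *ᵣ r) *ᵣ N +ᵣ T c π
        ≡⟨ cong (λ z → (c₀ *ᵣ r) *ᵣ z +ᵣ T c π) (sym (N-count π g)) ⟩
      (c₀ *ᵣ r) *ᵣ T (λ _ → 1ℚ) π +ᵣ T c π
        ≡⟨ cong (_+ᵣ T c π) (sym (Σℚ.∑-*ˡ allV (c₀ *ᵣ r) _)) ⟩
      ∑Vᵣ (λ v → (c₀ *ᵣ r) *ᵣ (𝟙ᵣ (not (0S v)) *ᵣ (1ℚ *ᵣ 𝟙ᵣ (π v)))) +ᵣ T c π
        ≡⟨ sym (Σℚ.∑-⊕ allV _ _) ⟩
      ∑Vᵣ (λ v → (c₀ *ᵣ r) *ᵣ (𝟙ᵣ (not (0S v)) *ᵣ (1ℚ *ᵣ 𝟙ᵣ (π v))) +ᵣ 𝟙ᵣ (not (0S v)) *ᵣ (c v *ᵣ 𝟙ᵣ (π v)))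
        ≡⟨ Σℚ.∑-cong allV (λ v → solve 4 (λ k a c p → k :* (a :* (con 1ℚ :* p)) :+ a :* (c :* p) := a :* ((c :+ k) :* p)) refl
             (c₀ *ᵣ r) (𝟙ᵣ (not (0S v))) (c v) (𝟙ᵣ (π v))) ⟩
      T (λ v → c v +ᵣ c₀ *ᵣ r) π ∎
    where
    c₀ : ℚ
    c₀ = c zeroV
    T : (V → ℚ) → Fn
    T c π = ∑Vᵣ (λ v → 𝟙ᵣ (not (0S v)) *ᵣ (c v *ᵣ 𝟙ᵣ (π v)))
    pick : ∀ f → ∑Vᵣ (λ v → 𝟙ᵣ (0S v) *ᵣ f v) ≡ f zeroV
    pick f = trans (Σℚ.∑-cong allV (λ v → Σℚ.𝟙-on (0S v) (λ e → cong f (0S-elim e)))) (trans (Σℚ.∑-*ʳ allV (f zeroV) _)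
      (trans (cong (_*ᵣ f zeroV) (trans (Σℚ.∑-cong allV (λ v → sym (ιℕ-𝟙 (0S v)))) (trans (sym (ιℕ-∑ allV _))
        (trans (cong ιℕ (𝕍.once zeroV)) ι-1)))) (ℚₚ.*-identityˡ (f zeroV))))
    N : ℚ
    N = ιℕ (q ^ d) -ᵣ 1ℚ
    N-count : ∀ π → IsGen π → T (λ _ → 1ℚ) π ≡ N
    N-count π g = begin
      T (λ _ → 1ℚ) π
        ≡⟨ solve 1 (λ t → t := (con 1ℚ :+ t) :- con 1ℚ) refl (T (λ _ → 1ℚ) π) ⟩
      (1ℚ +ᵣ T (λ _ → 1ℚ) π) -ᵣ 1ℚ
        ≡⟨ cong (λ z → (z +ᵣ T (λ _ → 1ℚ) π) -ᵣ 1ℚ) (sym (trans (pick (λ v → 1ℚ *ᵣ 𝟙ᵣ (π v)))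
             (cong (λ z → 1ℚ *ᵣ 𝟙ᵣ z) (has-0 (subspace g))))) ⟩
      (∑Vᵣ (λ v → 𝟙ᵣ (0S v) *ᵣ (1ℚ *ᵣ 𝟙ᵣ (π v))) +ᵣ T (λ _ → 1ℚ) π) -ᵣ 1ℚ
        ≡⟨ cong (_-ᵣ 1ℚ) (trans (sym (Σℚ.∑-⊕ allV _ _)) (trans (Σℚ.∑-cong allV (λ v → trans (sym (Σℚ.𝟙-split (0S v) _))
             (trans (ℚₚ.*-identityˡ (𝟙ᵣ (π v))) (sym (ιℕ-𝟙 (π v)))))) (trans (sym (ιℕ-∑ allV _)) (cong ιℕ (size g))))) ⟩
      N ∎
      where open ≡-Reasoning
    N≢0 : N ≢ 0ℚ
    N≢0 p = ℕₚ.<⇒≢ 1≤d (q^-inj {0} {d} (ιℕ-inj (trans ι-1 (sym (trans (solve 1 (λ x → x := (x :- con 1ℚ) :+ con 1ℚ) refl (ιℕ (q ^ d)))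
      (trans (cong (_+ᵣ 1ℚ) p) (ℚₚ.+-identityˡ 1ℚ)))))))
    r : ℚ
    r = proj₁ (ℚ-inverse N≢0)
    r-inv : r *ᵣ N ≡ 1ℚ
    r-inv = proj₂ (ℚ-inverse N≢0)

  span⇒cl : Span 1 χᵣ → IsCLSet ρ L
  span⇒cl s = points , pointList , y , λ π π∈ → let g = inClass⇒ d-even gρ π∈ in
      (λ l → subst (SumIn (_⊆S π) y points) (trans (sym (value π g)) (cong 𝟙ᵣ (does-intro (χ? π) l))) (sumIn-∑ (_⊆? π) y points))
    , (λ l → subst (SumIn (_⊆S π) y points) (trans (sym (value π g)) (cong 𝟙ᵣ (not-true (λ r → l (does-elim (χ? π) r))))) (sumIn-∑ (_⊆? π) y points))
    where
    c c′ : V → ℚ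
    c = proj₁ (span-linear s)
    c′ = proj₁ (spread c)
    y : Sub → ℚ
    y P = ∑Vᵣ (λ v → 𝟙ᵣ (not (0S v)) *ᵣ (c′ v *ᵣ 𝟙ᵣ (P v)))
    value : ∀ π → 𝒢 π → χᵣ π ≡ ∑ᵣ points (λ P → 𝟙ᵣ (does (P ⊆? π)) *ᵣ y P)
    value π g = begin
      χᵣ π
        ≡⟨ trans (proj₂ (span-linear s) π g) (proj₂ (spread c) π (proj₁ g)) ⟩
      ∑Vᵣ (λ v → 𝟙ᵣ (not (0S v)) *ᵣ (c′ v *ᵣ 𝟙ᵣ (π v)))
        ≡⟨ Σℚ.∑-cong allV (λ v → Σℚ.𝟙-on (not (0S v)) (λ n → cong (c′ v *ᵣ_) (trans (sym (ιℕ-𝟙 (π v)))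
             (trans (cong ιℕ (sym (points-count (proj₁ g) v (nonzero v n)))) (ιℕ-∑ points _))))) ⟩
      ∑Vᵣ (λ v → 𝟙ᵣ (not (0S v)) *ᵣ (c′ v *ᵣ ∑ᵣ points (λ P → ιℕ (𝟙 (does (P ⊆? π) ∧ P v)))))
        ≡⟨ Σℚ.∑-cong allV (λ v → trans (sym (ℚₚ.*-assoc (𝟙ᵣ (not (0S v))) (c′ v) _)) (trans (sym (Σℚ.∑-*ˡ points (𝟙ᵣ (not (0S v)) *ᵣ c′ v) _))
             (Σℚ.∑-cong points (λ P → move v P)))) ⟩
      ∑Vᵣ (λ v → ∑ᵣ points (λ P → 𝟙ᵣ (does (P ⊆? π)) *ᵣ (𝟙ᵣ (not (0S v)) *ᵣ (c′ v *ᵣ 𝟙ᵣ (P v)))))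
        ≡⟨ Σℚ.∑-swap allV points _ ⟩
      ∑ᵣ points (λ P → ∑Vᵣ (λ v → 𝟙ᵣ (does (P ⊆? π)) *ᵣ (𝟙ᵣ (not (0S v)) *ᵣ (c′ v *ᵣ 𝟙ᵣ (P v)))))
        ≡⟨ Σℚ.∑-cong points (λ P → Σℚ.∑-*ˡ allV (𝟙ᵣ (does (P ⊆? π))) _) ⟩
      ∑ᵣ points (λ P → 𝟙ᵣ (does (P ⊆? π)) *ᵣ y P) ∎
      where
      open ≡-Reasoning
      nonzero : ∀ v → not (0S v) ≡ true → v ≢ zeroV
      nonzero v n e = false≢true (cong not (0S-intro e)) n
      move : ∀ v P → (𝟙ᵣ (not (0S v)) *ᵣ c′ v) *ᵣ ιℕ (𝟙 (does (P ⊆? π) ∧ P v))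
           ≡ 𝟙ᵣ (does (P ⊆? π)) *ᵣ (𝟙ᵣ (not (0S v)) *ᵣ (c′ v *ᵣ 𝟙ᵣ (P v)))
      move v P = trans (cong ((𝟙ᵣ (not (0S v)) *ᵣ c′ v) *ᵣ_) (trans (ιℕ-𝟙 (does (P ⊆? π) ∧ P v)) (Σℚ.𝟙-∧ (does (P ⊆? π)) (P v))))
        (solve 4 (λ a c s p → (a :* c) :* (s :* p) := s :* (a :* (c :* p))) refl (𝟙ᵣ (not (0S v))) (c′ v) (𝟙ᵣ (does (P ⊆? π))) (𝟙ᵣ (P v)))

  eigen⇒cl : Eigen → IsCLSet ρ L
  eigen⇒cl eig = span⇒cl (by m refl)
    where
    by : ∀ n → n ≡ m → Span 1 χᵣ
    by zero    e = ⊥-elim (ℕₚ.<⇒≢ 1≤d (sym (trans d≡2m (cong (2 *_) (sym e)))))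
    by (suc n) e = descend n (ℕₚ.≤-reflexive e) eig (subst (λ z → Span z χᵣ) (sym e) χ-span)

theorem4p2 : ∀ {q : ℕ} (F : FiniteField q) (d : ℕ) → d % 2 ≡ 0 →
    let open Geometry F d
        open CameronLiebler F d
    in ∀ (ρ : Sub) → IsGenerator ρ →
       ∀ (L : List Sub) → IsGenSetIn ρ L →
       ∀ (i : ℕ) → 1 ≤ i → 2 * i ≤ d →
       IsCLSet ρ L ⇔
         (∀ π → InClass ρ π → ∀ (n : ℕ) →
            CountIn (λ σ → HasDim (σ ∩S π) (d ∸ 2 * i)) L n →
              (π ∈L L → ℕtoℚ n ≡ countIn q d i (param q d (length L)))
            × (¬ (π ∈L L) → ℕtoℚ n ≡ countOut q d i (param q d (length L))))
theorem4p2 {q} F d d-even ρ gen L (inL , distinct) (suc i) _ k≤d =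
  mk⇔ (λ cl → Counts.eigen⇒counts (cl⇒eigen cl)) (λ counts → eigen⇒cl (Counts.counts⇒eigen counts))
  where
  gρ : Classes.IsGen F d ρ
  gρ = Classes.generator⇒ F d gen
  open Main F d d-even gρ L (All.map (Classes.inClass⇒ F d d-even gρ) inL) distinct i k≤d
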